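{- Let $M$ be a finite set of bipartite graphs and let $\mathcal{Y}$ be the class of bipartite graphs containing no graph of $M$ as an si-subgraph. Then $\mathcal{Y}$ has bounded clique-width if and only if $M\cap\mathcal{S}\neq\emptyset$.
   Context: All graphs are finite and simple. For graphs $G_1=(V_1,E_1)$, $G_2=(V_2,E_2)$, $G_1\cap G_2=(V_1\cap V_2,E_1\cap E_2)$. For $G=(V,E)$ and an injective map $\alpha$ on $V$, $G^{\alpha}$ has vertex set $\alpha(V)$ and edge set $\{\{\alpha(v),\alpha(w)\}:\{v,w\}\in E\}$. $H$ is an si-subgraph (self-intersection) of $G$, written $G\xrightarrow{\cap}H$, if $H=G^{\alpha_1}\cap\cdots\cap G^{\alpha_k}$ for some injective maps $\alpha_1,\dots,\alpha_k$ on $V(G)$ (up to isomorphism of $H$). $\mathcal{S}$ denotes the class of forests in which every connected component is a tree with at most three leaves. -}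

module Defs where

open import Data.Nat using (ℕ; zero; suc; _+_)
open import Data.Bool using (Bool; true; false; _∨_; _∧_)
open import Data.Fin using (Fin; zero; suc; splitAt; inject₁; fromℕ; _≟_)
open import Data.List using (List; length; filterᵇ; allFin)
open import Data.Sum using (inj₁; inj₂; [_,_])
open import Data.Product using (Σ; ∃; ∃₂; _×_; _,_; proj₂)
open import Relation.Binary.PropositionalEquality using (_≡_; _≢_)
open import Relation.Nullary using (¬_)
open import Relation.Nullary.Decidable using (⌊_⌋)
open import Function.Definitions using (Injective; Bijective)
open import Level using (Level) renaming (suc to lsuc; zero to lzero)

record Graph (n : ℕ) : Set where
  field
    adj    : Fin n → Fin n → Bool
    sym    : ∀ u v → adj u v ≡ adj v u
    irrefl : ∀ u → adj u u ≡ false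
open Graph public

Bipartite : ∀ {n} → Graph n → Set
Bipartite {n} G = Σ (Fin n → Bool) λ c → ∀ u v → adj G u v ≡ true → c u ≢ c v

-- si-subgraphs.  Injective maps α₁ … α_k (k ≥ 1) from V(G) into the
-- universe ℕ; H is isomorphic to G^{α₁} ∩ … ∩ G^{α_k}, witnessed by an
-- injective f : V(H) → ℕ whose image is exactly ⋂ αᵢ(V(G)) and which
-- maps the edges of H exactly onto the common edges.

SI : ∀ {n m} → Graph n → Graph m → Set
SI {n} {m} G H =
  Σ ℕ λ k → Σ (Fin (suc k) → Fin n → ℕ) λ α →
    (∀ i → Injective _≡_ _≡_ (α i)) ×
    Σ (Fin m → ℕ) λ f →
      Injective _≡_ _≡_ f ×
      (∀ u i → ∃ λ a → α i a ≡ f u) ×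
      (∀ x → (∀ i → ∃ λ a → α i a ≡ x) → ∃ λ u → f u ≡ x) ×
      (∀ u v → (adj H u v ≡ true →
                  ∀ i → ∃₂ λ a b → α i a ≡ f u × α i b ≡ f v × adj G a b ≡ true)
             × ((∀ i → ∃₂ λ a b → α i a ≡ f u × α i b ≡ f v × adj G a b ≡ true)
                  → adj H u v ≡ true))

data Reach {n} (G : Graph n) : Fin n → Fin n → Set where
  here : ∀ {u} → Reach G u u
  step : ∀ {u v w} → adj G u v ≡ true → Reach G v w → Reach G u w

degree : ∀ {n} → Graph n → Fin n → ℕ
degree {n} G v = length (filterᵇ (adj G v) (allFin n))

Leaf : ∀ {n} → Graph n → Fin n → Set
Leaf G v = degree G v ≡ 1

Cycle : ∀ {n} → Graph n → Set
Cycle {n} G = Σ ℕ λ l → Σ (Fin (suc (suc (suc l))) → Fin n) λ c →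
  Injective _≡_ _≡_ c ×
  (∀ (i : Fin (suc (suc l))) → adj G (c (inject₁ i)) (c (suc i)) ≡ true) ×
  adj G (c (fromℕ (suc (suc l)))) (c zero) ≡ true

Forest : ∀ {n} → Graph n → Set
Forest G = ¬ Cycle G

AtMostThreeLeavesPerComponent : ∀ {n} → Graph n → Set
AtMostThreeLeavesPerComponent {n} G =
  ¬ (Σ (Fin 4 → Fin n) λ l → Injective _≡_ _≡_ l ×
       (∀ i → Leaf G (l i)) × (∀ i j → Reach G (l i) (l j)))

InS : ∀ {n} → Graph n → Set
InS G = Forest G × AtMostThreeLeavesPerComponent G

data Expr (k : ℕ) : Set where
  empty  : Expr k
  vertex : Fin k → Expr k
  _⊕_    : Expr k → Expr k → Expr k
  η      : (i j : Fin k) → i ≢ j → Expr k → Expr k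
  ρ      : (i j : Fin k) → Expr k → Expr k

size : ∀ {k} → Expr k → ℕ
size empty       = 0
size (vertex _)  = 1
size (e ⊕ f)     = size e + size f
size (η _ _ _ e) = size e
size (ρ _ _ e)   = size e

label : ∀ {k} (e : Expr k) → Fin (size e) → Fin k
label (vertex i)  _ = i
label (e ⊕ f)     x = [ label e , label f ] (splitAt (size e) x)
label (η _ _ _ e) x = label e x
label (ρ i j e)   x = if′ ⌊ label e x ≟ i ⌋ then j else label e x
  where
  if′_then_else_ : ∀ {A : Set} → Bool → A → A → A
  if′ true  then a else _ = a
  if′ false then _ else b = b

semAdj : ∀ {k} (e : Expr k) → Fin (size e) → Fin (size e) → Bool
semAdj empty       () _
semAdj (vertex _)  _ _ = false
semAdj (e ⊕ f)     x y with splitAt (size e) x | splitAt (size e) y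
... | inj₁ a | inj₁ b = semAdj e a b
... | inj₂ a | inj₂ b = semAdj f a b
... | inj₁ _ | inj₂ _ = false
... | inj₂ _ | inj₁ _ = false
semAdj (η i j _ e) x y =
  semAdj e x y
  ∨ (⌊ label e x ≟ i ⌋ ∧ ⌊ label e y ≟ j ⌋)
  ∨ (⌊ label e x ≟ j ⌋ ∧ ⌊ label e y ≟ i ⌋)
semAdj (ρ _ _ e)   x y = semAdj e x y

CWAtMost : ∀ {n} → Graph n → ℕ → Set
CWAtMost {n} G k = Σ (Expr k) λ e → Σ (Fin n → Fin (size e)) λ f →
  Bijective _≡_ _≡_ f × (∀ u v → adj G u v ≡ semAdj e (f u) (f v))

BoundedCliqueWidth : (∀ {n} → Graph n → Set) → Set
BoundedCliqueWidth P = ∃ λ k → ∀ n (G : Graph n) → P G → CWAtMost G k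

{-# OPTIONS --safe #-}

-- A graph H is an si-subgraph of G exactly when H embeds in G and every non-edge of H is a non-edge in some
-- embedding.  So if H is not an si-subgraph but embeds, it has a stuck pair: two non-adjacent vertices whose images
-- are adjacent under every embedding.
--
-- Let H be in S, that is, an induced subgraph of a disjoint union of subdivided claws, and let G be bipartite without
-- H as an si-subgraph.  In a large biclique of G a stuck pair is ruled out by any outside path that leaves and returns,
-- or that is long: so whatever else lies in its component hangs at single vertices of the biclique and has bounded
-- depth.  In the part without large bicliques there are few disjoint long subdivided claws, since the edges forced by
-- a stuck pair inside a long claw produce new claws, and thereby further edges, until they form a biclique.  Without
-- long claws each component is a longest path with shallow pieces attached locally.  In each case the vertices can be
-- ordered so that every initial segment has boundedly many neighbourhood types, which bounds the clique-width.
--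
-- Conversely, join many long paths pairwise by long paths.  The small subgraphs of this graph are in S, and in a
-- k-expression each subexpression has at most 3k vertices with later neighbours; hence no subexpression can pass from
-- meeting few of the paths to meeting most of them.

module Submission where

open import Defs renaming (sym to adj-sym)
open import Data.Nat using (ℕ; zero; suc; pred; _+_; _*_; _∸_; _≤_; _<_; z≤n; s≤s; >-nonZero)
open import Data.Nat.Properties hiding (_≟_)
import Data.Nat.Properties as ℕₚ
open import Data.Nat.Divisibility using (divides; _∣?_)
open import Data.Nat.Tactic.RingSolver using (solve-∀)
open import Data.Bool using (Bool; true; false; not; _∧_; _∨_; if_then_else_; T?) renaming (T to IsTrue)
import Data.Bool.Properties as Boolₚ
import Data.Bool.Solver
open import Data.Empty using (⊥; ⊥-elim)
open import Data.Unit using (tt)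
open import Data.Fin as Fin using (Fin; zero; suc; toℕ; fromℕ; fromℕ<; inject₁; inject≤; splitAt; _↑ˡ_; _↑ʳ_; combine; remQuot; _≟_)
open import Data.Fin.Properties using (any?; all?; toℕ-injective; toℕ<n; toℕ-fromℕ<; toℕ-inject₁; toℕ-fromℕ; pigeonhole; injective⇒≤; remQuot-combine; combine-remQuot; combine-injective; splitAt-↑ˡ; splitAt-↑ʳ; ↑ˡ-injective; ↑ʳ-injective)
import Data.Fin.Properties as Finₚ
open import Data.Fin.Relation.Unary.Top using (view; ‵fromℕ; ‵inject₁)
open import Data.List using (List; []; _∷_; [_]; _++_; map; concat; length; filter; filterᵇ; reverse; take; drop; lookup; tabulate; allFin)
open import Data.List.Properties using (++-assoc; ++-identityʳ; length-++; length-reverse; length-take; length-tabulate; reverse-++; unfold-reverse; take++drop≡id; ∷-injective; ∷-injectiveˡ; map-++; concat-++; filter-≐)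
open import Data.List.Relation.Unary.All as All using (All; []; _∷_)
import Data.List.Relation.Unary.All.Properties as Allₚ
open import Data.List.Relation.Unary.Any as Any using (Any; here; there)
import Data.List.Relation.Unary.Any.Properties as Anyₚ
open import Data.List.Relation.Unary.AllPairs using (AllPairs; []; _∷_)
import Data.List.Relation.Unary.AllPairs.Properties as AllPairsₚ
open import Data.List.Relation.Unary.Linked using (Linked; []; [-]; _∷_; linked?)
import Algebra.Solver.CommutativeMonoid
open import Data.List.Relation.Unary.Unique.Propositional using (Unique)
open import Data.List.Relation.Unary.Unique.Propositional.Properties as Uniqueₚ using (Unique[x∷xs]⇒x∉xs)
import Data.List.Relation.Unary.Unique.DecPropositional as UniqueDec
open import Data.List.Membership.Propositional using (_∈_; _∉_; find; lose)
open import Data.List.Membership.Propositional.Properties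
import Data.List.Membership.DecPropositional as MemDec
open import Data.List.Relation.Binary.Disjoint.Propositional using (Disjoint)
open import Data.List.Relation.Binary.Permutation.Propositional using (_↭_; prep; ↭⇒↭ₛ; ↭-refl; ↭-sym; ↭-trans; ↭-reflexive)
open import Data.List.Relation.Binary.Permutation.Propositional.Properties using (++-commutativeMonoid; ∈-resp-↭; All-resp-↭; ↭-length; shift; shifts; ↭-reverse) renaming (++⁺ˡ to ↭-++⁺ˡ; ++⁺ʳ to ↭-++⁺ʳ; ++-comm to ↭-++-comm)
import Data.List.Relation.Binary.Permutation.Setoid.Properties as PermS
open import Data.Vec as Vec using (Vec)
import Data.Vec.Properties as Vecₚ
open import Data.Product using (Σ; ∃; ∃₂; _×_; _,_; proj₁; proj₂)
open import Data.Sum as Sum using (_⊎_; inj₁; inj₂; [_,_]′)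
open import Function using (_∘_; id; case_of_)
open import Function.Bundles using (_⇔_; mk⇔)
open import Function.Definitions using (Injective)
open import Relation.Nullary using (¬_; Dec; yes; no)
open import Relation.Nullary.Decidable using (⌊_⌋; map′; _×-dec_; _⊎-dec_; _→-dec_; ¬?; decidable-stable; toWitness)
open import Relation.Binary.Definitions using (tri<; tri≈; tri>)
open import Relation.Binary.PropositionalEquality using (_≡_; _≢_; refl; sym; trans; cong; cong₂; subst; subst₂; setoid; ≢-sym)

-- The strength of a stuck pair is its uniformity: one pair of vertices of `H` is adjacent under all
-- embeddings at once, so every way of relocating `H` in `G` yields a further edge of `G`. In a
-- biclique the task is the opposite one. `H` embeds there by parity alone, and a contradiction
-- needs an embedding that keeps the pair apart. It comes from a path whose first vertex has both a
-- neighbour and a non-neighbour on one side of the biclique; this is why `Hub` enlarges the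
-- biclique until every other vertex has non-neighbours on both sides. Orders are used in place of
-- expressions because their widths compose: a vertex put in front costs one class (`good-cons`),
-- mutually non-adjacent pieces cost one class in total (`good-separated`), and blocks along a spine
-- multiply two widths (`good-blocks`). Deleting boundedly many disjoint claws is therefore
-- harmless. All alternatives are decided by finite search, so stuck pairs, longest paths, claws and
-- bicliques are produced as actual objects.

≤-from-sum : ∀ {L R a b} s → L ≤ R → a + R + s ≡ b + L → a ≤ b
≤-from-sum {L} {R} {a} {b} s p e =
  +-cancelʳ-≤ R a b (≤-trans (m≤m+n (a + R) s) (≤-trans (≤-reflexive e) (+-monoʳ-≤ b p)))

-- Lists: splitting, distinctness, permutation and finite search

module _ {a} {A : Set a} where

  ++-split : ∀ (as : List A) {bs ys zs} → as ++ bs ≡ ys ++ zs →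
    (∃ λ m → as ≡ ys ++ m × zs ≡ m ++ bs) ⊎ (∃ λ m → ys ≡ as ++ m × bs ≡ m ++ zs)
  ++-split [] {ys = ys} e = inj₂ (ys , refl , e)
  ++-split (x ∷ as) {ys = []} e = inj₁ (x ∷ as , refl , sym e)
  ++-split (x ∷ as) {ys = y ∷ ys} e with ∷-injective e
  ... | refl , e′ with ++-split as e′
  ...   | inj₁ (m , p , q) = inj₁ (m , cong (x ∷_) p , q)
  ...   | inj₂ (m , p , q) = inj₂ (m , cong (x ∷_) p , q)

  unique-++⁻ : ∀ (xs : List A) {ys} → Unique (xs ++ ys) → Unique xs × Unique ys × Disjoint xs ys
  unique-++⁻ [] u = [] , u , λ { (() , _) }
  unique-++⁻ (x ∷ xs) (px ∷ u) with unique-++⁻ xs u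
  ... | ux , uy , d =
    Allₚ.++⁻ˡ xs px ∷ ux , uy ,
    λ { (here refl , q) → All.lookup (Allₚ.++⁻ʳ xs px) q refl ; (there p , q) → d (p , q) }

  unique-++⁺ : ∀ {xs ys : List A} → Unique xs → Unique ys → Disjoint xs ys → Unique (xs ++ ys)
  unique-++⁺ = Uniqueₚ.++⁺

  unique-∷⁺ : ∀ {x} {xs : List A} → x ∉ xs → Unique xs → Unique (x ∷ xs)
  unique-∷⁺ x∉ u = Allₚ.¬Any⇒All¬ _ x∉ ∷ u

  unique-↭ : ∀ {xs ys : List A} → xs ↭ ys → Unique xs → Unique ys
  unique-↭ = PermS.Unique-resp-↭ (setoid A) ∘ ↭⇒↭ₛ

  unique-take : ∀ k {xs : List A} → Unique xs → Unique (take k xs)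
  unique-take k u = AllPairsₚ.take⁺ k u

  unique-reverse : ∀ {xs : List A} → Unique xs → Unique (reverse xs)
  unique-reverse {xs} = unique-↭ (↭-sym (↭-reverse xs))

  ∈-reverse⁻ : ∀ {x} {xs : List A} → x ∈ reverse xs → x ∈ xs
  ∈-reverse⁻ {xs = xs} = ∈-resp-↭ (↭-reverse xs)

  ∈-reverse⁺ : ∀ {x} {xs : List A} → x ∈ xs → x ∈ reverse xs
  ∈-reverse⁺ {xs = xs} = ∈-resp-↭ (↭-sym (↭-reverse xs))

  ∈-take⁻ : ∀ k {x} {xs : List A} → x ∈ take k xs → x ∈ xs
  ∈-take⁻ k {xs = xs} p = subst (_ ∈_) (take++drop≡id k xs) (∈-++⁺ˡ p)

  ∈-take-++ : ∀ k (as : List A) {x bs} → length as < k → x ∈ take k (as ++ x ∷ bs)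
  ∈-take-++ (suc k) [] p = here refl
  ∈-take-++ (suc k) (a ∷ as) (s≤s p) = there (∈-take-++ k as p)

  length-take-≤ : ∀ k {xs : List A} → k ≤ length xs → length (take k xs) ≡ k
  length-take-≤ k {xs} p = trans (length-take k xs) (m≤n⇒m⊓n≡m p)

  abstract
    remove : ∀ {x} {xs : List A} → x ∈ xs → ∃ λ ys → xs ↭ x ∷ ys
    remove p with ∈-∃++ p
    ... | as , bs , refl = as ++ bs , shift _ as bs

    extract : ∀ {vs U : List A} → Unique vs → All (_∈ U) vs → ∃ λ U′ → U ↭ vs ++ U′
    extract {[]} {U} _ _ = U , ↭-refl
    extract {v ∷ vs} (pv ∷ u) (v∈ ∷ vs∈) with remove v∈
    ... | U₁ , e with extract {vs} {U₁} u (All.tabulate λ {w} w∈ → drop-head w∈ (∈-resp-↭ e (All.lookup vs∈ w∈)))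
      where
      drop-head : ∀ {w} → w ∈ vs → w ∈ v ∷ U₁ → w ∈ U₁
      drop-head w∈ (here refl) = ⊥-elim (All.lookup pv w∈ refl)
      drop-head _ (there q) = q
    ...   | U₂ , e₂ = U₂ , ↭-trans e (prep v e₂)

  filter-split : ∀ {p} {P : A → Set p} (P? : ∀ x → Dec (P x)) xs →
    xs ↭ filter P? xs ++ filter (¬? ∘ P?) xs
  filter-split P? [] = ↭-refl
  filter-split P? (x ∷ xs) with P? x
  ... | yes _ = prep x (filter-split P? xs)
  ... | no _ = ↭-trans (prep x (filter-split P? xs)) (↭-sym (shift x (filter P? xs) _))

  lookup-unique : ∀ {xs : List A} → Unique xs → ∀ {i j} → lookup xs i ≡ lookup xs j → i ≡ j
  lookup-unique (_ ∷ _) {zero} {zero} _ = refl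
  lookup-unique (p ∷ _) {zero} {suc j} e = ⊥-elim (All.lookup p (∈-lookup j) e)
  lookup-unique (p ∷ _) {suc i} {zero} e = ⊥-elim (All.lookup p (∈-lookup i) (sym e))
  lookup-unique (_ ∷ u) {suc i} {suc j} e = cong suc (lookup-unique u e)

unique-length : ∀ {n} {xs : List (Fin n)} → Unique xs → length xs ≤ n
unique-length {xs = xs} u = injective⇒≤ {f = lookup xs} (lookup-unique u)

-- The finite search that decides whether there are claws, bicliques and longer paths: each of them
-- is coded by lists of known lengths over the vertices.
anyList? : ∀ {n p} l {P : List (Fin n) → Set p} → (∀ xs → Dec (P xs)) →
  Dec (∃ λ xs → length xs ≡ l × P xs)
anyList? zero P? = map′ (λ p → [] , refl , p) (λ { ([] , _ , p) → p }) (P? [])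
anyList? (suc l) P? =
  map′ (λ { (x , xs , e , p) → x ∷ xs , cong suc e , p })
       (λ { (x ∷ xs , e , p) → x , xs , suc-injective e , p })
       (any? λ x → anyList? l (λ xs → P? (x ∷ xs)))

anyVec? : ∀ {n p} l {P : Vec (Fin n) l → Set p} → (∀ xs → Dec (P xs)) → Dec (∃ P)
anyVec? zero P? = map′ (λ p → Vec.[] , p) (λ { (Vec.[] , p) → p }) (P? Vec.[])
anyVec? (suc l) P? =
  map′ (λ { (x , xs , p) → x Vec.∷ xs , p }) (λ { (x Vec.∷ xs , p) → x , xs , p })
       (any? λ x → anyVec? l (λ xs → P? (x Vec.∷ xs)))

-- Self-intersections through embeddings

record Emb {m n} (H : Graph m) (G : Graph n) : Set where
  field
    fn  : Fin m → Fin n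
    inj : Injective _≡_ _≡_ fn
    hom : ∀ {u v} → adj H u v ≡ true → adj G (fn u) (fn v) ≡ true
open Emb

irrefl′ : ∀ {n} (G : Graph n) {u} → adj G u u ≡ true → ⊥
irrefl′ G {u} e with trans (sym e) (irrefl G u)
... | ()

module _ {m n} {H : Graph m} {G : Graph n} where

  SI⇒Emb : SI G H → Emb H G
  SI⇒Emb (k , α , α-inj , f , f-inj , image , _ , edges) = record
    { fn  = g
    ; inj = λ {u} {v} e → f-inj (trans (sym (g-eq u)) (trans (cong (α zero) e) (g-eq v)))
    ; hom = λ {u} {v} e → case proj₁ (edges u v) e zero of λ
        { (a , b , p , q , r) →
          subst₂ (λ a b → adj G a b ≡ true)
            (α-inj zero (trans p (sym (g-eq u)))) (α-inj zero (trans q (sym (g-eq v)))) r } }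
    where
    g : Fin m → Fin n
    g u = proj₁ (image u zero)
    g-eq : ∀ u → α zero (g u) ≡ f u
    g-eq u = proj₂ (image u zero)

  -- The vertices outside the embedded copy of H get names above m that depend on i, so that they
  -- disappear from an intersection of copies with different indices.
  private
    name : Emb H G → ℕ → Fin n → ℕ
    name e i v with any? (λ u → fn e u ≟ v)
    ... | yes (u , _) = toℕ u
    ... | no _ = m + (i * n + toℕ v)

    name-image : ∀ e i u → name e i (fn e u) ≡ toℕ u
    name-image e i u with any? (λ u′ → fn e u′ ≟ fn e u)
    ... | yes (u′ , p) = cong toℕ (inj e p)
    ... | no ¬p = ⊥-elim (¬p (u , refl))

    name-inj : ∀ e i → Injective _≡_ _≡_ (name e i)
    name-inj e i {v} {w} p with any? (λ u → fn e u ≟ v) | any? (λ u → fn e u ≟ w)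
    ... | yes (u , refl) | yes (u′ , refl) = cong (fn e) (toℕ-injective p)
    ... | yes (u , _) | no _ = ⊥-elim (<⇒≢ (<-≤-trans (toℕ<n u) (m≤m+n m _)) p)
    ... | no _ | yes (u , _) = ⊥-elim (<⇒≢ (<-≤-trans (toℕ<n u) (m≤m+n m _)) (sym p))
    ... | no _ | no _ = toℕ-injective (+-cancelˡ-≡ (i * n) _ _ (+-cancelˡ-≡ m _ _ p))

    -- Private names of copy 0 lie below `m + n` and those of copy 1 at or above it, so a shared
    -- name must be the name of a vertex of `H`.
    name-common : ∀ e e′ v w → name e 0 v ≡ name e′ 1 w → ∃ λ u → toℕ u ≡ name e 0 v
    name-common e e′ v w p with any? (λ u → fn e u ≟ v) | any? (λ u → fn e′ u ≟ w)
    ... | yes (u , _) | _ = u , refl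
    ... | no _ | yes (u , _) = u , sym p
    ... | no _ | no _ = ⊥-elim (<⇒≢ (<-≤-trans (toℕ<n v) (≤-trans (m≤m+n n 0) (m≤m+n (n + 0) _)))
                          (+-cancelˡ-≡ m _ _ p))

  SI-from-embeddings : Emb H G →
    (∀ x y → x ≢ y → adj H x y ≡ false → Σ (Emb H G) λ e → adj G (fn e x) (fn e y) ≡ false) → SI G H
  SI-from-embeddings e₀ sep =
    -- Copies 0 and 1 both use `e₀`: their private names differ, so they already cut the common
    -- vertex set down to that of `H`. One further copy for each pair of vertices removes a surplus
    -- edge at that pair.
    suc (m * m) , (λ i → name (φ i) (toℕ i)) , (λ i → name-inj (φ i) (toℕ i)) ,
    toℕ , toℕ-injective ,
    (λ u i → fn (φ i) u , name-image (φ i) (toℕ i) u) ,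
    common ,
    λ u v → (λ e i → fn (φ i) u , fn (φ i) v , name-image (φ i) (toℕ i) u , name-image (φ i) (toℕ i) v , hom (φ i) e)
           , edge u v
    where
    pick : Fin m × Fin m → Emb H G
    pick (x , y) with x ≟ y | adj H x y Boolₚ.≟ false
    ... | no x≢y | yes nxy = proj₁ (sep x y x≢y nxy)
    ... | _ | _ = e₀

    pick-sep : ∀ x y → x ≢ y → adj H x y ≡ false → adj G (fn (pick (x , y)) x) (fn (pick (x , y)) y) ≡ false
    pick-sep x y x≢y nxy with x ≟ y | adj H x y Boolₚ.≟ false
    ... | yes p | _ = ⊥-elim (x≢y p)
    ... | no x≢y′ | yes nxy′ = proj₂ (sep x y x≢y′ nxy′)
    ... | no _ | no q = ⊥-elim (q nxy)

    φ : Fin (suc (suc (m * m))) → Emb H G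
    φ (suc (suc i)) = pick (remQuot m i)
    φ _ = e₀

    common : ∀ x → (∀ i → ∃ λ a → name (φ i) (toℕ i) a ≡ x) → ∃ λ u → toℕ u ≡ x
    common x h with h zero | h (suc zero)
    ... | v , p | w , q with name-common e₀ e₀ v w (trans p (sym q))
    ...   | u , r = u , trans r p

    at : ∀ i {u a} → name (φ i) (toℕ i) a ≡ toℕ u → fn (φ i) u ≡ a
    at i {u} p = name-inj (φ i) (toℕ i) (trans (name-image (φ i) (toℕ i) u) (sym p))

    edge : ∀ u v →
      (∀ i → ∃₂ λ a b → name (φ i) (toℕ i) a ≡ toℕ u × name (φ i) (toℕ i) b ≡ toℕ v × adj G a b ≡ true) →
      adj H u v ≡ true
    edge u v h with adj H u v in eq
    ... | true = refl
    ... | false with u ≟ v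
    ...   | yes refl with h zero
    ...     | a , b , p , q , r = ⊥-elim (irrefl′ G (subst (λ c → adj G c b ≡ true) (name-inj e₀ 0 (trans p (sym q))) r))
    edge u v h | false | no u≢v with h (suc (suc (combine u v)))
    ... | a , b , p , q , r =
      case trans (sym r) (trans (cong₂ (adj G) (sym (at _ {u} p)) (sym (at _ {v} q))) apart) of λ ()
      where
      apart : adj G (fn (pick (remQuot m (combine u v))) u) (fn (pick (remQuot m (combine u v))) v) ≡ false
      apart = subst (λ e → adj G (fn e u) (fn e v) ≡ false)
        (cong pick (sym (remQuot-combine u v))) (pick-sep u v u≢v eq)

  -- Vectors instead of functions, so that the existence of an embedding, with or without a
  -- prescribed non-edge, is a finite search.
  Emb-from-vec : Vec (Fin n) m → Set
  Emb-from-vec v = (∀ x y → Vec.lookup v x ≡ Vec.lookup v y → x ≡ y) ×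
    (∀ x y → adj H x y ≡ true → adj G (Vec.lookup v x) (Vec.lookup v y) ≡ true)

  Emb-from-vec? : ∀ v → Dec (Emb-from-vec v)
  Emb-from-vec? v = (all? λ x → all? λ y → (Vec.lookup v x ≟ Vec.lookup v y) →-dec (x ≟ y)) ×-dec
    (all? λ x → all? λ y → (adj H x y Boolₚ.≟ true) →-dec (adj G (Vec.lookup v x) (Vec.lookup v y) Boolₚ.≟ true))

  to-vec : (e : Emb H G) → Emb-from-vec (Vec.tabulate (fn e))
  to-vec e =
    (λ x y p → inj e (trans (sym (Vecₚ.lookup∘tabulate (fn e) x)) (trans p (Vecₚ.lookup∘tabulate (fn e) y)))) ,
    (λ x y p → trans (cong₂ (adj G) (Vecₚ.lookup∘tabulate (fn e) x) (Vecₚ.lookup∘tabulate (fn e) y)) (hom e p))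

  from-vec : ∀ v → Emb-from-vec v → Emb H G
  from-vec v (i , h) = record { fn = Vec.lookup v ; inj = λ {x} {y} → i x y ; hom = λ {x} {y} → h x y }

  emb? : Dec (Emb H G)
  emb? = map′ (λ (v , p) → from-vec v p) (λ e → Vec.tabulate (fn e) , to-vec e) (anyVec? m Emb-from-vec?)

  Stuck : Fin m → Fin m → Set
  Stuck x y = x ≢ y × adj H x y ≡ false × (∀ (e : Emb H G) → adj G (fn e x) (fn e y) ≡ true)

  separating? : ∀ x y → Dec (Σ (Emb H G) λ e → adj G (fn e x) (fn e y) ≡ false)
  separating? x y =
    map′ (λ (v , p , q) → from-vec v p , q)
         (λ (e , q) → Vec.tabulate (fn e) , to-vec e ,
            trans (cong₂ (adj G) (Vecₚ.lookup∘tabulate (fn e) x) (Vecₚ.lookup∘tabulate (fn e) y)) q)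
         (anyVec? m λ v → Emb-from-vec? v ×-dec (adj G (Vec.lookup v x) (Vec.lookup v y) Boolₚ.≟ false))

  stuck-pair : ¬ SI G H → Emb H G → ∃₂ Stuck
  stuck-pair ¬si e₀ with any? (λ x → any? (λ y →
      ¬? (x ≟ y) ×-dec (adj H x y Boolₚ.≟ false) ×-dec ¬? (separating? x y)))
  ... | yes (x , y , x≢y , nxy , ¬sep) = x , y , x≢y , nxy , λ e → Boolₚ.¬-not λ q → ¬sep (e , q)
  ... | no ¬p = ⊥-elim (¬si (SI-from-embeddings e₀ λ x y x≢y nxy →
                  decidable-stable (separating? x y) λ ¬sep → ¬p (x , y , x≢y , nxy , ¬sep)))

-- Clique-width from linear orders

record Lab {n} (G : Graph n) (k : ℕ) (ys zs : List (Fin n)) : Set where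
  field
    lab  : Fin n → Fin k
    same : ∀ {x x′ z} → x ∈ ys → x′ ∈ ys → lab x ≡ lab x′ → z ∈ zs → adj G x z ≡ adj G x′ z
open Lab

-- A bound on the neighbourhood-width of the linear layout `xs`: at every cut the vertices already
-- listed have at most `k` different neighbourhoods among those still to come.
Good : ∀ {n} → Graph n → ℕ → List (Fin n) → Set
Good G k xs = ∀ ys zs → xs ≡ ys ++ zs → Lab G k ys zs

-- The relation `R` is a parameter because a new vertex is drawn without its edges and receives them
-- by later joins. Since `R` and `lab` are defined on all vertices, stages can be compared pointwise
-- by `drawn-ext`.
record Drawn {n K} (ys : List (Fin n)) (R : Fin n → Fin n → Bool) (lab : Fin n → Fin K) : Set where
  field
    e      : Expr K
    g      : Fin (size e) → Fin n
    g-inj  : Injective _≡_ _≡_ g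
    g∈     : ∀ a → g a ∈ ys
    cover  : ∀ {v} → v ∈ ys → ∃ λ a → g a ≡ v
    sem    : ∀ a b → semAdj e a b ≡ R (g a) (g b)
    labels : ∀ a → label e a ≡ lab (g a)
mem : ∀ {K} → List (Fin K) → Fin K → Bool
mem [] l = false
mem (i ∷ is) l = ⌊ l ≟ i ⌋ ∨ mem is l

∈⇒mem : ∀ {K} {l : Fin K} {is} → l ∈ is → mem is l ≡ true
∈⇒mem {l = l} {i ∷ is} p with l ≟ i
... | yes _ = refl
∈⇒mem (here q) | no ¬q = ⊥-elim (¬q q)
∈⇒mem (there p) | no _ = ∈⇒mem p

mem⇒∈ : ∀ {K} {l : Fin K} is → mem is l ≡ true → l ∈ is
mem⇒∈ {l = l} (i ∷ is) p with l ≟ i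
... | yes q = here q
... | no _ = there (mem⇒∈ is p)

module _ {n K : ℕ} where

  open Drawn

  drawn-empty : ∀ {R} {lab : Fin n → Fin K} → Drawn [] R lab
  drawn-empty = record
    { e = empty ; g = λ () ; g-inj = λ { {()} } ; g∈ = λ () ; cover = λ () ; sem = λ () ; labels = λ () }

  drawn-ext : ∀ {ys ys′ R R′} {lab lab′ : Fin n → Fin K} → Drawn ys R lab →
    (∀ {v} → v ∈ ys → v ∈ ys′) → (∀ {v} → v ∈ ys′ → v ∈ ys) →
    (∀ {u v} → u ∈ ys → v ∈ ys → R u v ≡ R′ u v) → (∀ {u} → u ∈ ys → lab u ≡ lab′ u) → Drawn ys′ R′ lab′
  drawn-ext d to from r l = record
    { e = e d ; g = g d ; g-inj = g-inj d ; g∈ = to ∘ g∈ d ; cover = cover d ∘ from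
    ; sem = λ a b → trans (sem d a b) (r (g∈ d a) (g∈ d b))
    ; labels = λ a → trans (labels d a) (l (g∈ d a)) }

  drawn-η : ∀ {ys R} {lab : Fin n → Fin K} i j → i ≢ j → Drawn ys R lab →
    Drawn ys (λ u v → R u v ∨ (⌊ lab u ≟ i ⌋ ∧ ⌊ lab v ≟ j ⌋) ∨ (⌊ lab u ≟ j ⌋ ∧ ⌊ lab v ≟ i ⌋)) lab
  drawn-η i j i≢j d = record
    { e = η i j i≢j (e d) ; g = g d ; g-inj = g-inj d ; g∈ = g∈ d ; cover = cover d
    ; sem = λ a b → cong₂ _∨_ (sem d a b)
        (cong₂ (λ x y → (⌊ x ≟ i ⌋ ∧ ⌊ y ≟ j ⌋) ∨ (⌊ x ≟ j ⌋ ∧ ⌊ y ≟ i ⌋)) (labels d a) (labels d b))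
    ; labels = labels d }

  drawn-ρ : ∀ {ys R} {lab : Fin n → Fin K} i j → Drawn ys R lab →
    Drawn ys R (λ v → if ⌊ lab v ≟ i ⌋ then j else lab v)
  drawn-ρ {lab = lab} i j d = record
    { e = ρ i j (e d) ; g = g d ; g-inj = g-inj d ; g∈ = g∈ d ; cover = cover d ; sem = sem d ; labels = lbl }
    where
    lbl : ∀ a → label (ρ i j (e d)) a ≡ (if ⌊ lab (g d a) ≟ i ⌋ then j else lab (g d a))
    lbl a rewrite sym (labels d a) with label (e d) a ≟ i
    ... | yes _ = refl
    ... | no _ = refl

  drawn-add : ∀ {ys R R′} {lab lab′ : Fin n → Fin K} {z} → Drawn ys R lab → z ∉ ys →
    (∀ {u v} → u ∈ ys → v ∈ ys → R u v ≡ R′ u v) → (∀ v → R′ z v ≡ false) → (∀ v → R′ v z ≡ false) →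
    (∀ {u} → u ∈ ys → lab u ≡ lab′ u) → Drawn (z ∷ ys) R′ lab′
  drawn-add {ys} {R} {R′} {lab} {lab′} {z} d z∉ r rz rz′ l = record
    { e = e d ⊕ vertex (lab′ z) ; g = g′ ; g-inj = inj′ ; g∈ = in′ ; cover = cov ; sem = sem′ ; labels = lbl }
    where
    s = size (e d)
    g′ : Fin (s + 1) → Fin n
    g′ x = [ g d , (λ _ → z) ]′ (splitAt s x)
    inj′ : Injective _≡_ _≡_ g′
    inj′ {x} {y} p with splitAt s x in ex | splitAt s y in ey
    ... | inj₁ a | inj₁ b = trans (sym (Finₚ.splitAt⁻¹-↑ˡ ex)) (trans (cong (_↑ˡ 1) (g-inj d p)) (Finₚ.splitAt⁻¹-↑ˡ ey))
    ... | inj₁ a | inj₂ _ = ⊥-elim (z∉ (subst (_∈ ys) p (g∈ d a)))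
    ... | inj₂ _ | inj₁ b = ⊥-elim (z∉ (subst (_∈ ys) (sym p) (g∈ d b)))
    ... | inj₂ zero | inj₂ zero = trans (sym (Finₚ.splitAt⁻¹-↑ʳ {m = s} ex)) (Finₚ.splitAt⁻¹-↑ʳ {m = s} ey)
    in′ : ∀ x → g′ x ∈ z ∷ ys
    in′ x with splitAt s x
    ... | inj₁ a = there (g∈ d a)
    ... | inj₂ _ = here refl
    cov : ∀ {v} → v ∈ z ∷ ys → ∃ λ a → g′ a ≡ v
    cov (here refl) = s ↑ʳ zero , cong [ g d , (λ _ → z) ]′ (splitAt-↑ʳ s 1 zero)
    cov (there p) with cover d p
    ... | a , q = a ↑ˡ 1 , trans (cong [ g d , (λ _ → z) ]′ (splitAt-↑ˡ s a 1)) q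
    sem′ : ∀ a b → semAdj (e d ⊕ vertex (lab′ z)) a b ≡ R′ (g′ a) (g′ b)
    sem′ x y with splitAt s x | splitAt s y
    ... | inj₁ a | inj₁ b = trans (sem d a b) (r (g∈ d a) (g∈ d b))
    ... | inj₁ a | inj₂ _ = sym (rz′ _)
    ... | inj₂ _ | inj₁ b = sym (rz _)
    ... | inj₂ _ | inj₂ _ = sym (rz _)
    lbl : ∀ a → label (e d ⊕ vertex (lab′ z)) a ≡ lab′ (g′ a)
    lbl x with splitAt s x
    ... | inj₁ a = trans (labels d a) (l (g∈ d a))
    ... | inj₂ _ = refl

  -- Relabelling by an idempotent map can be done one label at a time: a target is never moved again.
  drawn-relabel : ∀ {ys R} {lab : Fin n → Fin K} (φ : Fin K → Fin K) → (∀ i → φ (φ i) ≡ φ i) →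
    Drawn ys R lab → Drawn ys R (φ ∘ lab)
  drawn-relabel {ys} {R} {lab} φ idem d =
    drawn-ext (go (allFin K)) id id (λ _ _ → refl) (λ {u} _ → cong (λ b → if b then φ (lab u) else lab u) (∈⇒mem (∈-allFin (lab u))))
    where
    relab : List (Fin K) → Fin n → Fin K
    relab is v = if mem is (lab v) then φ (lab v) else lab v
    go : ∀ is → Drawn ys R (relab is)
    go [] = drawn-ext d id id (λ _ _ → refl) (λ _ → refl)
    go (i ∷ is) = drawn-ext (drawn-ρ i (φ i) (go is)) id id (λ _ _ → refl) (λ {u} _ → eq u)
      where
      eq : ∀ u → (if ⌊ relab is u ≟ i ⌋ then φ i else relab is u) ≡ relab (i ∷ is) u
      eq u with mem is (lab u)
      eq u | true with φ (lab u) ≟ i | lab u ≟ i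
      ... | yes p | yes _ = trans (cong φ (sym p)) (idem (lab u))
      ... | yes p | no _ = trans (cong φ (sym p)) (idem (lab u))
      ... | no _ | yes _ = refl
      ... | no _ | no _ = refl
      eq u | false with lab u ≟ i
      ... | yes p = cong φ (sym p)
      ... | no _ = refl

  drawn-join : ∀ {ys R} {lab : Fin n → Fin K} (✦ : Fin K) (is : List (Fin K)) → ✦ ∉ is → Drawn ys R lab →
    Drawn ys (λ u v → R u v ∨ (mem is (lab u) ∧ ⌊ lab v ≟ ✦ ⌋) ∨ (⌊ lab u ≟ ✦ ⌋ ∧ mem is (lab v))) lab
  drawn-join {ys} {R} {lab} ✦ [] _ d = drawn-ext d id id (λ {u} {v} _ _ → eq (R u v) ⌊ lab u ≟ ✦ ⌋) (λ _ → refl)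
    where
    eq : ∀ a p → a ≡ a ∨ false ∨ (p ∧ false)
    eq true p = refl
    eq false true = refl
    eq false false = refl
  drawn-join {ys} {R} {lab} ✦ (i ∷ is) ✦∉ d =
    drawn-ext (drawn-η i ✦ (λ p → ✦∉ (here (sym p))) (drawn-join ✦ is (✦∉ ∘ there) d)) id id
      (λ {u} {v} _ _ → eq (R u v) ⌊ lab u ≟ i ⌋ (mem is (lab u)) ⌊ lab v ≟ ✦ ⌋ ⌊ lab u ≟ ✦ ⌋ ⌊ lab v ≟ i ⌋ (mem is (lab v)))
      (λ _ → refl)
    where
    open Data.Bool.Solver.∨-∧-Solver using (_:+_; _:*_; _:=_) renaming (solve to solve∨)
    eq : ∀ a p q s t p′ q′ → (a ∨ (q ∧ s) ∨ (t ∧ q′)) ∨ (p ∧ s) ∨ (t ∧ p′) ≡ a ∨ ((p ∨ q) ∧ s) ∨ (t ∧ (p′ ∨ q′))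
    eq = solve∨ 7 (λ a p q s t p′ q′ →
      ((a :+ ((q :* s) :+ (t :* q′))) :+ ((p :* s) :+ (t :* p′))) :=
      (a :+ (((p :+ q) :* s) :+ (t :* (p′ :+ q′))))) refl

module _ {n : ℕ} (G : Graph n) (k : ℕ) where

  open Drawn

  private
    -- One label for the vertex being added, a block A for the current labels, a block B for the next ones.
    K : ℕ
    K = suc (k + k)
    A B : Fin k → Fin K
    A i = suc (i ↑ˡ k)
    B i = suc (k ↑ʳ i)
    A-inj : ∀ {i j} → A i ≡ A j → i ≡ j
    A-inj p = ↑ˡ-injective k _ _ (Finₚ.suc-injective p)

    record Built (ys zs : List (Fin n)) : Set where
      field
        cls   : Lab G k ys zs
        drawn : Drawn ys (adj G) (A ∘ lab cls)

    module Step {ys zs : List (Fin n)} {z : Fin n} (b : Built ys (z ∷ zs)) (z∉ : z ∉ ys) (L : Lab G k (z ∷ ys) zs) where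
      open Built b
      old = lab cls

      -- An expression can only move whole labels, yet two vertices of one old class may lie in
      -- different classes of `L`. A representative decides for the whole class; this is sound
      -- because all its members have the same neighbours among the vertices to come.
      φA : Fin k → Fin k
      φA l with Any.any? (λ x → old x ≟ l) ys
      ... | yes p = lab L (proj₁ (find p))
      ... | no _ = l

      new : Fin n → Fin k
      new v with v ≟ z
      ... | yes _ = lab L z
      ... | no _ = φA (old v)

      rep : ∀ {x} → x ∈ ys → ∃ λ x′ → x′ ∈ ys × old x′ ≡ old x × φA (old x) ≡ lab L x′
      rep {x} x∈ with Any.any? (λ x′ → old x′ ≟ old x) ys
      ... | yes p = proj₁ (find p) , proj₁ (proj₂ (find p)) , proj₂ (proj₂ (find p)) , refl
      ... | no ¬p = ⊥-elim (¬p (lose x∈ refl))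

      new-rep : ∀ {x} → x ∈ z ∷ ys → ∃ λ x′ → x′ ∈ z ∷ ys × new x ≡ lab L x′ × (∀ {w} → w ∈ zs → adj G x w ≡ adj G x′ w)
      new-rep {x} x∈ with x ≟ z
      ... | yes refl = z , here refl , refl , λ _ → refl
      new-rep (here p) | no x≢ = ⊥-elim (x≢ p)
      new-rep (there x∈) | no x≢ with rep x∈
      ... | x′ , x′∈ , p , q = x′ , there x′∈ , q , λ w∈ → same cls x∈ x′∈ (sym p) (there w∈)

      cls′ : Lab G k (z ∷ ys) zs
      cls′ = record { lab = new ; same = λ x∈ x′∈ p w∈ → same′ (new-rep x∈) (new-rep x′∈) p w∈ }
        where
        same′ : ∀ {x x′ w} →
          (∃ λ y → y ∈ z ∷ ys × new x ≡ lab L y × (∀ {w} → w ∈ zs → adj G x w ≡ adj G y w)) →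
          (∃ λ y → y ∈ z ∷ ys × new x′ ≡ lab L y × (∀ {w} → w ∈ zs → adj G x′ w ≡ adj G y w)) →
          new x ≡ new x′ → w ∈ zs → adj G x w ≡ adj G x′ w
        same′ (y , y∈ , p , f) (y′ , y′∈ , p′ , f′) q w∈ =
          trans (f w∈) (trans (same L y∈ y′∈ (trans (sym p) (trans q p′)) w∈) (sym (f′ w∈)))

      lab₁ : Fin n → Fin K
      lab₁ v with v ≟ z
      ... | yes _ = zero
      ... | no _ = A (old v)

      R₁ : Fin n → Fin n → Bool
      R₁ u v = adj G u v ∧ (not ⌊ u ≟ z ⌋ ∧ not ⌊ v ≟ z ⌋)

      d₁ : Drawn (z ∷ ys) R₁ lab₁
      d₁ = drawn-add drawn z∉ keep dead₁ dead₂ keepₗ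
        where
        keep : ∀ {u v} → u ∈ ys → v ∈ ys → adj G u v ≡ R₁ u v
        keep {u} {v} u∈ v∈ with u ≟ z | v ≟ z
        ... | yes refl | _ = ⊥-elim (z∉ u∈)
        ... | no _ | yes refl = ⊥-elim (z∉ v∈)
        ... | no _ | no _ = sym (Boolₚ.∧-identityʳ _)
        dead₁ : ∀ v → R₁ z v ≡ false
        dead₁ v with z ≟ z
        ... | yes _ = Boolₚ.∧-zeroʳ _
        ... | no q = ⊥-elim (q refl)
        dead₂ : ∀ v → R₁ v z ≡ false
        dead₂ v with z ≟ z
        ... | yes _ = trans (cong (adj G v z ∧_) (Boolₚ.∧-zeroʳ _)) (Boolₚ.∧-zeroʳ _)
        ... | no q = ⊥-elim (q refl)
        keepₗ : ∀ {u} → u ∈ ys → A (old u) ≡ lab₁ u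
        keepₗ {u} u∈ with u ≟ z
        ... | yes refl = ⊥-elim (z∉ u∈)
        ... | no _ = refl

      Hit : Fin k → Set
      Hit l = Any (λ x → old x ≡ l × adj G x z ≡ true) ys
      hit? : ∀ l → Dec (Hit l)
      hit? l = Any.any? (λ x → (old x ≟ l) ×-dec (adj G x z Boolₚ.≟ true)) ys
      hits : List (Fin K)
      hits = map A (filter hit? (allFin k))

      zero∉hits : zero ∉ hits
      zero∉hits p with ∈-map⁻ A p
      ... | _ , _ , ()

      mem-zero : mem hits zero ≡ false
      mem-zero = Boolₚ.¬-not (λ p → zero∉hits (mem⇒∈ hits p))

      -- The old classes agree on `z`, which heads the undrawn vertices; hence a class that contains
      -- one neighbour of `z` consists of neighbours, and joining whole labels draws exactly the
      -- edges at `z`.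
      mem-hit : ∀ {v} → v ∈ ys → mem hits (A (old v)) ≡ adj G v z
      mem-hit {v} v∈ with adj G v z in eq
      ... | true = ∈⇒mem (∈-map⁺ A (∈-filter⁺ hit? (∈-allFin (old v)) (lose v∈ (refl , eq))))
      ... | false = Boolₚ.¬-not miss
        where
        miss : mem hits (A (old v)) ≢ true
        miss p with ∈-map⁻ A (mem⇒∈ hits p)
        ... | l , l∈ , q with find (proj₂ (∈-filter⁻ hit? {xs = allFin k} l∈))
        ...   | x , x∈ , r , xz = case trans (sym eq) (trans (same cls v∈ x∈ (trans (A-inj q) (sym r)) (here refl)) xz) of λ ()

      d₂ : Drawn (z ∷ ys) (adj G) lab₁
      d₂ = drawn-ext (drawn-join zero hits zero∉hits d₁) id id eq (λ _ → refl)
        where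
        tail∈ : ∀ {u} → u ∈ z ∷ ys → u ≢ z → u ∈ ys
        tail∈ (here p) q = ⊥-elim (q p)
        tail∈ (there p) _ = p
        eq : ∀ {u v} → u ∈ z ∷ ys → v ∈ z ∷ ys →
          R₁ u v ∨ (mem hits (lab₁ u) ∧ ⌊ lab₁ v ≟ zero ⌋) ∨ (⌊ lab₁ u ≟ zero ⌋ ∧ mem hits (lab₁ v)) ≡ adj G u v
        eq {u} {v} u∈ v∈ with u ≟ z | v ≟ z
        ... | yes refl | yes refl rewrite mem-zero | irrefl G u = refl
        ... | yes refl | no v≢ rewrite mem-zero | mem-hit (tail∈ v∈ v≢) | Boolₚ.∧-zeroʳ (adj G z v) = adj-sym G v z
        ... | no u≢ | yes refl rewrite mem-hit (tail∈ u∈ u≢) | Boolₚ.∧-zeroʳ (adj G u z) =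
          trans (Boolₚ.∨-identityʳ _) (Boolₚ.∧-identityʳ _)
        ... | no _ | no _ rewrite Boolₚ.∧-zeroʳ (mem hits (A (old u))) =
          trans (Boolₚ.∨-identityʳ _) (Boolₚ.∧-identityʳ _)

      -- `φA` may permute labels and so fail to be idempotent, as `drawn-relabel` demands. The
      -- detour from block A to block B and back splits it into two idempotent maps; it accounts for
      -- the second `k` in the number of labels.
      φ ψ : Fin K → Fin K
      φ zero = B (lab L z)
      φ (suc i) = [ B ∘ φA , B ]′ (splitAt k i)
      ψ zero = zero
      ψ (suc i) = [ A , A ]′ (splitAt k i)

      φ-A : ∀ (l : Fin k) → φ (A l) ≡ B (φA l)
      φ-A l rewrite splitAt-↑ˡ k l k = refl
      φ-B : ∀ (l : Fin k) → φ (B l) ≡ B l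
      φ-B l rewrite splitAt-↑ʳ k k l = refl
      ψ-A : ∀ (l : Fin k) → ψ (A l) ≡ A l
      ψ-A l rewrite splitAt-↑ˡ k l k = refl
      ψ-B : ∀ (l : Fin k) → ψ (B l) ≡ A l
      ψ-B l rewrite splitAt-↑ʳ k k l = refl

      φ-idem : ∀ i → φ (φ i) ≡ φ i
      φ-idem zero = φ-B _
      φ-idem (suc i) with splitAt k i
      ... | inj₁ _ = φ-B _
      ... | inj₂ _ = φ-B _
      ψ-idem : ∀ i → ψ (ψ i) ≡ ψ i
      ψ-idem zero = refl
      ψ-idem (suc i) with splitAt k i
      ... | inj₁ _ = ψ-A _
      ... | inj₂ _ = ψ-A _

      built : Built (z ∷ ys) zs
      built = record
        { cls = cls′
        ; drawn = drawn-ext (drawn-relabel ψ ψ-idem (drawn-relabel φ φ-idem d₂)) id id (λ _ _ → refl) (λ {u} _ → eq u) }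
        where
        eq : ∀ u → ψ (φ (lab₁ u)) ≡ A (new u)
        eq u with u ≟ z
        ... | yes _ = ψ-B _
        ... | no _ = trans (cong ψ (φ-A (old u))) (ψ-B _)

    build : ∀ ys zs → Unique (ys ++ zs) → Good G k (ys ++ zs) → Built ys zs → Built (ys ++ zs) []
    build ys [] _ _ b rewrite ++-identityʳ ys = b
    build ys (z ∷ zs) u good b =
      subst (λ xs → Built xs []) (++-assoc ys [ z ] zs)
        (build (ys ++ [ z ]) zs (subst Unique (sym (++-assoc ys [ z ] zs)) u)
          (λ as bs p → good as bs (trans (sym (++-assoc ys [ z ] zs)) p))
          (record { cls = record { lab = lab (Built.cls b′) ; same = λ x∈ x′∈ → same (Built.cls b′) (from x∈) (from x′∈) }
                  ; drawn = drawn-ext (Built.drawn b′) to from (λ _ _ → refl) (λ _ → refl) }))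
      where
      to : ∀ {v} → v ∈ z ∷ ys → v ∈ ys ++ [ z ]
      to (here p) = ∈-++⁺ʳ ys (here p)
      to (there p) = ∈-++⁺ˡ p
      from : ∀ {v} → v ∈ ys ++ [ z ] → v ∈ z ∷ ys
      from p = [ there , (λ { (here q) → here q }) ]′ (∈-++⁻ ys p)
      L = good (ys ++ [ z ]) zs (sym (++-assoc ys [ z ] zs))
      b′ : Built (z ∷ ys) zs
      b′ = Step.built b (λ p → proj₂ (proj₂ (unique-++⁻ ys u)) (p , here refl))
        (record { lab = lab L ; same = λ x∈ x′∈ → same L (to x∈) (to x′∈) })

  good⇒cw : ∀ {xs} → xs ↭ allFin n → Good G k xs → CWAtMost G (suc (k + k))
  good⇒cw {xs} perm good = e d , f , (f-inj , f-surj) , λ u v →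
      trans (cong₂ (adj G) (sym (g-f u)) (sym (g-f v))) (sym (sem d (f u) (f v)))
    where
    start : Built [] xs
    start = record { cls = record { lab = lab (good [] xs refl) ; same = λ () } ; drawn = drawn-empty }
    d = Built.drawn (build [] xs (unique-↭ (↭-sym perm) (Uniqueₚ.allFin⁺ n)) good start)
    f : Fin n → Fin (size (e d))
    f v = proj₁ (cover d (∈-resp-↭ (↭-sym perm) (∈-allFin v)))
    g-f : ∀ v → g d (f v) ≡ v
    g-f v = proj₂ (cover d (∈-resp-↭ (↭-sym perm) (∈-allFin v)))
    f-inj : Injective _≡_ _≡_ f
    f-inj {u} {v} p = trans (sym (g-f u)) (trans (cong (g d) p) (g-f v))
    f-surj : ∀ a → ∃ λ v → ∀ {w} → w ≡ v → f w ≡ a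
    f-surj a = g d a , λ { refl → g-inj d (g-f (g d a)) }

-- Orders assembled from blocks

catRev : ∀ {a} {A : Set a} → List (List A) → List A
catRev [] = []
catRev (b ∷ bs) = catRev bs ++ b

catRev-↭ : ∀ {a} {A : Set a} (bs : List (List A)) → catRev bs ↭ concat bs
catRev-↭ [] = ↭-refl
catRev-↭ (b ∷ bs) = ↭-trans (↭-++-comm (catRev bs) b) (↭-++⁺ˡ b (catRev-↭ bs))

catRev-split : ∀ {a} {A : Set a} (bs : List (List A)) {ys zs} → catRev bs ≡ ys ++ zs →
  bs ≡ [] ⊎ ∃₂ λ pre b₁ → ∃₂ λ b₂ post →
    bs ≡ pre ++ (b₁ ++ b₂) ∷ post × ys ≡ catRev post ++ b₁ × zs ≡ b₂ ++ catRev pre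
catRev-split [] _ = inj₁ refl
catRev-split (b ∷ bs) {ys} {zs} e with ++-split (catRev bs) e
... | inj₂ (m , p , q) = inj₂ ([] , m , zs , bs , cong (_∷ bs) q , p , sym (++-identityʳ zs))
... | inj₁ (m , p , q) with catRev-split bs p
...   | inj₂ (pre , b₁ , b₂ , post , r , s , t) =
  inj₂ (b ∷ pre , b₁ , b₂ , post , cong (b ∷_) r , s , trans q (trans (cong (_++ b) t) (++-assoc b₂ _ b)))
catRev-split (b ∷ .[]) {[]} {zs} e | inj₁ ([] , p , q) | inj₁ refl = inj₂ ([] , [] , b , [] , refl , refl , trans q (sym (++-identityʳ b)))

allPairs-++⁻ : ∀ {a r} {A : Set a} {R : A → A → Set r} as {bs x y} → AllPairs R (as ++ bs) → x ∈ as → y ∈ bs → R x y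
allPairs-++⁻ (a ∷ as) (p ∷ _) (here refl) y∈ = All.lookup (Allₚ.++⁻ʳ as p) y∈
allPairs-++⁻ (a ∷ as) (_ ∷ ps) (there x∈) y∈ = allPairs-++⁻ as ps x∈ y∈

module _ {n : ℕ} (G : Graph n) where

  private V = Fin n

  infix 4 _∈?_
  abstract
    _∈?_ : (x : V) (xs : List V) → Dec (x ∈ xs)
    _∈?_ = MemDec._∈?_ _≟_

  Sep : List V → List V → Set
  Sep xs zs = ∀ {x z} → x ∈ xs → z ∈ zs → adj G x z ≡ false

  lab-mono : ∀ {k k′ ys zs} → k ≤ k′ → Lab G k ys zs → Lab G k′ ys zs
  lab-mono p L = record
    { lab = λ x → inject≤ (lab L x) p
    ; same = λ x∈ x′∈ e → same L x∈ x′∈ (Finₚ.inject≤-injective p p _ _ e) }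

  good-mono : ∀ {k k′ xs} → k ≤ k′ → Good G k xs → Good G k′ xs
  good-mono p g ys zs e = lab-mono p (g ys zs e)

  good-cons : ∀ {k z xs} → Good G k xs → Good G (suc k) (z ∷ xs)
  good-cons g [] zs e = record { lab = λ _ → zero ; same = λ () }
  good-cons {k} {z} g (y ∷ ys) zs e with ∷-injective e
  ... | refl , e′ = record { lab = lab′ ; same = same′ }
    where
    L = g ys zs e′
    lab′ : V → Fin (suc k)
    lab′ x with x ≟ z
    ... | yes _ = zero
    ... | no _ = suc (lab L x)
    same′ : ∀ {x x′ w} → x ∈ z ∷ ys → x′ ∈ z ∷ ys → lab′ x ≡ lab′ x′ → w ∈ zs → adj G x w ≡ adj G x′ w
    same′ {x} {x′} x∈ x′∈ p w∈ with x ≟ z | x′ ≟ z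
    same′ x∈ x′∈ p w∈ | yes refl | yes refl = refl
    same′ (here q) _ p w∈ | no ¬q | no _ = ⊥-elim (¬q q)
    same′ (there x∈) (here q) p w∈ | no _ | no ¬q = ⊥-elim (¬q q)
    same′ (there x∈) (there x′∈) p w∈ | no _ | no _ = same L x∈ x′∈ (Finₚ.suc-injective p) w∈

  good-prefix : ∀ {k xs} zs → Good G k xs → Good G (length zs + k) (zs ++ xs)
  good-prefix [] g = g
  good-prefix (z ∷ zs) g = good-cons (good-prefix zs g)

  lab-active : ∀ {ys zs} ws → (∀ {x} → x ∈ ys → x ∉ ws → ∀ {z} → z ∈ zs → adj G x z ≡ false) →
    Lab G (suc (length ws)) ys zs
  lab-active {ys} {zs} ws dead = record { lab = lab′ ; same = same′ }
    where
    lab′ : V → Fin (suc (length ws))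
    lab′ x with x ∈? ws
    ... | yes p = suc (Any.index p)
    ... | no _ = zero
    same′ : ∀ {x x′ z} → x ∈ ys → x′ ∈ ys → lab′ x ≡ lab′ x′ → z ∈ zs → adj G x z ≡ adj G x′ z
    same′ {x} {x′} x∈ x′∈ p z∈ with x ∈? ws | x′ ∈? ws
    ... | yes q | yes q′ = cong (λ y → adj G y _)
      (trans (Anyₚ.lookup-index q) (trans (cong (lookup ws) (Finₚ.suc-injective p)) (sym (Anyₚ.lookup-index q′))))
    ... | no q | no q′ = trans (dead x∈ q z∈) (sym (dead x′∈ q′ z∈))

  -- Finished blocks need `t` classes towards everything still to come. A vertex of the block being
  -- drawn is classified by a pair: its class towards the rest of its own block, out of `p`, and its
  -- class towards the blocks not yet begun, out of `t`.
  block-cut : ∀ {t p} pre b₁ b₂ post → All (Good G p) (pre ++ (b₁ ++ b₂) ∷ post) →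
    (∀ pre′ post′ → pre ++ (b₁ ++ b₂) ∷ post ≡ pre′ ++ post′ → Lab G t (concat post′) (concat pre′)) →
    Lab G (t + p * t) (catRev post ++ b₁) (b₂ ++ catRev pre)
  block-cut {t} {p} pre b₁ b₂ post good cut = record { lab = lab′ ; same = same′ }
    where
    b = b₁ ++ b₂
    L₁ = cut (pre ++ [ b ]) post (sym (++-assoc pre [ b ] post))
    L₂ = cut pre (b ∷ post) refl
    Lᵢ = All.lookup good (∈-++⁺ʳ pre (here refl)) b₁ b₂ refl
    lab′ : V → Fin (t + p * t)
    lab′ x with x ∈? catRev post
    ... | yes _ = lab L₁ x ↑ˡ (p * t)
    ... | no _ = t ↑ʳ combine (lab Lᵢ x) (lab L₂ x)
    clash : ∀ {i : Fin t} {j : Fin (p * t)} → i ↑ˡ (p * t) ≢ t ↑ʳ j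
    clash {i} {j} q = case trans (sym (splitAt-↑ˡ t i (p * t))) (trans (cong (splitAt t) q) (splitAt-↑ʳ t (p * t) j)) of λ ()
    in-b₁ : ∀ {x} → x ∈ catRev post ++ b₁ → x ∉ catRev post → x ∈ b₁
    in-b₁ x∈ x∉ = [ ⊥-elim ∘ x∉ , id ]′ (∈-++⁻ (catRev post) x∈)
    z-left : ∀ {z} → z ∈ b₂ ++ catRev pre → z ∈ concat (pre ++ [ b ])
    z-left z∈ = subst (_ ∈_) (concat-++ pre [ b ]) (z-left′ (∈-++⁻ b₂ z∈))
      where
      z-left′ : ∀ {z} → z ∈ b₂ ⊎ z ∈ catRev pre → z ∈ concat pre ++ concat [ b ]
      z-left′ (inj₁ q) = ∈-++⁺ʳ (concat pre) (∈-++⁺ˡ (∈-++⁺ʳ b₁ q))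
      z-left′ (inj₂ q) = ∈-++⁺ˡ (∈-resp-↭ (catRev-↭ pre) q)
    same′ : ∀ {x x′ z} → x ∈ catRev post ++ b₁ → x′ ∈ catRev post ++ b₁ → lab′ x ≡ lab′ x′ →
      z ∈ b₂ ++ catRev pre → adj G x z ≡ adj G x′ z
    same′ {x} {x′} x∈ x′∈ q z∈ with x ∈? catRev post | x′ ∈? catRev post
    ... | yes r | yes r′ = same L₁ (∈-resp-↭ (catRev-↭ post) r) (∈-resp-↭ (catRev-↭ post) r′) (↑ˡ-injective (p * t) _ _ q) (z-left z∈)
    ... | yes _ | no _ = ⊥-elim (clash q)
    ... | no _ | yes _ = ⊥-elim (clash (sym q))
    ... | no r | no r′ with combine-injective _ _ _ _ (↑ʳ-injective t _ _ q) | ∈-++⁻ b₂ z∈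
    ...   | i≡ , _ | inj₁ z∈b₂ = same Lᵢ (in-b₁ x∈ r) (in-b₁ x′∈ r′) i≡ z∈b₂
    ...   | _ , j≡ | inj₂ z∈pre = same L₂ (∈-++⁺ˡ (∈-++⁺ˡ (in-b₁ x∈ r))) (∈-++⁺ˡ (∈-++⁺ˡ (in-b₁ x′∈ r′))) j≡ (∈-resp-↭ (catRev-↭ pre) z∈pre)

  good-blocks : ∀ {t p} bs → All (Good G p) bs →
    (∀ pre post → bs ≡ pre ++ post → Lab G t (concat post) (concat pre)) → Good G (t + p * t) (catRev bs)
  good-blocks {t} {p} bs good cut ys zs e with catRev-split bs e
  ... | inj₂ (pre , b₁ , b₂ , post , refl , ys≡ , zs≡) =
    subst₂ (Lab G (t + p * t)) (sym ys≡) (sym zs≡) (block-cut pre b₁ b₂ post good cut)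
  good-blocks {t} {p} .[] good cut [] zs e | inj₁ refl =
    record { lab = λ x → lab (cut [] [] refl) x ↑ˡ (p * t) ; same = λ () }

  good-separated : ∀ {p} bs → All (Good G p) bs → AllPairs Sep bs → Good G (suc p) (catRev bs)
  good-separated {p} bs good sep = subst (λ k → Good G k (catRev bs)) (cong suc (*-identityʳ p))
    (good-blocks bs good λ pre post e → record { lab = λ _ → zero ; same = λ x∈ x′∈ _ z∈ → trans (cut pre post e x∈ z∈) (sym (cut pre post e x′∈ z∈)) })
    where
    cut : ∀ pre post → bs ≡ pre ++ post → Sep (concat post) (concat pre)
    cut pre post refl {x} {z} x∈ z∈ with ∈-concat⁻′ post x∈ | ∈-concat⁻′ pre z∈
    ... | c , x∈c , c∈ | b , z∈b , b∈ = trans (adj-sym G x z) (allPairs-++⁻ pre sep b∈ c∈ z∈b x∈c)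

  abstract
    -- The common loop for cutting off components and hanging pieces: `P` is the invariant of the
    -- remainder, `Q` holds for each piece that is stripped, `S` is the stopping condition. Each `W`
    -- is nonempty, so the length of `U` suffices as fuel.
    peel : ∀ (P S Q : List V → Set) →
      (∀ U → P U → S U ⊎ ∃₂ λ W R → U ↭ W ++ R × 0 < length W × Q W × Sep W R × P R) →
      ∀ U → P U → ∃₂ λ bs R → U ↭ concat bs ++ R × All Q bs × AllPairs Sep bs × Sep (concat bs) R × S R × P R
    peel P S Q strip U pU = go (length U) U ≤-refl pU
      where
      go : ∀ fuel U → length U ≤ fuel → P U →
        ∃₂ λ bs R → U ↭ concat bs ++ R × All Q bs × AllPairs Sep bs × Sep (concat bs) R × S R × P R
      go fuel U len pU with strip U pU
      ... | inj₁ s = [] , U , ↭-refl , [] , [] , (λ ()) , s , pU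
      ... | inj₂ (W , R , perm , pos , qW , sep , pR) with fuel
      ...   | zero = ⊥-elim (<⇒≱ pos (≤-trans (m≤m+n (length W) (length R))
                (≤-trans (≤-reflexive (sym (trans (↭-length perm) (length-++ W)))) len)))
      ...   | suc fuel with go fuel R (≤-pred′ W R perm pos len) pR
        where
        ≤-pred′ : ∀ W R → U ↭ W ++ R → 0 < length W → length U ≤ suc fuel → length R ≤ fuel
        ≤-pred′ W R perm pos len = ≤-pred (≤-trans (+-monoˡ-≤ (length R) pos)
          (≤-trans (≤-reflexive (sym (trans (↭-length perm) (length-++ W)))) len))
      ...     | bs , R′ , perm′ , qs , seps , sepR , s , pR′ =
        W ∷ bs , R′ ,
        ↭-trans perm (↭-trans (↭-++⁺ˡ W perm′) (↭-reflexive (sym (++-assoc W (concat bs) R′)))) ,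
        qW ∷ qs ,
        All.tabulate (λ b∈ x∈ z∈ → sep x∈ (in-R (∈-++⁺ˡ (∈-concat⁺′ z∈ b∈)))) ∷ seps ,
        (λ x∈ z∈ → [ (λ q → sep q (in-R (∈-++⁺ʳ (concat bs) z∈))) , (λ q → sepR q z∈) ]′ (∈-++⁻ W x∈)) ,
        s , pR′
        where
        in-R : ∀ {z} → z ∈ concat bs ++ R′ → z ∈ R
        in-R = ∈-resp-↭ (↭-sym perm′)

  -- Pieces of bounded depth hanging at the vertices of a spine

  data Chain : V → V → List V → Set where
    stop : ∀ {v} → Chain v v [ v ]
    _◅_  : ∀ {u w v qs} → adj G u w ≡ true → Chain w v qs → Chain u v (u ∷ qs)
  infixr 5 _◅_

  ~-sym : ∀ {u v} → adj G u v ≡ true → adj G v u ≡ true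
  ~-sym {u} {v} e = trans (adj-sym G v u) e

  chain-++ : ∀ {u v w x as bs} → Chain u v as → adj G v w ≡ true → Chain w x bs → Chain u x (as ++ bs)
  chain-++ stop e c = e ◅ c
  chain-++ (f ◅ d) e c = f ◅ chain-++ d e c

  chain-reverse : ∀ {u v qs} → Chain u v qs → Chain v u (reverse qs)
  chain-reverse stop = stop
  chain-reverse {u} {v} {qs = u ∷ qs} (e ◅ c) =
    subst (Chain _ _) (sym (unfold-reverse u qs)) (chain-++ (chain-reverse c) (~-sym e) stop)

  chain-head∈ : ∀ {u v qs} → Chain u v qs → u ∈ qs
  chain-head∈ stop = here refl
  chain-head∈ (_ ◅ _) = here refl

  Hung : V → List V → Set
  Hung p D = ∀ {z} → z ∈ D → ∃₂ λ v qs → adj G p v ≡ true × Chain z v qs × Unique qs × All (_∈ D) qs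

  abstract
    mutual
      -- A depth-first search whose depth is bounded by the length of paths. Each level costs two
      -- classes: one for the search vertex placed in front of its piece, and one for keeping
      -- mutually separated pieces apart.
      hang : ∀ d p X → Unique (p ∷ X) →
        (∀ {v u qs} → v ∈ X → adj G p v ≡ true → Chain v u qs → Unique qs → All (_∈ X) qs → length qs ≤ d) →
        ∃₂ λ D R → X ↭ D ++ R × Good G (suc (d + d)) D × Sep D R × Sep [ p ] R × Hung p D
      hang d p X (_ ∷ uX) short with
        peel (λ U → Unique U × (∀ {x} → x ∈ U → x ∈ X)) (Sep [ p ])
             (λ W → Good G (d + d) W × Hung p W) strip X (uX , id)
        where
        strip : ∀ U → Unique U × (∀ {x} → x ∈ U → x ∈ X) → Sep [ p ] U ⊎ ∃₂ λ W R →
          U ↭ W ++ R × 0 < length W × (Good G (d + d) W × Hung p W) × Sep W R × (Unique R × (∀ {x} → x ∈ R → x ∈ X))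
        strip U (uU , sub) with Any.any? (λ v → adj G p v Boolₚ.≟ true) U
        ... | no none = inj₁ λ { (here refl) z∈ → Boolₚ.¬-not λ e → none (lose z∈ e) }
        ... | yes some with find some
        ...   | v , v∈ , e with remove v∈
        ...     | U₁ , perm with dfs d v U₁ (unique-↭ perm uU)
                   (λ c u al → short (sub v∈) e c u (All.map (sub ∘ ∈-resp-↭ (↭-sym perm)) al))
        ...       | W , R , perm₁ , good , sep , conn =
          inj₂ (v ∷ W , R , perm₂ , s≤s z≤n , (good , λ z∈ → let (qs , c , u , al) = conn z∈ in v , qs , e , c , u , al) ,
            sep , proj₁ (proj₂ (unique-++⁻ (v ∷ W) (unique-↭ perm₂ uU))) , λ x∈ → sub (∈-resp-↭ (↭-sym perm₂) (∈-++⁺ʳ (v ∷ W) x∈)))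
          where
          perm₂ : U ↭ v ∷ W ++ R
          perm₂ = ↭-trans perm (prep v perm₁)
      ... | bs , R , perm , qs , seps , sepR , s , _ =
        catRev bs , R , ↭-trans perm (↭-++⁺ʳ R (↭-sym (catRev-↭ bs))) ,
        good-separated bs (All.map proj₁ qs) seps ,
        (λ x∈ → sepR (∈-resp-↭ (catRev-↭ bs) x∈)) , s ,
        λ z∈ → let (b , z∈b , b∈) = ∈-concat⁻′ bs (∈-resp-↭ (catRev-↭ bs) z∈)
                   (v , ps , e , c , u , al) = proj₂ (All.lookup qs b∈) z∈b
               in v , ps , e , c , u , All.map (λ w∈ → ∈-resp-↭ (↭-sym (catRev-↭ bs)) (∈-concat⁺′ w∈ b∈)) al

      dfs : ∀ d v U → Unique (v ∷ U) →
        (∀ {u qs} → Chain v u qs → Unique qs → All (_∈ v ∷ U) qs → length qs ≤ d) →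
        ∃₂ λ W R → U ↭ W ++ R × Good G (d + d) (v ∷ W) × Sep (v ∷ W) R ×
          (∀ {w} → w ∈ v ∷ W → ∃ λ qs → Chain w v qs × Unique qs × All (_∈ v ∷ W) qs)
      dfs zero v U _ short with short stop ([] ∷ []) (here refl ∷ [])
      ... | ()
      dfs (suc d) v U uvU@(v∉ ∷ uU) short with hang d v U uvU
        (λ v∈ e c u al → ≤-pred (short (e ◅ c) (All.tabulate (λ q∈ p → All.lookup v∉ (All.lookup al q∈) p) ∷ u) (here refl ∷ All.map there al)))
      ... | D , R , perm , good , sepD , sepv , hung =
        D , R , perm , subst (λ k → Good G k (v ∷ D)) (cong suc (sym (+-suc d d))) (good-cons good) ,
        (λ { (here refl) → sepv (here refl) ; (there p) → sepD p }) , conn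
        where
        conn : ∀ {w} → w ∈ v ∷ D → ∃ λ qs → Chain w v qs × Unique qs × All (_∈ v ∷ D) qs
        conn (here refl) = [ v ] , stop , [] ∷ [] , here refl ∷ []
        conn (there w∈) with hung w∈
        ... | v′ , qs , e , c , u , al =
          qs ++ [ v ] , chain-++ c (~-sym e) stop ,
          unique-++⁺ u ([] ∷ []) (λ { (q∈ , here refl) → All.lookup v∉ (∈-resp-↭ (↭-sym perm) (∈-++⁺ˡ (All.lookup al q∈))) refl }) ,
          Allₚ.++⁺ (All.map there al) (here refl ∷ [])

  -- The relation is asymmetric: a piece takes everything that its spine vertex can reach in what is
  -- left, so it is separated from later pieces but possibly adjacent to later spine vertices.
  -- Drawing the later blocks first, as `catRev` does, leaves only spine vertices with undrawn
  -- neighbours in other blocks.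
  Later : V × List V → V × List V → Set
  Later (p , D) (p′ , D′) = Sep [ p ] D′ × Sep D D′

  abstract
    attach : ∀ d ps X → Unique (ps ++ X) →
      (∀ {p v u qs} → p ∈ ps → v ∈ X → adj G p v ≡ true → Chain v u qs → Unique qs → All (_∈ X) qs → length qs ≤ d) →
      ∃₂ λ Ds R → map proj₁ Ds ≡ ps × X ↭ concat (map proj₂ Ds) ++ R ×
        All (λ (p , D) → Good G (2 + (d + d)) (p ∷ D)) Ds × AllPairs Later Ds ×
        All (λ (p , D) → Sep [ p ] R × Sep D R) Ds × All (λ (p , D) → Hung p D) Ds
    attach d [] X _ _ = [] , X , refl , ↭-refl , [] , [] , [] , []
    attach d (p ∷ ps) X (p∉ ∷ u) short with hang d p X
      (Allₚ.++⁻ʳ ps p∉ ∷ proj₁ (proj₂ (unique-++⁻ ps u))) (short (here refl))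
    ... | D , R , perm , good , sepD , sepp , hung
      with attach d ps R
        (unique-++⁺ (proj₁ (unique-++⁻ ps u)) (proj₁ (proj₂ (unique-++⁻ D (unique-↭ perm (proj₁ (proj₂ (unique-++⁻ ps u)))))))
          (λ (a , b) → proj₂ (proj₂ (unique-++⁻ ps u)) (a , in-X (∈-++⁺ʳ D b))))
        (λ p∈ v∈ e c u al → short (there p∈) (in-X (∈-++⁺ʳ D v∈)) e c u (All.map (in-X ∘ ∈-++⁺ʳ D) al))
      where
      in-X : ∀ {x} → x ∈ D ++ R → x ∈ X
      in-X = ∈-resp-↭ (↭-sym perm)
    ...   | Ds , R′ , refl , perm′ , goods , later , seps , hungs =
      (p , D) ∷ Ds , R′ , refl ,
      ↭-trans perm (↭-trans (↭-++⁺ˡ D perm′) (↭-reflexive (sym (++-assoc D _ R′)))) ,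
      good-cons good ∷ goods ,
      All.tabulate (λ {(p′ , D′)} D∈ → (λ x∈ z∈ → sepp x∈ (in-R (∈-++⁺ˡ (∈-concat⁺′ z∈ (∈-map⁺ proj₂ D∈))))) ,
                            (λ x∈ z∈ → sepD x∈ (in-R (∈-++⁺ˡ (∈-concat⁺′ z∈ (∈-map⁺ proj₂ D∈)))))) ∷ later ,
      ((λ x∈ z∈ → sepp x∈ (in-R (∈-++⁺ʳ _ z∈))) , (λ x∈ z∈ → sepD x∈ (in-R (∈-++⁺ʳ _ z∈)))) ∷ seps ,
      hung ∷ hungs
      where
      in-R : ∀ {x} → x ∈ concat (map proj₂ Ds) ++ R′ → x ∈ R
      in-R = ∈-resp-↭ (↭-sym perm′)

-- Graphs without a subdivided claw

module _ {a} {A : Set a} {R : A → A → Set} where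

  linked-++⁻ˡ : ∀ as {bs} → Linked R (as ++ bs) → Linked R as
  linked-++⁻ˡ [] _ = []
  linked-++⁻ˡ (a ∷ []) _ = [-]
  linked-++⁻ˡ (a ∷ b ∷ as) (r ∷ l) = r ∷ linked-++⁻ˡ (b ∷ as) l

  linked-tail : ∀ {x xs} → Linked R (x ∷ xs) → Linked R xs
  linked-tail [-] = []
  linked-tail (_ ∷ l) = l

  linked-++⁻ʳ : ∀ as {bs} → Linked R (as ++ bs) → Linked R bs
  linked-++⁻ʳ [] l = l
  linked-++⁻ʳ (a ∷ as) l = linked-++⁻ʳ as (linked-tail l)

  linked-join : ∀ as {p bs} → Linked R (as ++ [ p ]) → Linked R (p ∷ bs) → Linked R (as ++ p ∷ bs)
  linked-join [] _ l = l
  linked-join (a ∷ []) (r ∷ _) l = r ∷ l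
  linked-join (a ∷ b ∷ as) (r ∷ k) l = r ∷ linked-join (b ∷ as) k l

  linked-take : ∀ k {xs} → Linked R xs → Linked R (take k xs)
  linked-take k {xs} l = linked-++⁻ˡ (take k xs) (subst (Linked R) (sym (take++drop≡id k xs)) l)

  linked-reverse : (∀ {x y} → R x y → R y x) → ∀ {xs} → Linked R xs → Linked R (reverse xs)
  linked-reverse _ [] = []
  linked-reverse _ [-] = [-]
  linked-reverse s {x ∷ y ∷ xs} (r ∷ l) =
    subst (Linked R) (sym (trans (unfold-reverse x (y ∷ xs)) (cong (_++ [ x ]) (unfold-reverse y xs))))
      (subst (Linked R) (sym (++-assoc (reverse xs) [ y ] [ x ]))
        (linked-join (reverse xs) (subst (Linked R) (unfold-reverse y xs) (linked-reverse s l)) (s r ∷ [-])))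

map-++⁻ : ∀ {a b} {A : Set a} {B : Set b} (f : A → B) xs {as bs} → map f xs ≡ as ++ bs →
  ∃₂ λ xs₁ xs₂ → xs ≡ xs₁ ++ xs₂ × map f xs₁ ≡ as × map f xs₂ ≡ bs
map-++⁻ f xs {[]} e = [] , xs , refl , refl , e
map-++⁻ f (x ∷ xs) {a ∷ as} e with ∷-injective e
... | p , q with map-++⁻ f xs q
...   | xs₁ , xs₂ , refl , r , s = x ∷ xs₁ , xs₂ , refl , cong₂ _∷_ p r , s

-- The value `t + p * t` of `good-blocks`. Here `t` is 3R + 1, for at most 3R active spine vertices
-- and one class of inactive vertices, and `p` is 2R + 2, for a spine vertex together with a piece
-- of depth R.
component-size : ℕ → ℕ
component-size R = suc ((R + R) + R) + (2 + (R + R)) * suc ((R + R) + R)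

module _ {n : ℕ} (G : Graph n) where

  private V = Fin n
  private module PermSolver = Algebra.Solver.CommutativeMonoid (++-commutativeMonoid {A = Fin n})
  open PermSolver using (_⊜_) renaming (_⊕_ to _⊞_; solve to solve↭)

  Path : List V → Set
  Path = Linked (λ u v → adj G u v ≡ true)

  path? : ∀ qs → Dec (Path qs)
  path? = linked? (λ u v → adj G u v Boolₚ.≟ true)

  path-reverse : ∀ {qs} → Path qs → Path (reverse qs)
  path-reverse = linked-reverse (~-sym G)

  chain⇒path : ∀ {u v qs} → Chain G u v qs → Path qs
  chain⇒path stop = [-]
  chain⇒path (e ◅ stop) = e ∷ [-]
  chain⇒path (e ◅ c@(_ ◅ _)) = e ∷ chain⇒path c

  chain⇒path-∷ : ∀ {c u v qs} → adj G c u ≡ true → Chain G u v qs → Path (c ∷ qs)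
  chain⇒path-∷ e c = chain⇒path (e ◅ c)

  record Trip (R : ℕ) (U : List V) : Set where
    field
      centre : V
      l₁ l₂ l₃ : List V
      len₁ : length l₁ ≡ R
      len₂ : length l₂ ≡ R
      len₃ : length l₃ ≡ R
      path₁ : Path (centre ∷ l₁)
      path₂ : Path (centre ∷ l₂)
      path₃ : Path (centre ∷ l₃)
      uniq : Unique (centre ∷ l₁ ++ l₂ ++ l₃)
      inside : All (_∈ U) (centre ∷ l₁ ++ l₂ ++ l₃)

  trip? : ∀ R U → Dec (Trip R U)
  trip? R U = map′
    (λ { (c , l₁ , e₁ , p₁ , l₂ , e₂ , p₂ , l₃ , e₃ , p₃ , u , i) → record
      { centre = c ; l₁ = l₁ ; l₂ = l₂ ; l₃ = l₃ ; len₁ = e₁ ; len₂ = e₂ ; len₃ = e₃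
      ; path₁ = p₁ ; path₂ = p₂ ; path₃ = p₃ ; uniq = u ; inside = i } })
    (λ t → let open Trip t in
      centre , l₁ , len₁ , path₁ , l₂ , len₂ , path₂ , l₃ , len₃ , path₃ , uniq , inside)
    (any? λ c → anyList? R λ l₁ → path? (c ∷ l₁) ×-dec anyList? R λ l₂ → path? (c ∷ l₂) ×-dec
      anyList? R λ l₃ → path? (c ∷ l₃) ×-dec UniqueDec.unique? _≟_ (c ∷ l₁ ++ l₂ ++ l₃) ×-dec
      All.all? (λ x → MemDec._∈?_ _≟_ x U) (c ∷ l₁ ++ l₂ ++ l₃))

  trip-from-legs : ∀ {R U c} l₁ l₂ l₃ → R ≤ length l₁ → R ≤ length l₂ → R ≤ length l₃ →
    Path (c ∷ l₁) → Path (c ∷ l₂) → Path (c ∷ l₃) → Unique (c ∷ l₁ ++ l₂ ++ l₃) →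
    All (_∈ U) (c ∷ l₁ ++ l₂ ++ l₃) → Trip R U
  trip-from-legs {R} {U} {c} l₁ l₂ l₃ r₁ r₂ r₃ p₁ p₂ p₃ u i = record
    { centre = c ; l₁ = take R l₁ ; l₂ = take R l₂ ; l₃ = take R l₃
    ; len₁ = length-take-≤ R r₁ ; len₂ = length-take-≤ R r₂ ; len₃ = length-take-≤ R r₃
    ; path₁ = linked-take (suc R) p₁ ; path₂ = linked-take (suc R) p₂ ; path₃ = linked-take (suc R) p₃
    ; uniq = proj₁ (unique-++⁻ _ (unique-↭ perm u)) ; inside = Allₚ.++⁻ˡ _ (All-resp-↭ perm i) }
    where
    perm : c ∷ l₁ ++ l₂ ++ l₃ ↭ (c ∷ take R l₁ ++ take R l₂ ++ take R l₃) ++ (drop R l₁ ++ drop R l₂ ++ drop R l₃)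
    perm = ↭-trans
      (↭-reflexive (cong (c ∷_) (cong₂ _++_ (sym (take++drop≡id R l₁)) (cong₂ _++_ (sym (take++drop≡id R l₂)) (sym (take++drop≡id R l₃))))))
      (solve↭ 7 (λ c t₁ t₂ t₃ d₁ d₂ d₃ →
        (c ⊞ ((t₁ ⊞ d₁) ⊞ ((t₂ ⊞ d₂) ⊞ (t₃ ⊞ d₃)))) ⊜ ((c ⊞ (t₁ ⊞ (t₂ ⊞ t₃))) ⊞ (d₁ ⊞ (d₂ ⊞ d₃))))
        ↭-refl [ c ] (take R l₁) (take R l₂) (take R l₃) (drop R l₁) (drop R l₂) (drop R l₃))

  module Longest (U : List V) where

    InU : List V → Set
    InU qs = Path qs × Unique qs × All (_∈ U) qs

    inU? : ∀ qs → Dec (InU qs)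
    inU? qs = path? qs ×-dec UniqueDec.unique? _≟_ qs ×-dec All.all? (λ x → MemDec._∈?_ _≟_ x U) qs

    longest : ∀ {u} → u ∈ U → ∃ λ ps → 0 < length ps × InU ps × (∀ {qs} → InU qs → length qs ≤ length ps)
    longest {u} u∈ = go n [ u ] (s≤s z≤n) ([-] , [] ∷ [] , u∈ ∷ []) (n≤1+n n)
      where
      go : ∀ fuel ps → 0 < length ps → InU ps → n ≤ length ps + fuel →
        ∃ λ ps → 0 < length ps × InU ps × (∀ {qs} → InU qs → length qs ≤ length ps)
      go fuel ps pos i b with anyList? (suc (length ps)) inU?
      ... | no none = ps , pos , i , λ {qs} j → ≮⇒≥ λ lt → none (take (suc (length ps)) qs , length-take-≤ (suc (length ps)) {qs} lt ,
              linked-take _ (proj₁ j) , unique-take _ (proj₁ (proj₂ j)) , Allₚ.take⁺ _ (proj₂ (proj₂ j)))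
      go zero ps pos i b | yes (qs , e , j) =
        ⊥-elim (<⇒≱ (≤-reflexive (sym e)) (≤-trans (unique-length (proj₁ (proj₂ j))) (≤-trans b (≤-reflexive (+-identityʳ _)))))
      go (suc fuel) ps pos i b | yes (qs , e , j) =
        go fuel qs (≤-trans (s≤s z≤n) (≤-reflexive (sym e))) j
          (≤-trans b (≤-reflexive (trans (+-suc (length ps) fuel) (cong (_+ fuel) (sym e)))))

  module ClawFree (R : ℕ) (U : List V) (¬trip : ¬ Trip R U) (ps X : List V) (ps-pos : 0 < length ps)
    (ps-in : Longest.InU U ps) (maximal : ∀ {qs} → Longest.InU U qs → length qs ≤ length ps)
    (permX : U ↭ ps ++ X) (uX : Unique (ps ++ X)) where

    private
      in-U : ∀ {x} → x ∈ ps ++ X → x ∈ U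
      in-U = ∈-resp-↭ (↭-sym permX)

      path-++-centre : ∀ pre {p} post → Path (pre ++ p ∷ post) → Path (p ∷ reverse pre)
      path-++-centre pre {p} post l = subst Path (reverse-++ pre [ p ])
        (path-reverse (linked-++⁻ˡ (pre ++ [ p ]) (subst Path (sym (++-assoc pre [ p ] post)) l)))

    -- Suppose that a path of more than R vertices hangs at `p`. If both parts of the longest path
    -- at `p` have R vertices, the three form a claw; otherwise the hanging path replaces a shorter
    -- part and gives a longer path.
    short : ∀ {p v u qs} → p ∈ ps → v ∈ X → adj G p v ≡ true → Chain G v u qs → Unique qs → All (_∈ X) qs → length qs ≤ R
    short {p} {v} {u} {qs} p∈ v∈ e c uq al with ∈-∃++ p∈
    ... | pre , post , ps≡ = ≮⇒≥ λ lt → lemma lt (R ℕₚ.≤? length pre) (R ℕₚ.≤? length post)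
      where
      path-ps : Path (pre ++ p ∷ post)
      path-ps = subst Path ps≡ (proj₁ ps-in)
      path-q : Path (p ∷ qs)
      path-q = chain⇒path-∷ e c
      uniq : Unique ((pre ++ p ∷ post) ++ qs)
      uniq = subst (λ l → Unique (l ++ qs)) ps≡ (unique-++⁺ (proj₁ (unique-++⁻ ps uX)) uq
        (λ (a , b) → proj₂ (proj₂ (unique-++⁻ ps uX)) (a , All.lookup al b)))
      inside : All (_∈ U) ((pre ++ p ∷ post) ++ qs)
      inside = subst (λ l → All (_∈ U) (l ++ qs)) ps≡ (Allₚ.++⁺ (proj₂ (proj₂ ps-in)) (All.map (in-U ∘ ∈-++⁺ʳ ps) al))
      length-ps : length ps ≡ length pre + suc (length post)
      length-ps = trans (cong length ps≡) (length-++ pre)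
      lemma : R < length qs → Dec (R ≤ length pre) → Dec (R ≤ length post) → ⊥
      lemma lt (yes a) (yes b) = ¬trip (trip-from-legs (reverse pre) post qs
          (≤-trans a (≤-reflexive (sym (length-reverse pre)))) b (<⇒≤ lt)
          (path-++-centre pre post path-ps) (linked-++⁻ʳ pre path-ps) path-q
          (unique-↭ perm uniq) (All-resp-↭ perm inside))
        where
        perm : (pre ++ p ∷ post) ++ qs ↭ p ∷ reverse pre ++ post ++ qs
        perm = ↭-trans (solve↭ 4 (λ a p b q → ((a ⊞ (p ⊞ b)) ⊞ q) ⊜ (p ⊞ (a ⊞ (b ⊞ q)))) ↭-refl pre [ p ] post qs)
          (prep p (↭-++⁺ʳ (post ++ qs) (↭-sym (↭-reverse pre))))
      lemma lt (no a) _ = <⇒≱ longer (maximal (long-path , unique-↭ perm u₁ , All-resp-↭ perm i₁))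
        where
        long : List V
        long = reverse qs ++ p ∷ post
        long-path : Path long
        long-path = linked-join (reverse qs) (subst Path (unfold-reverse p qs) (path-reverse path-q)) (linked-++⁻ʳ pre path-ps)
        u₁ : Unique (qs ++ p ∷ post)
        u₁ = proj₁ (proj₂ (unique-++⁻ pre (unique-↭ (solve↭ 3 (λ a b q → ((a ⊞ b) ⊞ q) ⊜ (a ⊞ (q ⊞ b))) ↭-refl pre (p ∷ post) qs) uniq)))
        i₁ : All (_∈ U) (qs ++ p ∷ post)
        i₁ = Allₚ.++⁻ʳ pre (All-resp-↭ (solve↭ 3 (λ a b q → ((a ⊞ b) ⊞ q) ⊜ (a ⊞ (q ⊞ b))) ↭-refl pre (p ∷ post) qs) inside)
        perm : qs ++ p ∷ post ↭ long
        perm = ↭-++⁺ʳ (p ∷ post) (↭-sym (↭-reverse qs))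
        longer : length ps < length long
        longer = ≤-trans (s≤s (≤-reflexive length-ps))
          (≤-trans (+-monoˡ-≤ (suc (length post)) (<-trans (≰⇒> a) lt))
            (≤-reflexive (sym (trans (length-++ (reverse qs)) (cong (_+ suc (length post)) (length-reverse qs))))))
      lemma lt (yes _) (no b) = <⇒≱ longer (maximal (long-path , u₁ , i₁))
        where
        long : List V
        long = pre ++ p ∷ qs
        long-path : Path long
        long-path = linked-join pre (linked-++⁻ˡ (pre ++ [ p ]) (subst Path (sym (++-assoc pre [ p ] post)) path-ps)) path-q
        perm : (pre ++ p ∷ post) ++ qs ↭ post ++ pre ++ p ∷ qs
        perm = solve↭ 4 (λ a p b q → ((a ⊞ (p ⊞ b)) ⊞ q) ⊜ (b ⊞ (a ⊞ (p ⊞ q)))) ↭-refl pre [ p ] post qs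
        u₁ : Unique long
        u₁ = proj₁ (proj₂ (unique-++⁻ post (unique-↭ perm uniq)))
        i₁ : All (_∈ U) long
        i₁ = Allₚ.++⁻ʳ post (All-resp-↭ perm inside)
        longer : length ps < length long
        longer = ≤-trans (s≤s (≤-reflexive length-ps))
          (≤-trans (≤-reflexive (sym (+-suc (length pre) (suc (length post)))))
            (≤-trans (+-monoʳ-≤ (length pre) (s≤s (<-trans (≰⇒> b) lt))) (≤-reflexive (sym (length-++ pre)))))

    -- A vertex q that lies far from the end of the path and far behind p carries a subdivided claw if q and p
    -- are joined by a path through ds: its third leg runs through ds to p and back along the path.
    far : ∀ α {p} β γ {q} δ ds → ps ≡ α ++ p ∷ β ++ γ ++ q ∷ δ → R + R ≤ length γ → R ≤ length δ →
      Path (q ∷ ds ++ [ p ]) → Unique ds → All (_∈ X) ds → ⊥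
    far α {p} β γ {q} δ ds ps≡ lγ lδ path-d ud al =
      ¬trip (trip-from-legs δ (reverse γ₂) (ds ++ p ∷ β ++ γ₁) lδ
        (≤-trans (≤-from-sum 0 lγ len-γ) (≤-reflexive (sym (length-reverse γ₂))))
        (≤-trans (≤-reflexive (sym len-γ₁)) (≤-trans (m≤n+m (length γ₁) (length ds + suc (length β)))
          (≤-reflexive (sym (trans (length-++ ds) (trans (cong (λ k → length ds + suc k) (length-++ β)) (sym (+-assoc (length ds) (suc (length β)) (length γ₁)))))))))
        (linked-++⁻ʳ (α ++ p ∷ β ++ γ) path₀)
        (linked-++⁻ˡ (q ∷ reverse γ₂) (subst Path rev≡ (path-++-centre (α ++ p ∷ β ++ γ) δ path₀)))
        (linked-join (q ∷ ds) path-d (linked-++⁻ˡ (p ∷ β ++ γ₁) (subst Path pβγ≡ (linked-++⁻ʳ α (subst Path ps≡ (proj₁ ps-in))))))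
        (proj₁ (proj₂ (unique-++⁻ α (unique-↭ perm uniq))))
        (Allₚ.++⁻ʳ α (All-resp-↭ perm inside)))
      where
      γ₁ = take R γ
      γ₂ = drop R γ
      path₀ : Path ((α ++ p ∷ β ++ γ) ++ q ∷ δ)
      path₀ = subst Path (trans ps≡ (sym (trans (++-assoc α (p ∷ β ++ γ) (q ∷ δ)) (cong (λ l → α ++ p ∷ l) (++-assoc β γ (q ∷ δ)))))) (proj₁ ps-in)
      len-γ₁ : length γ₁ ≡ R
      len-γ₁ = length-take-≤ R (≤-trans (m≤m+n R R) lγ)
      len-γ : R + length γ + 0 ≡ length γ₂ + (R + R)
      len-γ = trans (+-identityʳ _) (trans (cong (R +_) (trans (cong length (sym (take++drop≡id R γ))) (trans (length-++ γ₁) (cong (_+ length γ₂) len-γ₁))))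
        (arith R (length γ₂)))
        where
        arith : ∀ R a → R + (R + a) ≡ a + (R + R)
        arith = solve-∀
      rev≡ : q ∷ reverse (α ++ p ∷ β ++ γ) ≡ (q ∷ reverse γ₂) ++ (reverse γ₁ ++ reverse (α ++ p ∷ β))
      rev≡ = cong (q ∷_) (trans (cong reverse (sym (++-assoc α (p ∷ β) γ))) (trans (reverse-++ (α ++ p ∷ β) γ)
        (trans (cong (_++ reverse (α ++ p ∷ β)) (trans (cong reverse (sym (take++drop≡id R γ))) (reverse-++ γ₁ γ₂)))
          (++-assoc (reverse γ₂) (reverse γ₁) _))))
      pβγ≡ : p ∷ β ++ γ ++ q ∷ δ ≡ (p ∷ β ++ γ₁) ++ (γ₂ ++ q ∷ δ)
      pβγ≡ = cong (p ∷_) (trans (cong (λ l → β ++ l ++ q ∷ δ) (sym (take++drop≡id R γ)))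
        (trans (cong (β ++_) (++-assoc γ₁ γ₂ (q ∷ δ))) (sym (++-assoc β γ₁ _))))
      uniq : Unique (ps ++ ds)
      uniq = unique-++⁺ (proj₁ (unique-++⁻ ps uX)) ud (λ (a , b) → proj₂ (proj₂ (unique-++⁻ ps uX)) (a , All.lookup al b))
      inside : All (_∈ U) (ps ++ ds)
      inside = Allₚ.++⁺ (proj₂ (proj₂ ps-in)) (All.map (in-U ∘ ∈-++⁺ʳ ps) al)
      perm : ps ++ ds ↭ α ++ (q ∷ δ ++ reverse γ₂ ++ (ds ++ p ∷ β ++ γ₁))
      perm = ↭-trans (↭-reflexive (cong (_++ ds) (trans ps≡ (cong (λ l → α ++ p ∷ β ++ l ++ q ∷ δ) (sym (take++drop≡id R γ))))))
        (↭-trans (solve↭ 8 (λ α p β γ₁ γ₂ q δ ds → ((α ⊞ (p ⊞ (β ⊞ ((γ₁ ⊞ γ₂) ⊞ (q ⊞ δ))))) ⊞ ds) ⊜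
            (α ⊞ (q ⊞ (δ ⊞ (γ₂ ⊞ (ds ⊞ (p ⊞ (β ⊞ γ₁)))))))) ↭-refl α [ p ] β γ₁ γ₂ [ q ] δ ds)
          (↭-++⁺ˡ α (prep q (↭-++⁺ˡ δ (↭-++⁺ʳ (ds ++ p ∷ β ++ γ₁) (↭-sym (↭-reverse γ₂)))))))

    private
      cutSize blockSize : ℕ
      cutSize = suc ((R + R) + R)
      blockSize = 2 + (R + R)

    component : ∃₂ λ W S → U ↭ W ++ S × 0 < length W × Good G (cutSize + blockSize * cutSize) W × Sep G W S
    component with attach G R ps X uX short
    ... | Ds , S , map≡ , permD , goods , later , seps , hungs =
      catRev bs , S , perm , pos , good-blocks G bs (Allₚ.map⁺ goods) cut , sepW
      where
      block : V × List V → List V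
      block (p , D) = p ∷ D
      bs = map block Ds
      concat-bs : ∀ Es → concat (map block Es) ↭ map proj₁ Es ++ concat (map proj₂ Es)
      concat-bs [] = ↭-refl
      concat-bs ((p , D) ∷ Es) = prep p (↭-trans (↭-++⁺ˡ D (concat-bs Es)) (shifts D (map proj₁ Es)))
      perm : U ↭ catRev bs ++ S
      perm = ↭-trans permX (↭-trans (↭-++⁺ˡ ps permD) (↭-trans (↭-reflexive (sym (++-assoc ps _ S)))
        (↭-++⁺ʳ S (↭-trans (↭-reflexive (cong (_++ concat (map proj₂ Ds)) (sym map≡))) (↭-trans (↭-sym (concat-bs Ds)) (↭-sym (catRev-↭ bs)))))))
      pos : 0 < length (catRev bs)
      pos = ≤-trans ps-pos (≤-trans (≤-trans (m≤m+n (length ps) (length (concat (map proj₂ Ds))))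
        (≤-reflexive (trans (cong (λ l → length l + length (concat (map proj₂ Ds))) (sym map≡)) (sym (length-++ (map proj₁ Ds))))))
        (≤-reflexive (↭-length (↭-trans (↭-sym (concat-bs Ds)) (↭-sym (catRev-↭ bs))))))
      sepW : Sep G (catRev bs) S
      sepW x∈ z∈ with ∈-concat⁻′ bs (∈-resp-↭ (catRev-↭ bs) x∈)
      ... | b , x∈b , b∈ with ∈-map⁻ block b∈
      ...   | (p , D) , d∈ , refl with x∈b
      ...     | here refl = proj₁ (All.lookup seps d∈) (here refl) z∈
      ...     | there x∈D = proj₂ (All.lookup seps d∈) x∈D z∈

      D⊆X : ∀ {p D} → (p , D) ∈ Ds → ∀ {x} → x ∈ D → x ∈ X
      D⊆X d∈ x∈ = ∈-resp-↭ (↭-sym permD) (∈-++⁺ˡ (∈-concat⁺′ x∈ (∈-map⁺ proj₂ d∈)))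

      cut : ∀ pre post → bs ≡ pre ++ post → Lab G cutSize (concat post) (concat pre)
      cut pre post bs≡ with map-++⁻ block Ds {pre} {post} bs≡
      ... | Dpre , Dpost , refl , refl , refl = lab-mono G (s≤s lenW) (lab-active G ws dead)
        where
        qs = map proj₁ Dpost
        -- The spine vertices that may still have undrawn neighbours. By `far`, any other one would
        -- be the centre of a claw: R vertices on to the end of the path form one leg, and the 2R
        -- vertices back to the cut are shared between the second leg and the tail of the third.
        ws = take (R + R) qs ++ take R (reverse qs)
        lenW : length ws ≤ (R + R) + R
        lenW = ≤-trans (≤-reflexive (length-++ (take (R + R) qs))) (+-mono-≤
          (≤-trans (≤-reflexive (length-take (R + R) qs)) (m⊓n≤m _ _))
          (≤-trans (≤-reflexive (length-take R (reverse qs))) (m⊓n≤m _ _)))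
        ps-split : ps ≡ map proj₁ Dpre ++ qs
        ps-split = trans (sym map≡) (map-++ proj₁ Dpre Dpost)
        far-apart : ∀ {p q ds} → p ∈ map proj₁ Dpre → q ∈ qs → q ∉ ws → Path (q ∷ ds ++ [ p ]) → Unique ds → All (_∈ X) ds → ⊥
        far-apart {p} {q} {ds} p∈ q∈ q∉ path-d ud al with ∈-∃++ p∈ | ∈-∃++ q∈
        ... | α , β , e₁ | γ , δ , e₂ =
          far α β γ δ ds (trans ps-split (trans (cong₂ _++_ e₁ e₂) (++-assoc α (p ∷ β) _)))
            (≮⇒≥ λ lt → q∉ (∈-++⁺ˡ (subst (λ l → q ∈ take (R + R) l) (sym e₂) (∈-take-++ (R + R) γ lt))))
            (≮⇒≥ λ lt → q∉ (∈-++⁺ʳ (take (R + R) qs) (subst (λ l → q ∈ take R l) (sym rev)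
              (∈-take-++ R (reverse δ) (≤-trans (s≤s (≤-reflexive (length-reverse δ))) lt)))))
            path-d ud al
          where
          rev : reverse qs ≡ reverse δ ++ q ∷ reverse γ
          rev = trans (cong reverse e₂) (trans (reverse-++ γ (q ∷ δ)) (trans (cong (_++ reverse γ) (unfold-reverse q δ)) (++-assoc (reverse δ) [ q ] (reverse γ))))
        dead : ∀ {x} → x ∈ concat (map block Dpost) → x ∉ ws → ∀ {z} → z ∈ concat (map block Dpre) → adj G x z ≡ false
        dead x∈ x∉ z∈ with ∈-concat⁻′ (map block Dpost) x∈ | ∈-concat⁻′ (map block Dpre) z∈
        ... | b , x∈b , b∈ | b′ , z∈b′ , b′∈ with ∈-map⁻ block b∈ | ∈-map⁻ block b′∈
        ...   | (q , E) , d∈ , refl | (p , D) , d′∈ , refl = go x∈b z∈b′ x∉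
          where
          lat : Later G (p , D) (q , E)
          lat = allPairs-++⁻ Dpre later d′∈ d∈
          go : ∀ {x z} → x ∈ q ∷ E → z ∈ p ∷ D → x ∉ ws → adj G x z ≡ false
          go {x} {z} (there x∈E) (here refl) _ = trans (adj-sym G x z) (proj₁ lat (here refl) x∈E)
          go {x} {z} (there x∈E) (there z∈D) _ = trans (adj-sym G x z) (proj₂ lat z∈D x∈E)
          -- An edge from `q` back across the cut leads to the spine vertex `p` either at once or
          -- through the piece hanging at `p`; both cases give the connecting path that `far`
          -- excludes.
          go {x} {z} (here refl) (here refl) x∉ = Boolₚ.¬-not λ e →
            far-apart {ds = []} (∈-map⁺ proj₁ d′∈) (∈-map⁺ proj₁ d∈) x∉ (e ∷ [-]) [] []
          go {x} {z} (here refl) (there z∈D) x∉ = Boolₚ.¬-not λ e →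
            let (v , ds , e′ , c , ud , al) = All.lookup hungs (∈-++⁺ˡ d′∈) z∈D
            in far-apart (∈-map⁺ proj₁ d′∈) (∈-map⁺ proj₁ d∈) x∉ (chain⇒path (e ◅ chain-++ G c (~-sym G e′) stop)) ud
                 (All.map (D⊆X (∈-++⁺ˡ d′∈)) al)

  module _ (R : ℕ) (U : List V) (uU : Unique U) (¬trip : ¬ Trip R U) where
    private
      Sub : List V → Set
      Sub U′ = Unique U′ × (∀ {x} → x ∈ U′ → x ∈ U)

      Split : List V → Set
      Split U′ = ∃₂ λ W S → U′ ↭ W ++ S × 0 < length W × Good G (component-size R) W × Sep G W S × Sub S

      trip-⊆ : ∀ {U′} → (∀ {x} → x ∈ U′ → x ∈ U) → Trip R U′ → Trip R U
      trip-⊆ sub t = record { Trip t hiding (inside) ; inside = All.map sub (Trip.inside t) }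

      split-component : ∀ U′ → Sub U′ → ∀ {u} → u ∈ U′ → Split U′
      split-component U′ (uU′ , sub) u∈ = from-path (Longest.longest U′ u∈)
        where
        from-component : (∃₂ λ W S → U′ ↭ W ++ S × 0 < length W × Good G (component-size R) W × Sep G W S) → Split U′
        from-component (W , S , perm , pos , good , sep) = W , S , perm , pos , good , sep ,
          proj₁ (proj₂ (unique-++⁻ W (unique-↭ perm uU′))) , λ x∈ → sub (∈-resp-↭ (↭-sym perm) (∈-++⁺ʳ W x∈))
        from-path : (∃ λ ps → 0 < length ps × Longest.InU U′ ps × (∀ {qs} → Longest.InU U′ qs → length qs ≤ length ps)) → Split U′
        from-path (ps , ps-pos , ps-in@(_ , u-ps , al) , maximal) with extract u-ps al
        ... | X , permX = from-component
          (ClawFree.component R U′ (¬trip ∘ trip-⊆ sub) ps X ps-pos ps-in maximal permX (unique-↭ permX uU′))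

      strip : ∀ U′ → Sub U′ → U′ ≡ [] ⊎ Split U′
      strip [] _ = inj₁ refl
      strip U′@(_ ∷ _) s = inj₂ (split-component U′ s (here refl))

      assemble : (∃₂ λ bs S → U ↭ concat bs ++ S × All (Good G (component-size R)) bs × AllPairs (Sep G) bs ×
        Sep G (concat bs) S × S ≡ [] × Sub S) → ∃ λ xs → U ↭ xs × Good G (suc (component-size R)) xs
      assemble (bs , .[] , perm , goods , seps , _ , refl , _) =
        catRev bs , ↭-trans perm (↭-trans (↭-reflexive (++-identityʳ _)) (↭-sym (catRev-↭ bs))) , good-separated G bs goods seps

    clawFree⇒good : ∃ λ xs → U ↭ xs × Good G (suc (component-size R)) xs
    clawFree⇒good = assemble (peel G Sub (_≡ []) (Good G (component-size R)) strip U (uU , id))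

-- t ℓ k is the k-th vertex of leg ℓ of a subdivided claw; the centre is t ℓ 0 for every ℓ.
record IsTrip {n} (G : Graph n) (r : ℕ) (t : Fin 3 → ℕ → Fin n) : Set where
  field
    centre≡ : ∀ ℓ ℓ′ → t ℓ 0 ≡ t ℓ′ 0
    next    : ∀ ℓ {k} → k < r → adj G (t ℓ k) (t ℓ (suc k)) ≡ true
    trip-inj : ∀ {ℓ ℓ′ k k′} → k ≤ r → k′ ≤ r → t ℓ k ≡ t ℓ′ k′ → k ≡ k′ × (k ≡ 0 ⊎ ℓ ≡ ℓ′)
open IsTrip

-- The possible positions of two distinct non-adjacent vertices in a subdivided claw, up to exchange.
data Shape (ℓ : Fin 3) (s : ℕ) (ℓ′ : Fin 3) (s′ : ℕ) : Set where
  centre-leg : s ≡ 0 → 2 ≤ s′ → Shape ℓ s ℓ′ s′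
  along      : ℓ ≡ ℓ′ → 1 ≤ s → 2 + s ≤ s′ → Shape ℓ s ℓ′ s′
  across     : ℓ ≢ ℓ′ → 1 ≤ s → 1 ≤ s′ → Shape ℓ s ℓ′ s′

-- Bicliques, and the edges forced inside a large claw

record Biclique {n} (G : Graph n) (Q : ℕ) (U : List (Fin n)) : Set where
  field
    as bs : List (Fin n)
    len-as : length as ≡ Q
    len-bs : length bs ≡ Q
    uniq-as : Unique as
    uniq-bs : Unique bs
    as⊆ : All (_∈ U) as
    bs⊆ : All (_∈ U) bs
    complete : All (λ a → All (λ b → adj G a b ≡ true) bs) as

biclique? : ∀ {n} (G : Graph n) Q U → Dec (Biclique G Q U)
biclique? {n} G Q U = map′
  (λ { (as , e , u , i , bs , e′ , u′ , i′ , c) → record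
    { as = as ; bs = bs ; len-as = e ; len-bs = e′ ; uniq-as = u ; uniq-bs = u′ ; as⊆ = i ; bs⊆ = i′ ; complete = c } })
  (λ b → let open Biclique b in as , len-as , uniq-as , as⊆ , bs , len-bs , uniq-bs , bs⊆ , complete)
  (anyList? Q λ as → unique? as ×-dec All.all? in? as ×-dec anyList? Q λ bs → unique? bs ×-dec All.all? in? bs ×-dec
    All.all? (λ a → All.all? (λ b → adj G a b Boolₚ.≟ true) bs) as)
  where
  unique? = UniqueDec.unique? (_≟_ {n})
  in? = λ x → MemDec._∈?_ _≟_ x U

module _ {n : ℕ} (G : Graph n) where

  biclique-tabulate : ∀ {Q U} (u v : Fin Q → Fin n) → Injective _≡_ _≡_ u → Injective _≡_ _≡_ v →
    (∀ i → u i ∈ U) → (∀ i → v i ∈ U) → (∀ i j → adj G (u i) (v j) ≡ true) → Biclique G Q U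
  biclique-tabulate u v u-inj v-inj u∈ v∈ c = record
    { as = tabulate u ; bs = tabulate v ; len-as = length-tabulate u ; len-bs = length-tabulate v
    ; uniq-as = Uniqueₚ.tabulate⁺ u-inj ; uniq-bs = Uniqueₚ.tabulate⁺ v-inj
    ; as⊆ = Allₚ.tabulate⁺ u∈ ; bs⊆ = Allₚ.tabulate⁺ v∈
    ; complete = Allₚ.tabulate⁺ λ i → Allₚ.tabulate⁺ λ j → c i j }

  biclique-from : ∀ {Q U} (u v : ℕ → Fin n) →
    (∀ {x y} → x < Q → y < Q → u x ≡ u y → x ≡ y) → (∀ {x y} → x < Q → y < Q → v x ≡ v y → x ≡ y) →
    (∀ {x} → x < Q → u x ∈ U) → (∀ {x} → x < Q → v x ∈ U) →
    (∀ {x y} → x < Q → y < Q → adj G (u x) (v y) ≡ true) → Biclique G Q U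
  biclique-from u v u-inj v-inj u∈ v∈ c = biclique-tabulate (u ∘ toℕ) (v ∘ toℕ)
    (λ {i} {j} e → toℕ-injective (u-inj (toℕ<n i) (toℕ<n j) e)) (λ {i} {j} e → toℕ-injective (v-inj (toℕ<n i) (toℕ<n j) e))
    (u∈ ∘ toℕ<n) (v∈ ∘ toℕ<n) (λ i j → c (toℕ<n i) (toℕ<n j))

  module _ (bip : Bipartite G) where

    private
      c : Fin n → Bool
      c = proj₁ bip
      proper : ∀ u v → adj G u v ≡ true → c u ≢ c v
      proper = proj₂ bip

    same-colour : ∀ {u v w} → adj G u v ≡ true → adj G v w ≡ true → proj₁ bip u ≡ proj₁ bip w
    same-colour {u} {v} {w} p q with c u | c v | c w | proper _ _ p | proper _ _ q
    ... | true | true | _ | a | _ = ⊥-elim (a refl)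
    ... | false | false | _ | a | _ = ⊥-elim (a refl)
    ... | _ | true | true | _ | b = ⊥-elim (b refl)
    ... | _ | false | false | _ | b = ⊥-elim (b refl)
    ... | true | false | true | _ | _ = refl
    ... | false | true | false | _ | _ = refl

    non-adjacent : ∀ {u w} → proj₁ bip u ≡ proj₁ bip w → adj G u w ≡ false
    non-adjacent {u} {w} e = Boolₚ.¬-not λ q → proper u w q e

three : ∀ {a} {A : Set a} → A → A → A → Fin 3 → A
three x y z zero = x
three x y z (suc zero) = y
three x y z (suc (suc zero)) = z

-- Claws are assembled with the two relevant legs in places 0 and 1; this map takes the legs `ℓ` and
-- `ℓ′` of a stuck pair to these places.
leg-perm : Fin 3 → Fin 3 → Fin 3 → Fin 3
leg-perm ℓ ℓ′ i = if ⌊ i ≟ ℓ ⌋ then zero else if ⌊ i ≟ ℓ′ ⌋ then suc zero else suc (suc zero)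

leg-perm-inj : ∀ ℓ ℓ′ → ℓ ≢ ℓ′ → ∀ i j → leg-perm ℓ ℓ′ i ≡ leg-perm ℓ ℓ′ j → i ≡ j
leg-perm-inj = toWitness {a? = all? λ ℓ → all? λ ℓ′ → ¬? (ℓ ≟ ℓ′) →-dec all? λ i → all? λ j →
  (leg-perm ℓ ℓ′ i ≟ leg-perm ℓ ℓ′ j) →-dec (i ≟ j)} _

leg-perm-₁ : ∀ ℓ ℓ′ → leg-perm ℓ ℓ′ ℓ ≡ zero
leg-perm-₁ ℓ ℓ′ with ℓ ≟ ℓ
... | yes _ = refl
... | no p = ⊥-elim (p refl)

leg-perm-₂ : ∀ ℓ ℓ′ → ℓ ≢ ℓ′ → leg-perm ℓ ℓ′ ℓ′ ≡ suc zero
leg-perm-₂ ℓ ℓ′ p with ℓ′ ≟ ℓ | ℓ′ ≟ ℓ′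
... | yes q | _ = ⊥-elim (p (sym q))
... | no _ | yes _ = refl
... | no _ | no q = ⊥-elim (q refl)

other-leg : Fin 3 → Fin 3
other-leg zero = suc zero
other-leg (suc _) = zero

other-leg-≢ : ∀ ℓ → ℓ ≢ other-leg ℓ
other-leg-≢ zero ()
other-leg-≢ (suc _) ()

-- A long subdivided claw is coded by the numbers 0 … 3R: the codes 0 … 2R run along two legs, with the
-- centre at R, and 2R + j is the j-th vertex of the third leg.
module Line {n : ℕ} (G : Graph n) (R r : ℕ) (w : ℕ → Fin n)
  (line : ∀ {i} → i < 3 * R → i ≢ 2 * R → adj G (w i) (w (suc i)) ≡ true)
  (branch : adj G (w R) (w (suc (2 * R))) ≡ true)
  (w-inj : ∀ {i j} → i ≤ 3 * R → j ≤ 3 * R → w i ≡ w j → i ≡ j) where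

  private
    _~_ : ℕ → ℕ → Set
    i ~ j = adj G (w i) (w j) ≡ true

  -- The codes of a leg are confined to the interval from `lo` up to but excluding `hi`, which
  -- avoids the centre. Disjointness of legs then reduces to comparing ends of intervals, as in
  -- `Apart`.
  record Leg (z lo hi : ℕ) (f : ℕ → ℕ) : Set where
    field
      start : z ~ f 0
      go    : ∀ {k} → suc k < r → f k ~ f (suc k)
      lower : ∀ {k} → k < r → lo ≤ f k
      upper : ∀ {k} → k < r → f k < hi
      f-inj : ∀ {k k′} → k < r → k′ < r → f k ≡ f k′ → k ≡ k′
      top   : hi ≤ suc (3 * R)
      z∉    : z < lo ⊎ hi ≤ z
  open Leg

  private
    2R≤3R : 2 * R ≤ 3 * R
    2R≤3R = *-monoˡ-≤ R {2} {3} (s≤s (s≤s z≤n))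

  -- The codes of a leg that climbs from `a`, and after the code `a + s` follows a chord that skips
  -- `e` codes. With `e` equal to 0 this is a plain ascending leg.
  jump : ℕ → ℕ → ℕ → ℕ → ℕ
  jump a s e k = a + (k + (if ⌊ k ℕₚ.≤? s ⌋ then 0 else e))

  jump-≤ : ∀ a {s} e {k} → k ≤ s → jump a s e k ≡ a + k
  jump-≤ a {s} e {k} p with k ℕₚ.≤? s
  ... | yes _ = cong (a +_) (+-identityʳ k)
  ... | no q = ⊥-elim (q p)

  jump-> : ∀ a {s} e {k} → s < k → jump a s e k ≡ a + (k + e)
  jump-> a {s} e {k} p with k ℕₚ.≤? s
  ... | yes q = ⊥-elim (<⇒≱ p q)
  ... | no _ = refl

  jump-leg : ∀ {z} a s e → z ~ a → (a + s) ~ (a + (suc s + e)) → a + (r + e) ≤ suc (2 * R) → z < a →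
    Leg z a (a + (r + e)) (jump a s e)
  jump-leg {z} a s e za hop bound z<a = record
    { start = subst (z ~_) (sym (trans (jump-≤ a {s} e z≤n) (+-identityʳ a))) za ; go = go′ ; lower = λ _ → m≤m+n a _
    ; upper = upper′
    ; f-inj = λ {k} {k′} _ _ p → shift-inj k k′ p
    ; top = ≤-trans bound (s≤s 2R≤3R) ; z∉ = inj₁ z<a }
    where
    f = jump a s e
    jump≤ : ∀ k → f k ≤ a + (k + e)
    jump≤ k with k ℕₚ.≤? s
    ... | yes _ = +-monoʳ-≤ a (+-monoʳ-≤ k z≤n)
    ... | no _ = ≤-refl
    upper′ : ∀ {k} → k < r → f k < a + (r + e)
    upper′ {k} k<r = ≤-<-trans (jump≤ k) (+-monoʳ-< a (+-monoˡ-< e k<r))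
    shift-mono : ∀ {k k′} → k < k′ → f k < f k′
    shift-mono {k} {k′} lt with k ℕₚ.≤? s | k′ ℕₚ.≤? s
    ... | yes _ | yes _ = +-monoʳ-< a (+-monoˡ-< 0 lt)
    ... | yes _ | no _ = +-monoʳ-< a (+-mono-<-≤ lt z≤n)
    ... | no p | yes q = ⊥-elim (p (≤-trans (<⇒≤ lt) q))
    ... | no _ | no _ = +-monoʳ-< a (+-monoˡ-< e lt)
    shift-inj : ∀ k k′ → f k ≡ f k′ → k ≡ k′
    shift-inj k k′ p with <-cmp k k′
    ... | tri< lt _ _ = ⊥-elim (<⇒≢ (shift-mono lt) p)
    ... | tri≈ _ q _ = q
    ... | tri> _ _ gt = ⊥-elim (<⇒≢ (shift-mono gt) (sym p))
    consecutive : ∀ x → suc x ≤ 2 * R → x ~ suc x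
    consecutive x b = line (≤-trans b 2R≤3R) (<⇒≢ b)
    go′ : ∀ {k} → suc k < r → f k ~ f (suc k)
    go′ {k} k<r with <-cmp k s
    ... | tri< k<s _ _ = subst₂ _~_ (sym (jump-≤ a e (<⇒≤ k<s))) (sym (trans (jump-≤ a e k<s) (+-suc a k)))
      (consecutive (a + k) (≤-trans (≤-reflexive (sym (+-suc a k))) (≤-pred (≤-trans (≤-trans (≤-reflexive (sym (+-suc a (suc k)))) (+-monoʳ-≤ a (≤-trans k<r (m≤m+n r e)))) bound))))
    ... | tri≈ _ refl _ = subst₂ _~_ (sym (jump-≤ a e ≤-refl)) (sym (jump-> a e ≤-refl)) hop
    ... | tri> _ _ s<k = subst₂ _~_ (sym (jump-> a e s<k)) (sym (trans (jump-> a e (<-trans s<k ≤-refl)) (+-suc a (k + e))))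
      (consecutive (a + (k + e)) (≤-pred (≤-trans (≤-trans (≤-reflexive (sym (trans (+-suc a (suc (k + e))) (cong suc (+-suc a (k + e)))))) (+-monoʳ-≤ a (+-monoˡ-≤ e k<r))) bound)))

  up-leg : ∀ {z} a → z ~ a → a + r ≤ suc (2 * R) → z < a → 1 < r → Leg z a (a + (r + 0)) (jump a 0 0)
  up-leg {z} a za bound z<a 1<r = jump-leg a 0 0 za
    (subst₂ _~_ (sym (+-identityʳ a)) (sym (+-comm a 1)) (line (≤-trans a<2R 2R≤3R) (<⇒≢ a<2R)))
    (subst (λ k → a + k ≤ suc (2 * R)) (sym (+-identityʳ r)) bound) z<a
    where
    a<2R : a < 2 * R
    a<2R = ≤-pred (≤-trans (≤-trans (≤-reflexive (cong suc (+-comm 1 a))) (≤-trans (≤-reflexive (sym (+-suc a 1))) (+-monoʳ-≤ a 1<r))) bound)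

  up-value : ∀ a k → jump a 0 0 k ≡ a + k
  up-value a k with k ℕₚ.≤? 0
  ... | yes _ = cong (a +_) (+-identityʳ k)
  ... | no _ = cong (a +_) (+-identityʳ k)

  down-leg : ∀ {z} a → z ~ a → r ≤ suc a → a ≤ 2 * R → (z < suc a ∸ r ⊎ a < z) → Leg z (suc a ∸ r) (suc a) (a ∸_)
  down-leg {z} a za r≤ a≤ z∉′ = record
    { start = za ; go = go′ ; lower = λ k<r → ∸-monoʳ-≤ (suc a) k<r
    ; upper = λ {k} _ → s≤s (m∸n≤m a k)
    ; f-inj = λ k<r k′<r p → ∸-cancelˡ-≡ (≤-pred (≤-trans k<r r≤)) (≤-pred (≤-trans k′<r r≤)) p
    ; top = s≤s (≤-trans a≤ 2R≤3R) ; z∉ = z∉′ }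
    where
    go′ : ∀ {k} → suc k < r → (a ∸ k) ~ (a ∸ suc k)
    go′ {k} k<r = subst (_~ (a ∸ suc k)) suc-eq (~-sym G (line (≤-trans lt 2R≤3R) (<⇒≢ lt)))
      where
      suc-eq : suc (a ∸ suc k) ≡ a ∸ k
      suc-eq = sym (+-∸-assoc 1 {a} {suc k} (≤-pred (≤-trans k<r r≤)))
      lt : a ∸ suc k < 2 * R
      lt = ≤-trans (≤-reflexive suc-eq) (≤-trans (m∸n≤m a k) a≤)

  branch-leg : ∀ {z} a → z ~ a → 2 * R < a → a + r ≤ suc (3 * R) → z < a → Leg z a (a + r) (a +_)
  branch-leg {z} a za 2R<a bound z<a = record
    { start = subst (z ~_) (sym (+-identityʳ a)) za ; go = go′ ; lower = λ {k} _ → m≤m+n a k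
    ; upper = λ k<r → +-monoʳ-< a k<r
    ; f-inj = λ _ _ p → +-cancelˡ-≡ a _ _ p ; top = bound ; z∉ = inj₁ z<a }
    where
    go′ : ∀ {k} → suc k < r → (a + k) ~ (a + suc k)
    go′ {k} k<r = subst ((a + k) ~_) (sym (+-suc a k))
      (line (≤-pred (≤-trans (≤-trans (≤-reflexive (sym (trans (+-suc a (suc k)) (cong suc (+-suc a k))))) (+-monoʳ-≤ a k<r)) bound))
        (λ p → <⇒≢ (<-≤-trans 2R<a (m≤m+n a k)) (sym p)))

  Apart : ℕ → ℕ → ℕ → ℕ → Set
  Apart lo hi lo′ hi′ = hi ≤ lo′ ⊎ hi′ ≤ lo

  claw : ℕ → (Fin 3 → ℕ → ℕ) → (Fin 3 → Fin 3) → Fin 3 → ℕ → Fin n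
  claw z F σ ℓ zero = w z
  claw z F σ ℓ (suc k) = w (F (σ ℓ) k)

  module _ {z lo₁ hi₁ lo₂ hi₂ lo₃ hi₃ f g h} (1≤r : 1 ≤ r) (z≤ : z ≤ 3 * R)
    (L₁ : Leg z lo₁ hi₁ f) (L₂ : Leg z lo₂ hi₂ g) (L₃ : Leg z lo₃ hi₃ h)
    (a₁₂ : Apart lo₁ hi₁ lo₂ hi₂) (a₁₃ : Apart lo₁ hi₁ lo₃ hi₃) (a₂₃ : Apart lo₂ hi₂ lo₃ hi₃)
    (σ : Fin 3 → Fin 3) (σ-inj : ∀ i j → σ i ≡ σ j → i ≡ j) where

    private
      F : Fin 3 → ℕ → ℕ
      lo hi : Fin 3 → ℕ
      F = three f g h
      lo = three lo₁ lo₂ lo₃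
      hi = three hi₁ hi₂ hi₃

      leg : ∀ i → Leg z (lo i) (hi i) (F i)
      leg zero = L₁
      leg (suc zero) = L₂
      leg (suc (suc zero)) = L₃

      apart-sym : ∀ {a b c d} → Apart a b c d → Apart c d a b
      apart-sym (inj₁ p) = inj₂ p
      apart-sym (inj₂ p) = inj₁ p

      apart : ∀ i j → i ≢ j → Apart (lo i) (hi i) (lo j) (hi j)
      apart zero zero p = ⊥-elim (p refl)
      apart zero (suc zero) _ = a₁₂
      apart zero (suc (suc zero)) _ = a₁₃
      apart (suc zero) zero _ = apart-sym a₁₂
      apart (suc zero) (suc zero) p = ⊥-elim (p refl)
      apart (suc zero) (suc (suc zero)) _ = a₂₃
      apart (suc (suc zero)) zero _ = apart-sym a₁₃
      apart (suc (suc zero)) (suc zero) _ = apart-sym a₂₃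
      apart (suc (suc zero)) (suc (suc zero)) p = ⊥-elim (p refl)

      code≤ : ∀ i {k} → k < r → F i k ≤ 3 * R
      code≤ i k<r = ≤-pred (≤-trans (upper (leg i) k<r) (top (leg i)))

      z≢ : ∀ i {k} → k < r → z ≢ F i k
      z≢ i k<r p with z∉ (leg i)
      ... | inj₁ q = <⇒≱ q (≤-trans (lower (leg i) k<r) (≤-reflexive (sym p)))
      ... | inj₂ q = <⇒≱ (upper (leg i) k<r) (≤-trans q (≤-reflexive p))

      F-inj : ∀ i j {k k′} → k < r → k′ < r → F i k ≡ F j k′ → i ≡ j × k ≡ k′
      F-inj i j {k} {k′} k<r k′<r p with i ≟ j
      ... | yes refl = refl , f-inj (leg i) k<r k′<r p
      ... | no i≢j with apart i j i≢j
      ...   | inj₁ q = ⊥-elim (<⇒≢ (<-≤-trans (upper (leg i) k<r) (≤-trans q (lower (leg j) k′<r))) p)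
      ...   | inj₂ q = ⊥-elim (<⇒≢ (<-≤-trans (upper (leg j) k′<r) (≤-trans q (lower (leg i) k<r))) (sym p))

    claw-isTrip : IsTrip G r (claw z F σ)
    claw-isTrip = record { centre≡ = λ _ _ → refl ; next = λ ℓ → next′ ℓ ; trip-inj = inj′ }
      where
      next′ : ∀ ℓ {k} → k < r → adj G (claw z F σ ℓ k) (claw z F σ ℓ (suc k)) ≡ true
      next′ ℓ {zero} _ = start (leg (σ ℓ))
      next′ ℓ {suc k} k<r = go (leg (σ ℓ)) k<r
      inj′ : ∀ {ℓ ℓ′ k k′} → k ≤ r → k′ ≤ r → claw z F σ ℓ k ≡ claw z F σ ℓ′ k′ → k ≡ k′ × (k ≡ 0 ⊎ ℓ ≡ ℓ′)
      inj′ {k = zero} {zero} _ _ _ = refl , inj₁ refl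
      inj′ {ℓ} {ℓ′} {zero} {suc k′} _ b p = ⊥-elim (z≢ (σ ℓ′) b (w-inj z≤ (code≤ (σ ℓ′) b) p))
      inj′ {ℓ} {ℓ′} {suc k} {zero} a _ p = ⊥-elim (z≢ (σ ℓ) a (w-inj z≤ (code≤ (σ ℓ) a) (sym p)))
      inj′ {ℓ} {ℓ′} {suc k} {suc k′} a b p with F-inj (σ ℓ) (σ ℓ′) a b (w-inj (code≤ (σ ℓ) a) (code≤ (σ ℓ′) b) p)
      ... | q , refl = refl , inj₂ (σ-inj _ _ q)

    claw-inside : ∀ ℓ {k} → k ≤ r → ∃ λ i → i ≤ 3 * R × claw z F σ ℓ k ≡ w i
    claw-inside ℓ {zero} _ = z , z≤ , refl
    claw-inside ℓ {suc k} p = F (σ ℓ) k , code≤ (σ ℓ) p , refl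

-- If two fixed positions are adjacent in every small subdivided claw inside a large one, then new edges
-- provide new small claws, and the edges found in this way contain a large biclique.
module Forced {n : ℕ} (G : Graph n) (R r : ℕ) (w : ℕ → Fin n)
  (line : ∀ {i} → i < 3 * R → i ≢ 2 * R → adj G (w i) (w (suc i)) ≡ true)
  (branch : adj G (w R) (w (suc (2 * R))) ≡ true)
  (w-inj : ∀ {i j} → i ≤ 3 * R → j ≤ 3 * R → w i ≡ w j → i ≡ j)
  (2≤r : 2 ≤ r) (U : List (Fin n)) (w∈ : ∀ {i} → i ≤ 3 * R → w i ∈ U) where

  open Line G R r w line branch w-inj

  private
    infix 4 _~_
    _~_ : ℕ → ℕ → Set
    i ~ j = adj G (w i) (w j) ≡ true

    1≤r : 1 ≤ r
    1≤r = ≤-trans (s≤s z≤n) 2≤r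

    ~-step : ∀ {z} → z < 2 * R → z ~ suc z
    ~-step lt = line (≤-trans lt (*-monoˡ-≤ R {2} {3} (s≤s (s≤s z≤n)))) (<⇒≢ lt)

    down-from : ∀ {z} → r ≤ z → z ≤ 2 * R → Leg z (z ∸ r) z (λ k → z ∸ suc k)
    down-from {zero} p _ = ⊥-elim (<⇒≱ 1≤r p)
    down-from {suc a} p q = down-leg a (~-sym G (~-step q)) p (<⇒≤ q) (inj₂ ≤-refl)

    module Room {X : ℕ} (room : X + (4 * r + 4) ≤ R) where

      room-up : ∀ {x b} → x ≤ X → b ≤ 3 * r + 3 → R + x + b + r ≤ suc (2 * R)
      -- `≤-from-sum` turns a linear inequality into an identity for the ring solver, with the slack
      -- as first argument. The summand 4r + 4 in `room` pays for a constant offset of up to 3r + 3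
      -- and for one more leg of r vertices.
      room-up {x} {b} p q = ≤-from-sum 2 (+-mono-≤ (+-mono-≤ p q) room) (eq R x b r X)
        where
        eq : ∀ R x b r X → R + x + b + r + (X + (3 * r + 3) + R) + 2 ≡ suc (2 * R) + (x + b + (X + (4 * r + 4)))
        eq = solve-∀

      room-branch : ∀ {x} → x ≤ X → suc (2 * R) + x + r ≤ suc (3 * R)
      room-branch {x} p = ≤-from-sum (3 * r + 4) (+-mono-≤ p room) (eq R x r X)
        where
        eq : ∀ R x r X → suc (2 * R) + x + r + (X + R) + (3 * r + 4) ≡ suc (3 * R) + (x + (X + (4 * r + 4)))
        eq = solve-∀

      r≤R : r ≤ R
      r≤R = ≤-trans (≤-trans (m≤m+n r _) (≤-trans (m≤m+n (4 * r) 4) (m≤n+m (4 * r + 4) X))) room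

      code≤ : ∀ {x b} → x ≤ X → b ≤ 3 * r + 3 → R + x + b ≤ 2 * R
      code≤ {x} {b} p q = ≤-pred (≤-trans (≤-trans (≤-reflexive (sym (+-comm (R + x + b) 1))) (+-monoʳ-≤ (R + x + b) 1≤r)) (room-up p q))

      code<3R : ∀ {x b} → x ≤ X → b ≤ 3 * r + 3 → R + x + b ≤ 3 * R
      code<3R p q = ≤-trans (code≤ p q) (*-monoˡ-≤ R {2} {3} (s≤s (s≤s z≤n)))

    at-0 : ∀ a {b} → b ~ a → b ~ a + 0
    at-0 a {b} = subst (b ~_) (sym (+-identityʳ a))

  module Across (ℓ ℓ′ : Fin 3) (ℓ≢ℓ′ : ℓ ≢ ℓ′) (s₁ t₁ Q : ℕ) (s≤r : suc s₁ ≤ r) (t≤r : suc t₁ ≤ r)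
    (Φ : ∀ t → IsTrip G r t → (∀ ℓ {k} → k ≤ r → ∃ λ i → i ≤ 3 * R × t ℓ k ≡ w i) →
      adj G (t ℓ (suc s₁)) (t ℓ′ (suc t₁)) ≡ true)
    (room : (Q * (suc s₁ + t₁) + suc s₁ * Q + Q) * (suc s₁ + t₁) + (4 * r + 4) ≤ R) where

    private
      s D K : ℕ
      s = suc s₁
      D = s + t₁
      K = Q * D + s * Q + Q
      open Room {K * D} room

      Ψ : ∀ {z lo₁ hi₁ lo₂ hi₂ lo₃ hi₃ f g h} → z ≤ 3 * R → Leg z lo₁ hi₁ f → Leg z lo₂ hi₂ g → Leg z lo₃ hi₃ h →
        Apart lo₁ hi₁ lo₂ hi₂ → Apart lo₁ hi₁ lo₃ hi₃ → Apart lo₂ hi₂ lo₃ hi₃ → f s₁ ~ g t₁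
      Ψ {f = f} {g} {h} z≤ L₁ L₂ L₃ a b c =
        subst₂ (λ i j → three f g h i s₁ ~ three f g h j t₁) (leg-perm-₁ ℓ ℓ′) (leg-perm-₂ ℓ ℓ′ ℓ≢ℓ′)
          (Φ _ (claw-isTrip 1≤r z≤ L₁ L₂ L₃ a b c (leg-perm ℓ ℓ′) (leg-perm-inj ℓ ℓ′ ℓ≢ℓ′))
               (claw-inside 1≤r z≤ L₁ L₂ L₃ a b c (leg-perm ℓ ℓ′) (leg-perm-inj ℓ ℓ′ ℓ≢ℓ′)))

      ns≤ : ∀ {n} → n ≤ K → n * s ≤ K * D
      ns≤ p = *-mono-≤ p (m≤m+n s t₁)
      nt≤ : ∀ {n} → n ≤ K → n * t₁ ≤ K * D
      nt≤ p = *-mono-≤ p (m≤n+m t₁ s)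

      z-ok : ∀ {x} → x ≤ K * D → R + x ≤ 2 * R
      z-ok p = ≤-trans (≤-reflexive (sym (+-identityʳ _))) (code≤ p z≤n)

      2R≤3R : 2 * R ≤ 3 * R
      2R≤3R = *-monoˡ-≤ R {2} {3} (s≤s (s≤s z≤n))

    -- The third leg becomes attached further up the line. With centre `z`, one leg climbs the line
    -- and one enters the third leg by the previous edge; the forced edge joins a vertex `s` codes
    -- above `z` to a vertex `t₁` codes further out. Hence each of these centres carries a claw of
    -- its own.
    branch-edge : ∀ n → n ≤ K → R + n * s ~ suc (2 * R) + n * t₁
    branch-edge zero _ = subst₂ _~_ (sym (+-identityʳ R)) (sym (+-identityʳ _)) branch
    branch-edge (suc n) n<K = subst₂ _~_ (trans (up-value (suc z) s₁) (eq₁ R n s₁)) (eq₂ R n t₁)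
      (Ψ (≤-trans (z-ok x≤) 2R≤3R)
        (up-leg (suc z) (~-step (≤-trans (≤-reflexive (+-comm 1 z)) (code≤ x≤ (≤-trans (s≤s z≤n) (m≤n+m 3 (3 * r))))))
          (subst (λ k → k + r ≤ suc (2 * R)) (+-comm z 1) (room-up x≤ (≤-trans (s≤s z≤n) (m≤n+m 3 (3 * r))))) ≤-refl 2≤r)
        (branch-leg b (branch-edge n (<⇒≤ n<K)) (s≤s (m≤m+n (2 * R) _)) (room-branch (nt≤ (<⇒≤ n<K))) z<b)
        (down-from (≤-trans r≤R (m≤m+n R _)) (z-ok x≤))
        (inj₁ (≤-trans (subst (λ k → k + (r + 0) ≤ suc (2 * R)) (+-comm z 1)
          (subst (λ k → z + 1 + k ≤ suc (2 * R)) (sym (+-identityʳ r)) (room-up x≤ (≤-trans (s≤s z≤n) (m≤n+m 3 (3 * r)))))) (s≤s (m≤m+n (2 * R) _))))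
        (inj₂ (n≤1+n z)) (inj₂ (<⇒≤ z<b)))
      where
      z = R + n * s
      b = suc (2 * R) + n * t₁
      x≤ = ns≤ (<⇒≤ n<K)
      z<b : z < b
      z<b = s≤s (≤-trans (z-ok x≤) (m≤m+n (2 * R) _))
      eq₁ : ∀ R n s₁ → suc (R + n * suc s₁) + s₁ ≡ R + suc n * suc s₁
      eq₁ = solve-∀
      eq₂ : ∀ R n t₁ → suc (2 * R) + n * t₁ + t₁ ≡ suc (2 * R) + suc n * t₁
      eq₂ = solve-∀

    -- Now the centre is `s` codes above the left end. One leg descends to that end, one climbs from
    -- the far end of the previous edge, and the third is supplied by `branch-edge`. The forced edge
    -- is longer by `D`, that is, by `s` at its left end and by `t₁` at its right end.
    line-edge : ∀ M n → n + M ≤ K → R + n * s ~ R + n * s + suc (M * D)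
    line-edge zero n n≤K = subst (R + n * s ~_) (+-comm 1 _)
      (~-step (≤-trans (≤-reflexive (+-comm 1 _)) (code≤ (ns≤ (≤-trans (m≤m+n n 0) n≤K)) (≤-trans (s≤s z≤n) (m≤n+m 3 (3 * r))))))
    line-edge (suc M) n n≤K = subst₂ _~_ (trans (cong (_∸ s) (eq₀ R n s₁)) (m+n∸m≡n s (R + n * s))) (trans (up-value a t₁) (eq₁ R n s₁ t₁ M))
      (Ψ (≤-trans (z-ok x≤) 2R≤3R)
        (down-from (≤-trans r≤R (m≤m+n R _)) (z-ok x≤))
        (up-leg a (line-edge M (suc n) n′≤K) room-a z<a 2≤r)
        (branch-leg b (branch-edge (suc n) n+1≤K) (s≤s (m≤m+n (2 * R) _)) (room-branch (nt≤ n+1≤K)) z<b)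
        (inj₁ (<⇒≤ z<a)) (inj₁ (<⇒≤ z<b))
        (inj₁ (≤-trans (subst (λ k → a + k ≤ suc (2 * R)) (sym (+-identityʳ r)) room-a) (s≤s (m≤m+n (2 * R) _)))))
      where
      n′≤K : suc n + M ≤ K
      n′≤K = ≤-trans (≤-reflexive (sym (+-suc n M))) n≤K
      n+1≤K : suc n ≤ K
      n+1≤K = ≤-trans (m≤m+n (suc n) M) n′≤K
      z = R + suc n * s
      a = z + suc (M * D)
      b = suc (2 * R) + suc n * t₁
      x≤ = ns≤ n+1≤K
      z<a : z < a
      z<a = ≤-trans (≤-reflexive (+-comm 1 z)) (+-monoʳ-≤ z (s≤s z≤n))
      z<b : z < b
      z<b = s≤s (≤-trans (z-ok x≤) (m≤m+n (2 * R) _))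
      y≤ : suc n * s + M * D ≤ K * D
      y≤ = ≤-trans (+-monoˡ-≤ (M * D) (*-monoʳ-≤ (suc n) (m≤m+n s t₁))) (≤-trans (≤-reflexive (sym (*-distribʳ-+ D (suc n) M))) (*-monoˡ-≤ D n′≤K))
      room-a : a + r ≤ suc (2 * R)
      room-a = subst (λ k → k + r ≤ suc (2 * R)) (eq R (suc n * s) (M * D)) (room-up y≤ (≤-trans (s≤s z≤n) (m≤n+m 3 (3 * r))))
        where
        eq : ∀ R x y → R + (x + y) + 1 ≡ R + x + suc y
        eq = solve-∀
      eq₀ : ∀ R n s₁ → R + suc n * suc s₁ ≡ suc s₁ + (R + n * suc s₁)
      eq₀ = solve-∀
      eq₁ : ∀ R n s₁ t₁ M → R + suc n * suc s₁ + suc (M * (suc s₁ + t₁)) + t₁ ≡ R + n * suc s₁ + suc (suc M * (suc s₁ + t₁))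
      eq₁ = solve-∀

    -- Left ends move in steps of `s` and lengths grow in steps of `D`, so left ends are taken at
    -- multiples of `D * s`. Then the edge from the `x`-th left end to the `y`-th right end has `M`
    -- equal to `s * (Q ∸ x) + y`, which is where `K` comes from.
    biclique : Biclique G Q U
    biclique = biclique-from G (λ x → w (R + x * D * s)) (λ y → w (R + suc ((s * Q + y) * D)))
      (λ {x} {y} p q e → *-cancelʳ-≡ x y D (*-cancelʳ-≡ (x * D) (y * D) s (+-cancelˡ-≡ R _ _ (w-inj (u≤ p) (u≤ q) e))))
      (λ {x} {y} p q e → +-cancelˡ-≡ (s * Q) _ _ (*-cancelʳ-≡ (s * Q + x) (s * Q + y) D (suc-injective (+-cancelˡ-≡ R _ _ (w-inj (v≤ p) (v≤ q) e)))))
      (w∈ ∘ u≤) (w∈ ∘ v≤) edge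
      where
      n≤ : ∀ {x} → x < Q → x * D ≤ K
      n≤ p = ≤-trans (*-monoˡ-≤ D (<⇒≤ p)) (≤-trans (m≤m+n (Q * D) (s * Q)) (m≤m+n _ Q))
      u≤ : ∀ {x} → x < Q → R + x * D * s ≤ 3 * R
      u≤ p = ≤-trans (z-ok (ns≤ (n≤ p))) 2R≤3R
      v≤ : ∀ {y} → y < Q → R + suc ((s * Q + y) * D) ≤ 3 * R
      v≤ {y} p = ≤-trans (≤-reflexive (eq R ((s * Q + y) * D))) (code<3R (*-monoˡ-≤ D (≤-trans (+-monoʳ-≤ (s * Q) (<⇒≤ p)) (+-monoˡ-≤ Q (m≤n+m (s * Q) (Q * D))))) (≤-trans (s≤s z≤n) (m≤n+m 3 (3 * r))))
        where
        eq : ∀ R x → R + suc x ≡ R + x + 1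
        eq = solve-∀
      edge : ∀ {x y} → x < Q → y < Q → R + x * D * s ~ R + suc ((s * Q + y) * D)
      edge {x} {y} p q = subst (R + x * D * s ~_) (trans (eq R x D s (Q ∸ x) y) (cong (λ k → R + suc ((s * k + y) * D)) (m+[n∸m]≡n (<⇒≤ p))))
        (line-edge (s * (Q ∸ x) + y) (x * D)
          (≤-trans (≤-reflexive (sym (+-assoc (x * D) _ y))) (+-mono-≤ (+-mono-≤ (*-monoˡ-≤ D (<⇒≤ p)) (*-monoʳ-≤ s (m∸n≤m Q x))) (<⇒≤ q))))
        where
        eq : ∀ R x D s x′ y → R + x * D * s + suc ((s * x′ + y) * D) ≡ R + suc ((s * (x + x′) + y) * D)
        eq = solve-∀

  private
    module Spread (D Q : ℕ) (room : (r + Q + Q) * suc D + (4 * r + 4) ≤ R) where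
      K X : ℕ
      K = r + Q + Q
      X = K * suc D
      open Room {X} room public

      -- All left ends precede all right ends, and the pair `x`, `y` is `Q ∸ x + y` steps apart, up
      -- to the extra 1. Left ends start at the `r`-th step because `edge` needs space for a leg of
      -- `r` vertices between the hub and the centre.
      spread : ∀ c → c ≤ 2 * r + 1 →
        (∀ M j → r ≤ j * suc D → j + M ≤ K → R + c + j * suc D ~ R + c + j * suc D + suc (M * suc D)) → Biclique G Q U
      spread c c≤ edge = biclique-from G (λ x → w (R + c + (r + x) * suc D)) (λ y → w (R + c + suc ((r + Q + y) * suc D)))
        (λ {x} {y} p q e → +-cancelˡ-≡ r _ _ (*-cancelʳ-≡ (r + x) (r + y) (suc D) (+-cancelˡ-≡ (R + c) _ _ (w-inj (u≤ p) (u≤ q) e))))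
        (λ {x} {y} p q e → +-cancelˡ-≡ (r + Q) _ _ (*-cancelʳ-≡ (r + Q + x) (r + Q + y) (suc D) (suc-injective (+-cancelˡ-≡ (R + c) _ _ (w-inj (v≤ p) (v≤ q) e)))))
        (w∈ ∘ u≤) (w∈ ∘ v≤) edge′
        where
        c+1≤ : c + 1 ≤ 3 * r + 3
        c+1≤ = ≤-from-sum (r + 1) c≤ (eq c r)
          where
          eq : ∀ c r → c + 1 + (2 * r + 1) + (r + 1) ≡ 3 * r + 3 + c
          eq = solve-∀
        u≤ : ∀ {x} → x < Q → R + c + (r + x) * suc D ≤ 3 * R
        u≤ {x} p = ≤-trans (≤-reflexive (eq R c ((r + x) * suc D)))
          (code<3R (*-monoˡ-≤ (suc D) (≤-trans (+-monoʳ-≤ r (<⇒≤ p)) (m≤m+n (r + Q) Q))) (≤-trans (m≤m+n c 1) c+1≤))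
          where
          eq : ∀ R c x → R + c + x ≡ R + x + c
          eq = solve-∀
        v≤ : ∀ {y} → y < Q → R + c + suc ((r + Q + y) * suc D) ≤ 3 * R
        v≤ {y} p = ≤-trans (≤-reflexive (eq R c ((r + Q + y) * suc D)))
          (code<3R (*-monoˡ-≤ (suc D) (+-monoʳ-≤ (r + Q) (<⇒≤ p))) c+1≤)
          where
          eq : ∀ R c x → R + c + suc x ≡ R + x + (c + 1)
          eq = solve-∀
        edge′ : ∀ {x y} → x < Q → y < Q → R + c + (r + x) * suc D ~ R + c + suc ((r + Q + y) * suc D)
        edge′ {x} {y} p q = subst (R + c + (r + x) * suc D ~_)
          (trans (eq R c r x (Q ∸ x) y D) (cong (λ k → R + c + suc ((r + k + y) * suc D)) (m+[n∸m]≡n (<⇒≤ p))))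
          (edge (Q ∸ x + y) (r + x) (≤-trans (m≤m+n r x) (m≤m*n (r + x) (suc D)))
            (≤-trans (≤-reflexive (trans (sym (+-assoc (r + x) (Q ∸ x) y)) (cong (_+ y) (trans (+-assoc r x (Q ∸ x)) (cong (r +_) (m+[n∸m]≡n (<⇒≤ p))))))) (+-monoʳ-≤ (r + Q) (<⇒≤ q))))
          where
          eq : ∀ R c r x x′ y D → R + c + (r + x) * suc D + suc ((x′ + y) * suc D) ≡ R + c + suc ((r + (x + x′) + y) * suc D)
          eq = solve-∀

      jD≤ : ∀ {j} → j ≤ K → j * suc D ≤ X
      jD≤ = *-monoˡ-≤ (suc D)

      jMD≤ : ∀ {j M} → j + M ≤ K → j * suc D + M * suc D ≤ X
      jMD≤ {j} {M} p = ≤-trans (≤-reflexive (sym (*-distribʳ-+ (suc D) j M))) (*-monoˡ-≤ (suc D) p)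

      2R≤3R : 2 * R ≤ 3 * R
      2R≤3R = *-monoˡ-≤ R {2} {3} (s≤s (s≤s z≤n))

      R≤2R : R ≤ 2 * R
      R≤2R = m≤m+n R _

      room-1 : ∀ {b} → b ≤ 3 → b ≤ 3 * r + 3
      room-1 p = ≤-trans p (m≤n+m 3 (3 * r))

      from-sum : ∀ {x c k l} → x ≤ X → c ≤ 3 * r + 3 → k ≡ R + x + c + r → l ≡ suc (2 * R) → k ≤ l
      from-sum p q e refl = ≤-trans (≤-reflexive e) (room-up p q)

      from-sum′ : ∀ {x c k} → x ≤ X → c ≤ 3 * r + 3 → k ≡ R + x + c → k ≤ 2 * R
      from-sum′ p q e = ≤-trans (≤-reflexive e) (code≤ p q)

      branch-arm : Leg R (suc (2 * R)) (suc (2 * R) + r) (suc (2 * R) +_)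
      branch-arm = branch-leg (suc (2 * R)) branch ≤-refl
        (subst (λ k → k + r ≤ suc (3 * R)) (+-identityʳ _) (room-branch {0} z≤n)) (s≤s R≤2R)

      down-arm : Leg R (R ∸ r) R (λ k → R ∸ suc k)
      down-arm = down-from r≤R R≤2R

      R~ : R ~ suc R
      R~ = ~-step (from-sum′ {0} {1} z≤n (room-1 (s≤s z≤n)) (eq R))
        where
        eq : ∀ R → suc R ≡ R + 0 + 1
        eq = solve-∀

  module CentreLeg (ℓ ℓ′ : Fin 3) (D Q : ℕ) (t≤r : suc (suc D) ≤ r)
    (Φ : ∀ t → IsTrip G r t → (∀ ℓ {k} → k ≤ r → ∃ λ i → i ≤ 3 * R × t ℓ k ≡ w i) →
      adj G (t ℓ 0) (t ℓ′ (suc (suc D))) ≡ true)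
    (room : (r + Q + Q) * suc D + (4 * r + 4) ≤ R) where

    open Spread D Q room

    private
      Ψ : ∀ {z lo₁ hi₁ lo₂ hi₂ lo₃ hi₃ f g h} → z ≤ 3 * R → Leg z lo₁ hi₁ f → Leg z lo₂ hi₂ g → Leg z lo₃ hi₃ h →
        Apart lo₁ hi₁ lo₂ hi₂ → Apart lo₁ hi₁ lo₃ hi₃ → Apart lo₂ hi₂ lo₃ hi₃ → z ~ f (suc D)
      Ψ {z} {f = f} {g} {h} z≤ L₁ L₂ L₃ a b c =
        subst (λ i → z ~ three f g h i (suc D)) (leg-perm-₁ ℓ′ (other-leg ℓ′))
          (Φ _ (claw-isTrip 1≤r z≤ L₁ L₂ L₃ a b c (leg-perm ℓ′ (other-leg ℓ′)) (leg-perm-inj ℓ′ _ (other-leg-≢ ℓ′)))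
               (claw-inside 1≤r z≤ L₁ L₂ L₃ a b c (leg-perm ℓ′ (other-leg ℓ′)) (leg-perm-inj ℓ′ _ (other-leg-≢ ℓ′))))

    -- The centre stays at `R`. A known neighbour `a` of `R` serves as the first vertex of an
    -- ascending leg, and the forced edge makes the vertex `suc D` codes further up a neighbour as
    -- well.
    hub : ∀ j → j ≤ K → R ~ R + 1 + j * suc D
    hub zero _ = at-0 (R + 1) (subst (R ~_) (+-comm 1 R) R~)
    hub (suc j) j<K = subst (R ~_) (trans (up-value a (suc D)) (eq R j D))
      (Ψ (≤-trans R≤2R 2R≤3R) (up-leg a (hub j (<⇒≤ j<K)) bound R<a 2≤r) down-arm branch-arm
        (inj₂ (<⇒≤ R<a)) (inj₁ (subst (λ k → a + k ≤ suc (2 * R)) (sym (+-identityʳ r)) bound)) (inj₁ (≤-trans R≤2R (n≤1+n _))))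
      where
      a = R + 1 + j * suc D
      R<a : R < a
      R<a = ≤-trans (≤-reflexive (+-comm 1 R)) (m≤m+n (R + 1) _)
      bound : a + r ≤ suc (2 * R)
      bound = from-sum (jD≤ (<⇒≤ j<K)) (room-1 {1} (s≤s z≤n)) (eq′ R (j * suc D) r) refl
        where
        eq′ : ∀ R x r → R + 1 + x + r ≡ R + x + 1 + r
        eq′ = solve-∀
      eq : ∀ R j D → R + 1 + j * suc D + suc D ≡ R + 1 + suc j * suc D
      eq = solve-∀

    -- The argument of `hub` with a new centre `z`. Its missing third leg runs over the edge from
    -- `z` to `R` and then down from `R`; the condition on `j` keeps the leg descending from `z`
    -- above `R`.
    spread-edge : ∀ M j → r ≤ j * suc D → j + M ≤ K → R + 1 + j * suc D ~ R + 1 + j * suc D + suc (M * suc D)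
    spread-edge zero j _ j≤K = subst (R + 1 + j * suc D ~_) (+-comm 1 _)
      (~-step (from-sum′ (jD≤ (≤-trans (m≤m+n j 0) j≤K)) (room-1 {2} (s≤s (s≤s z≤n))) (eq R (j * suc D))))
      where
      eq : ∀ R x → suc (R + 1 + x) ≡ R + x + 2
      eq = solve-∀
    spread-edge (suc M) j r≤ j≤K = subst (z ~_) (trans (up-value a (suc D)) (eq R j M D))
      (Ψ (≤-trans z≤ 2R≤3R) (up-leg a (spread-edge M j r≤ j+M≤K) bound z<a 2≤r)
        (down-from (≤-trans r≤R (≤-trans (m≤m+n R 1) (m≤m+n (R + 1) _))) z≤)
        (down-leg R (~-sym G (hub j (≤-trans (m≤m+n j M) j+M≤K))) (≤-trans r≤R (n≤1+n R)) R≤2R (inj₂ R<z))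
        (inj₂ (<⇒≤ z<a)) (inj₂ (≤-trans R<z (<⇒≤ z<a))) (inj₂ R<z∸r))
      where
      j+M≤K : j + M ≤ K
      j+M≤K = ≤-trans (+-monoʳ-≤ j (n≤1+n M)) j≤K
      z = R + 1 + j * suc D
      a = z + suc (M * suc D)
      z<a : z < a
      z<a = ≤-trans (≤-reflexive (+-comm 1 z)) (+-monoʳ-≤ z (s≤s z≤n))
      R<z : R < z
      R<z = ≤-trans (≤-reflexive (+-comm 1 R)) (m≤m+n (R + 1) _)
      z≤ : z ≤ 2 * R
      z≤ = from-sum′ (jD≤ (≤-trans (m≤m+n j M) j+M≤K)) (room-1 {1} (s≤s z≤n)) (eq′ R (j * suc D))
        where
        eq′ : ∀ R x → R + 1 + x ≡ R + x + 1
        eq′ = solve-∀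
      bound : a + r ≤ suc (2 * R)
      bound = from-sum (jMD≤ {j} {M} j+M≤K) (room-1 {2} (s≤s (s≤s z≤n))) (eq′ R (j * suc D) (M * suc D) r) refl
        where
        eq′ : ∀ R x y r → R + 1 + x + suc y + r ≡ R + (x + y) + 2 + r
        eq′ = solve-∀
      R<z∸r : suc R ≤ z ∸ r
      R<z∸r = ≤-trans (≤-reflexive (trans (+-comm 1 R) (sym (m+n∸n≡m (R + 1) r)))) (∸-monoˡ-≤ r (+-monoʳ-≤ (R + 1) r≤))
      eq : ∀ R j M D → R + 1 + j * suc D + suc (M * suc D) + suc D ≡ R + 1 + j * suc D + suc (suc M * suc D)
      eq = solve-∀

    biclique : Biclique G Q U
    biclique = spread 1 (m≤n+m 1 (2 * r)) spread-edge

  module Along (ℓ : Fin 3) (s₁ D Q : ℕ) (t≤r : suc s₁ + suc (suc D) ≤ r)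
    (Φ : ∀ t → IsTrip G r t → (∀ ℓ {k} → k ≤ r → ∃ λ i → i ≤ 3 * R × t ℓ k ≡ w i) →
      adj G (t ℓ (suc s₁)) (t ℓ (suc (s₁ + suc (suc D)))) ≡ true)
    (room : (r + Q + Q) * suc D + (4 * r + 4) ≤ R) where

    open Spread D Q room

    private
      Ψ : ∀ {z lo₁ hi₁ lo₂ hi₂ lo₃ hi₃ f g h} → z ≤ 3 * R → Leg z lo₁ hi₁ f → Leg z lo₂ hi₂ g → Leg z lo₃ hi₃ h →
        Apart lo₁ hi₁ lo₂ hi₂ → Apart lo₁ hi₁ lo₃ hi₃ → Apart lo₂ hi₂ lo₃ hi₃ → f s₁ ~ f (s₁ + suc (suc D))
      Ψ {z} {f = f} {g} {h} z≤ L₁ L₂ L₃ a b c =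
        subst (λ i → three f g h i s₁ ~ three f g h i (s₁ + suc (suc D))) (leg-perm-₁ ℓ (other-leg ℓ))
          (Φ _ (claw-isTrip 1≤r z≤ L₁ L₂ L₃ a b c (leg-perm ℓ (other-leg ℓ)) (leg-perm-inj ℓ _ (other-leg-≢ ℓ)))
               (claw-inside 1≤r z≤ L₁ L₂ L₃ a b c (leg-perm ℓ (other-leg ℓ)) (leg-perm-inj ℓ _ (other-leg-≢ ℓ))))

      s<r : suc s₁ ≤ r
      s<r = ≤-trans (m≤m+n (suc s₁) _) t≤r

      -- Jumping along the leg after its code a + s₁ moves the second vertex by one step.
      advance : ∀ {z lo₂ hi₂ lo₃ hi₃ g h} a M → z ≤ 3 * R → z ~ a → a + s₁ ~ a + s₁ + suc (M * suc D) →
        a + (r + M * suc D) ≤ suc (2 * R) → z < a → Leg z lo₂ hi₂ g → Leg z lo₃ hi₃ h →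
        Apart a (a + (r + M * suc D)) lo₂ hi₂ → Apart a (a + (r + M * suc D)) lo₃ hi₃ → Apart lo₂ hi₂ lo₃ hi₃ →
        a + s₁ ~ a + s₁ + suc (suc M * suc D)
      advance a M z≤ za hop bound z<a L₂ L₃ p q r′ =
        subst₂ _~_ (jump-≤ a {s₁} (M * suc D) ≤-refl)
          (trans (jump-> a {s₁} (M * suc D) (≤-trans (≤-reflexive (+-comm 1 s₁)) (+-monoʳ-≤ s₁ (s≤s z≤n)))) (eq a s₁ D M))
          (Ψ z≤ (jump-leg a s₁ (M * suc D) za (subst (a + s₁ ~_) (eq′ a s₁ (M * suc D)) hop) bound z<a) L₂ L₃ p q r′)
        where
        eq : ∀ a s₁ D M → a + (s₁ + suc (suc D) + M * suc D) ≡ a + s₁ + suc (suc M * suc D)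
        eq = solve-∀
        eq′ : ∀ a s₁ x → a + s₁ + suc x ≡ a + (suc s₁ + x)
        eq′ = solve-∀

    -- The first vertex of the pair is fixed at the code `suc R + s₁`. The leg takes the longest
    -- chord known there, and the forced edge is longer by `suc D`.
    hub : ∀ j → j ≤ K → suc R + s₁ ~ suc R + s₁ + suc (j * suc D)
    hub zero _ = subst (suc R + s₁ ~_) (+-comm 1 _) (~-step (from-sum′ {0} {s₁ + 2} z≤n (≤-from-sum (2 * r + 2) s<r (eq s₁ r)) (eq′ R s₁)))
      where
      eq : ∀ s r → s + 2 + r + (2 * r + 2) ≡ 3 * r + 3 + suc s
      eq = solve-∀
      eq′ : ∀ R s → suc (suc R + s) ≡ R + 0 + (s + 2)
      eq′ = solve-∀
    hub (suc j) j<K = advance (suc R) j (≤-trans R≤2R 2R≤3R) R~ (hub j (<⇒≤ j<K)) bound ≤-refl down-arm branch-arm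
        (inj₂ (n≤1+n R)) (inj₁ bound) (inj₁ (≤-trans R≤2R (n≤1+n _)))
      where
      bound : suc R + (r + j * suc D) ≤ suc (2 * R)
      bound = from-sum (jD≤ (<⇒≤ j<K)) (room-1 {1} (s≤s z≤n)) (eq R r (j * suc D)) refl
        where
        eq : ∀ R r x → suc R + (r + x) ≡ R + x + 1 + r
        eq = solve-∀

    private
      z : ℕ
      z = suc R + s₁

      z≤2R : z ≤ 2 * R
      z≤2R = from-sum′ {0} {s₁ + 1} z≤n (≤-from-sum (2 * r + 3) s<r (eq s₁ r)) (eq′ R s₁)
        where
        eq : ∀ s r → s + 1 + r + (2 * r + 3) ≡ 3 * r + 3 + suc s
        eq = solve-∀
        eq′ : ∀ R s → suc R + s ≡ R + 0 + (s + 1)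
        eq′ = solve-∀

    -- The hub `z` becomes the centre. Its own long edge leads to `a`, where the chord is prolonged,
    -- while the other two legs go down and up from `z`; the condition on `j` ensures that the
    -- ascending one ends before `a`.
    spread-edge : ∀ M j → r ≤ j * suc D → j + M ≤ K →
      z + suc (j * suc D) + s₁ ~ z + suc (j * suc D) + s₁ + suc (M * suc D)
    spread-edge zero j _ j≤K = subst (z + suc (j * suc D) + s₁ ~_) (+-comm 1 _)
      (~-step (from-sum′ {j * suc D} {s₁ + s₁ + 3} (jD≤ (≤-trans (m≤m+n j 0) j≤K)) (≤-from-sum (r + 2) (+-mono-≤ s<r s<r) (eq s₁ r)) (eq′ R s₁ (j * suc D))))
      where
      eq : ∀ s r → s + s + 3 + (r + r) + (r + 2) ≡ 3 * r + 3 + (suc s + suc s)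
      eq = solve-∀
      eq′ : ∀ R s x → suc (suc R + s + suc x + s) ≡ R + x + (s + s + 3)
      eq′ = solve-∀
    spread-edge (suc M) j r≤ j≤K = advance a M (≤-trans z≤2R 2R≤3R) (hub j (≤-trans (m≤m+n j M) j+M≤K)) (spread-edge M j r≤ j+M≤K)
        bound z<a (down-from (≤-trans r≤R (≤-trans (n≤1+n R) (m≤m+n (suc R) s₁))) z≤2R)
        (up-leg (suc z) (~-step z<2R) (≤-trans room-z (≤-trans (m≤m+n a _) bound)) ≤-refl 2≤r)
        (inj₂ (<⇒≤ z<a)) (inj₂ (subst (λ k → suc z + k ≤ a) (sym (+-identityʳ r)) room-z)) (inj₁ (n≤1+n z))
      where
      j+M≤K : j + M ≤ K
      j+M≤K = ≤-trans (+-monoʳ-≤ j (n≤1+n M)) j≤K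
      a = z + suc (j * suc D)
      z<a : z < a
      z<a = ≤-trans (≤-reflexive (+-comm 1 z)) (+-monoʳ-≤ z (s≤s z≤n))
      room-z : suc z + r ≤ a
      room-z = ≤-trans (≤-reflexive (sym (+-suc z r))) (+-monoʳ-≤ z (s≤s r≤))
      z<2R : z < 2 * R
      z<2R = from-sum′ {0} {s₁ + 2} z≤n (≤-from-sum (2 * r + 2) s<r (eq s₁ r)) (eq′ R s₁)
        where
        eq : ∀ s r → s + 2 + r + (2 * r + 2) ≡ 3 * r + 3 + suc s
        eq = solve-∀
        eq′ : ∀ R s → suc (suc R + s) ≡ R + 0 + (s + 2)
        eq′ = solve-∀
      bound : a + (r + M * suc D) ≤ suc (2 * R)
      bound = from-sum {j * suc D + M * suc D} {s₁ + 2} (jMD≤ {j} {M} j+M≤K) (≤-from-sum (2 * r + 2) s<r (eq s₁ r)) (eq′ R s₁ (j * suc D) r (M * suc D)) refl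
        where
        eq : ∀ s r → s + 2 + r + (2 * r + 2) ≡ 3 * r + 3 + suc s
        eq = solve-∀
        eq′ : ∀ R s x r y → suc R + s + suc x + (r + y) ≡ R + (x + y) + (s + 2) + r
        eq′ = solve-∀

    biclique : Biclique G Q U
    biclique = spread (s₁ + s₁ + 2) (≤-from-sum 1 (+-mono-≤ s<r s<r) (eq₀ s₁ r))
      (λ M j p q → subst₂ _~_ (eq R s₁ (j * suc D)) (cong (_+ suc (M * suc D)) (eq R s₁ (j * suc D))) (spread-edge M j p q))
      where
      eq₀ : ∀ s r → s + s + 2 + (r + r) + 1 ≡ 2 * r + 1 + (suc s + suc s)
      eq₀ = solve-∀
      eq : ∀ R s x → suc R + s + suc x + s ≡ R + (s + s + 2) + x
      eq = solve-∀

-- Many disjoint large claws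

-- Coordinates of H as an induced subgraph of a disjoint union of subdivided claws.
record Coord {m} (H : Graph m) : Set where
  field
    comp : Fin m → Fin m
    leg  : Fin m → Fin 3
    pos  : Fin m → ℕ
    pos< : ∀ x → pos x < m
    coord-inj : ∀ {x y} → comp x ≡ comp y → pos x ≡ pos y → pos x ≡ 0 ⊎ leg x ≡ leg y → x ≡ y

  Next : Fin m → Fin m → Set
  Next x y = comp x ≡ comp y × pos y ≡ suc (pos x) × (pos x ≡ 0 ⊎ leg x ≡ leg y)

  field
    adj⇒next : ∀ {x y} → adj H x y ≡ true → Next x y ⊎ Next y x
    next⇒adj : ∀ {x y} → Next x y → adj H x y ≡ true

  shape : ∀ {x y} → x ≢ y → adj H x y ≡ false → comp x ≡ comp y →
    Shape (leg x) (pos x) (leg y) (pos y) ⊎ Shape (leg y) (pos y) (leg x) (pos x)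
  shape {x} {y} x≢y nxy c with pos x in px | pos y in py
  ... | zero | zero = ⊥-elim (x≢y (coord-inj c (trans px (sym py)) (inj₁ px)))
  ... | zero | suc zero = case trans (sym nxy) (next⇒adj (c , trans py (cong suc (sym px)) , inj₁ px)) of λ ()
  ... | zero | suc (suc _) = inj₁ (centre-leg refl (s≤s (s≤s z≤n)))
  ... | suc zero | zero = case trans (sym nxy) (trans (adj-sym H x y) (next⇒adj (sym c , trans px (cong suc (sym py)) , inj₁ py))) of λ ()
  ... | suc (suc _) | zero = inj₂ (centre-leg refl (s≤s (s≤s z≤n)))
  ... | suc i | suc j with leg x ≟ leg y
  ...   | no ℓ≢ = inj₁ (across ℓ≢ (s≤s z≤n) (s≤s z≤n))
  ...   | yes ℓ≡ with <-cmp i j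
  ...     | tri≈ _ refl _ = ⊥-elim (x≢y (coord-inj c (trans px (sym py)) (inj₂ ℓ≡)))
  ...     | tri< i<j _ _ with m≤n⇒m<n∨m≡n i<j
  ...       | inj₁ lt = inj₁ (along ℓ≡ (s≤s z≤n) (s≤s lt))
  ...       | inj₂ refl = case trans (sym nxy) (next⇒adj (c , trans py (cong suc (sym px)) , inj₂ ℓ≡)) of λ ()
  shape {x} {y} x≢y nxy c | suc i | suc j | yes ℓ≡ | tri> _ _ j<i with m≤n⇒m<n∨m≡n j<i
  ... | inj₁ lt = inj₂ (along (sym ℓ≡) (s≤s z≤n) (s≤s lt))
  ... | inj₂ refl = case trans (sym nxy) (trans (adj-sym H x y) (next⇒adj (sym c , trans px (cong suc (sym py)) , inj₂ (sym ℓ≡)))) of λ ()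

embed-claws : ∀ {m n} {H : Graph m} {G : Graph n} (C : Coord H) r → m ≤ r → (τ : Fin m → Fin 3 → ℕ → Fin n) →
  (∀ i → IsTrip G r (τ i)) → (∀ {i j} → i ≢ j → ∀ ℓ ℓ′ {k k′} → k ≤ r → k′ ≤ r → τ i ℓ k ≢ τ j ℓ′ k′) → Emb H G
embed-claws {m} {n} {H} {G} C r m≤r τ trip disj = record { fn = fn′ ; inj = inj′ ; hom = hom′ }
  where
  open Coord C
  fn′ : Fin m → Fin n
  fn′ x = τ (comp x) (leg x) (pos x)
  pos≤ : ∀ x → pos x ≤ r
  pos≤ x = ≤-trans (<⇒≤ (pos< x)) m≤r
  inj′ : Injective _≡_ _≡_ fn′
  inj′ {x} {y} p with comp x ≟ comp y
  ... | no q = ⊥-elim (disj q (leg x) (leg y) (pos≤ x) (pos≤ y) p)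
  ... | yes q with trip-inj (trip (comp x)) (pos≤ x) (pos≤ y) (trans p (cong (λ c → τ c (leg y) (pos y)) (sym q)))
  ...   | k≡ , ℓ≡ = coord-inj q k≡ ℓ≡
  hom-next : ∀ {x y} → Next x y → adj G (fn′ x) (fn′ y) ≡ true
  hom-next {x} {y} (c , p , l) = subst₂ (λ u v → adj G u v ≡ true) (source l) target
    (next (trip (comp x)) (leg y) (≤-trans (<-trans (≤-reflexive (sym p)) (pos< y)) m≤r))
    where
    source : pos x ≡ 0 ⊎ leg x ≡ leg y → τ (comp x) (leg y) (pos x) ≡ fn′ x
    source (inj₂ ℓ≡) = cong (λ ℓ → τ (comp x) ℓ (pos x)) (sym ℓ≡)
    source (inj₁ z) = trans (cong (τ (comp x) (leg y)) z)
      (trans (centre≡ (trip (comp x)) (leg y) (leg x)) (cong (τ (comp x) (leg x)) (sym z)))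
    target : τ (comp x) (leg y) (suc (pos x)) ≡ fn′ y
    target = trans (cong (τ (comp x) (leg y)) (sym p)) (cong (λ i → τ i (leg y) (pos y)) c)
  hom′ : ∀ {x y} → adj H x y ≡ true → adj G (fn′ x) (fn′ y) ≡ true
  hom′ e with adj⇒next e
  ... | inj₁ q = hom-next q
  ... | inj₂ q = ~-sym G (hom-next q)

nth : ∀ {a} {A : Set a} → A → List A → ℕ → A
nth d [] _ = d
nth d (x ∷ xs) zero = x
nth d (x ∷ xs) (suc k) = nth d xs k

module _ {a} {A : Set a} {d : A} where

  nth-++ˡ : ∀ as {bs k} → k < length as → nth d (as ++ bs) k ≡ nth d as k
  nth-++ˡ (a ∷ as) {k = zero} _ = refl
  nth-++ˡ (a ∷ as) {k = suc k} (s≤s p) = nth-++ˡ as p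

  nth-++ʳ : ∀ as {bs} k → nth d (as ++ bs) (length as + k) ≡ nth d bs k
  nth-++ʳ [] k = refl
  nth-++ʳ (a ∷ as) k = nth-++ʳ as k

  nth-∈ : ∀ xs {k} → k < length xs → nth d xs k ∈ xs
  nth-∈ (x ∷ xs) {zero} _ = here refl
  nth-∈ (x ∷ xs) {suc k} (s≤s p) = there (nth-∈ xs p)

  nth-inj : ∀ {xs i j} → Unique xs → i < length xs → j < length xs → nth d xs i ≡ nth d xs j → i ≡ j
  nth-inj {x ∷ xs} {zero} {zero} _ _ _ _ = refl
  nth-inj {x ∷ xs} {zero} {suc j} (p ∷ _) _ (s≤s q) e = ⊥-elim (All.lookup p (nth-∈ xs q) e)
  nth-inj {x ∷ xs} {suc i} {zero} (p ∷ _) (s≤s q) _ e = ⊥-elim (All.lookup p (nth-∈ xs q) (sym e))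
  nth-inj {x ∷ xs} {suc i} {suc j} (_ ∷ u) (s≤s p) (s≤s q) e = cong suc (nth-inj u p q e)

  nth-linked : ∀ {R : A → A → Set} xs {i} → Linked R xs → suc i < length xs → R (nth d xs i) (nth d xs (suc i))
  nth-linked (x ∷ y ∷ xs) {zero} (r ∷ _) _ = r
  nth-linked (x ∷ y ∷ xs) {suc i} (_ ∷ l) (s≤s p) = nth-linked (y ∷ xs) l p
  nth-linked (x ∷ []) {i} _ (s≤s ())

record Claw {n} (G : Graph n) (R : ℕ) (U : List (Fin n)) : Set where
  field
    w      : ℕ → Fin n
    line   : ∀ {i} → i < 3 * R → i ≢ 2 * R → adj G (w i) (w (suc i)) ≡ true
    branch : adj G (w R) (w (suc (2 * R))) ≡ true
    w-inj  : ∀ {i j} → i ≤ 3 * R → j ≤ 3 * R → w i ≡ w j → i ≡ j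
    w∈     : ∀ {i} → i ≤ 3 * R → w i ∈ U

module _ {n : ℕ} {G : Graph n} where

  trip⇒claw : ∀ {R U} → 0 < R → (t : Trip G R U) →
    Σ (Claw G R U) λ c → ∀ {i} → i ≤ 3 * R → Claw.w c i ∈ (Trip.centre t ∷ Trip.l₁ t ++ Trip.l₂ t ++ Trip.l₃ t)
  trip⇒claw {R} {U} pos t = record
    { w = nth c L ; line = line′ ; branch = branch′ ; w-inj = λ p q → nth-inj u (len p) (len q)
    ; w∈ = λ p → All.lookup i (nth-∈ L (len p)) } , λ p → ∈-resp-↭ (↭-sym perm) (nth-∈ L (len p))
    where
    open Trip t renaming (centre to c)
    -- This list realises the codes from 0 to 2R with the centre at R, and `l₃` follows. The
    -- transition from 2R to 2R + 1 is the one place where consecutive codes come from different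
    -- legs.
    L₁ = reverse l₁ ++ c ∷ l₂
    L = L₁ ++ l₃
    perm : c ∷ l₁ ++ l₂ ++ l₃ ↭ L
    perm = ↭-trans (↭-sym (shift c l₁ (l₂ ++ l₃))) (↭-trans (↭-++⁺ʳ (c ∷ l₂ ++ l₃) (↭-sym (↭-reverse l₁))) (↭-reflexive (sym (++-assoc (reverse l₁) (c ∷ l₂) l₃))))
    u : Unique L
    u = unique-↭ perm uniq
    i : All (_∈ U) L
    i = All-resp-↭ perm inside
    len-r : length (reverse l₁) ≡ R
    len-r = trans (length-reverse l₁) len₁
    len-L₁ : length L₁ ≡ suc (2 * R)
    len-L₁ = trans (length-++ (reverse l₁)) (trans (cong₂ (λ a b → a + suc b) len-r len₂) (eq R))
      where
      eq : ∀ R → R + suc R ≡ suc (2 * R)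
      eq = solve-∀
    len-L : length L ≡ suc (3 * R)
    len-L = trans (length-++ L₁) (trans (cong₂ _+_ len-L₁ len₃) (eq R))
      where
      eq : ∀ R → suc (2 * R) + R ≡ suc (3 * R)
      eq = solve-∀
    len : ∀ {k} → k ≤ 3 * R → k < length L
    len p = ≤-trans (s≤s p) (≤-reflexive (sym len-L))
    path-L₁ : Path G L₁
    path-L₁ = linked-join (reverse l₁) (subst (Path G) (unfold-reverse c l₁) (path-reverse G path₁)) path₂
    line′ : ∀ {k} → k < 3 * R → k ≢ 2 * R → adj G (nth c L k) (nth c L (suc k)) ≡ true
    line′ {k} k< k≢ with <-cmp k (2 * R)
    ... | tri≈ _ e _ = ⊥-elim (k≢ e)
    ... | tri< lt _ _ = subst₂ (λ a b → adj G a b ≡ true) (sym (nth-++ˡ L₁ (<-trans (n<1+n k) lt′))) (sym (nth-++ˡ L₁ lt′)) (nth-linked L₁ path-L₁ lt′)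
      where
      lt′ : suc k < length L₁
      lt′ = ≤-trans (s≤s lt) (≤-reflexive (sym len-L₁))
    ... | tri> _ _ gt with m≤n⇒∃[o]m+o≡n gt
    ...   | j , refl = subst₂ (λ a b → adj G a b ≡ true)
        (sym (trans (cong (λ a → nth c L (a + j)) (sym len-L₁)) (nth-++ʳ L₁ j)))
        (sym (trans (cong (nth c L) (trans (cong suc (cong (_+ j) (sym len-L₁))) (sym (+-suc (length L₁) j)))) (nth-++ʳ L₁ (suc j))))
        (nth-linked l₃ (linked-tail path₃) (≤-trans (≤-from-sum 0 k< (eq R j)) (≤-reflexive (sym len₃))))
      where
      eq : ∀ R j → suc (suc j) + 3 * R + 0 ≡ R + suc (suc (2 * R) + j)
      eq = solve-∀
    branch′ : adj G (nth c L R) (nth c L (suc (2 * R))) ≡ true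
    branch′ = subst₂ (λ a b → adj G a b ≡ true)
      (sym (trans (nth-++ˡ L₁ (≤-trans (s≤s (m≤m+n R _)) (≤-reflexive (sym len-L₁))))
        (trans (cong (nth c L₁) (trans (sym len-r) (sym (+-identityʳ _)))) (nth-++ʳ (reverse l₁) 0))))
      (sym (trans (cong (nth c L) (trans (sym len-L₁) (sym (+-identityʳ _)))) (nth-++ʳ L₁ 0)))
      (first l₃ path₃ (≤-trans pos (≤-reflexive (sym len₃))))
      where
      first : ∀ l → Path G (c ∷ l) → 0 < length l → adj G c (nth c l 0) ≡ true
      first (x ∷ l) (e ∷ _) _ = e

  record Claws (R N : ℕ) (U : List (Fin n)) : Set where
    field
      claw     : Fin N → Claw G R U
      disjoint : ∀ {i j} → i ≢ j → ∀ {a b} → a ≤ 3 * R → b ≤ 3 * R → Claw.w (claw i) a ≢ Claw.w (claw j) b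

  claw-⊆ : ∀ {R U U′} → (∀ {x} → x ∈ U → x ∈ U′) → Claw G R U → Claw G R U′
  claw-⊆ sub c = record { Claw c hiding (w∈) ; w∈ = λ p → sub (Claw.w∈ c p) }

  find-claws : ∀ R → 0 < R → ∀ N U → Unique U →
    Claws R N U ⊎ ∃₂ λ Z U′ → U ↭ Z ++ U′ × length Z ≤ N * suc (3 * R) × ¬ Trip G R U′
  find-claws R pos zero U _ = inj₁ (record { claw = λ () ; disjoint = λ { {()} } })
  find-claws R pos (suc N) U uU with trip? G R U
  ... | no ¬t = inj₂ ([] , U , ↭-refl , z≤n , ¬t)
  ... | yes t with extract (Trip.uniq t) (Trip.inside t) | trip⇒claw pos t
  ...   | U₁ , perm | c , c∈ with find-claws R pos N U₁ (proj₁ (proj₂ (unique-++⁻ (Trip.centre t ∷ Trip.l₁ t ++ Trip.l₂ t ++ Trip.l₃ t) (unique-↭ perm uU))))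
  ...     | inj₂ (Z , U₂ , perm₂ , lenZ , ¬t) =
    inj₂ ((Trip.centre t ∷ Trip.l₁ t ++ Trip.l₂ t ++ Trip.l₃ t) ++ Z , U₂ ,
      ↭-trans perm (↭-trans (↭-++⁺ˡ _ perm₂) (↭-reflexive (sym (++-assoc (Trip.centre t ∷ Trip.l₁ t ++ Trip.l₂ t ++ Trip.l₃ t) Z U₂)))) ,
      ≤-trans (≤-reflexive (trans (length-++ (Trip.centre t ∷ Trip.l₁ t ++ Trip.l₂ t ++ Trip.l₃ t)) (cong (_+ length Z) size-t))) (+-monoʳ-≤ (suc (3 * R)) lenZ) , ¬t)
    where
    size-t : length (Trip.centre t ∷ Trip.l₁ t ++ Trip.l₂ t ++ Trip.l₃ t) ≡ suc (3 * R)
    size-t = cong suc (trans (length-++ (Trip.l₁ t)) (trans (cong₂ _+_ (Trip.len₁ t) (trans (length-++ (Trip.l₂ t)) (cong₂ _+_ (Trip.len₂ t) (Trip.len₃ t)))) (cong (λ k → R + (R + k)) (sym (+-identityʳ R)))))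
  ...     | inj₁ cs = inj₁ (record { claw = claw′ ; disjoint = disj })
    where
    in-U : ∀ {x} → x ∈ U₁ → x ∈ U
    in-U x∈ = ∈-resp-↭ (↭-sym perm) (∈-++⁺ʳ (Trip.centre t ∷ Trip.l₁ t ++ Trip.l₂ t ++ Trip.l₃ t) x∈)
    claw′ : Fin (suc N) → Claw G R U
    claw′ zero = c
    claw′ (suc i) = claw-⊆ in-U (Claws.claw cs i)
    apart : ∀ i {a b} → a ≤ 3 * R → b ≤ 3 * R → Claw.w c a ≢ Claw.w (Claws.claw cs i) b
    apart i p q e = proj₂ (proj₂ (unique-++⁻ (Trip.centre t ∷ Trip.l₁ t ++ Trip.l₂ t ++ Trip.l₃ t) (unique-↭ perm uU)))
      (c∈ p , subst (_∈ U₁) (sym e) (Claw.w∈ (Claws.claw cs i) q))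
    disj : ∀ {i j} → i ≢ j → ∀ {a b} → a ≤ 3 * R → b ≤ 3 * R → Claw.w (claw′ i) a ≢ Claw.w (claw′ j) b
    disj {zero} {zero} ne = ⊥-elim (ne refl)
    disj {zero} {suc j} _ p q = apart j p q
    disj {suc i} {zero} _ p q e = apart i q p (sym e)
    disj {suc i} {suc j} ne = Claws.disjoint cs (ne ∘ cong suc)

-- Positions in `H` are below `m`; the summand 2 provides the two vertices per leg that `up-leg`
-- requires.
claw-size : ℕ → ℕ
claw-size m = suc (suc m)

-- One length for every shape of a stuck pair. The first three summands in the bracket bound `K` in
-- `Across`, where `s` is at most r and `D` at most 2r; the last is `K` in `Spread`. The factor 2r
-- bounds the step width, and 4r + 4 is the margin asked for by `Room`.
claw-length : ℕ → ℕ → ℕ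
claw-length m Q = (Q * (2 * r) + r * Q + Q + (r + Q + Q)) * (2 * r) + (4 * r + 4)
  where
  r = claw-size m

module _ {n : ℕ} {G : Graph n} {R r : ℕ} (r<R : r < R) (1<r : 1 < r) {U : List (Fin n)} (c : Claw G R U) where
  private
    open Claw c
    open Line G R r w line branch w-inj

    2R≤3R : 2 * R ≤ 3 * R
    2R≤3R = *-monoˡ-≤ R {2} {3} (s≤s (s≤s z≤n))

    R<2R : R < 2 * R
    R<2R = ≤-trans (≤-reflexive (+-comm 1 R)) (+-monoʳ-≤ R (≤-trans (≤-trans (s≤s z≤n) r<R) (m≤m+n R 0)))

    inner-leg : ∀ {R′} → suc R′ ≡ R → Leg R (suc R′ ∸ r) (suc R′) (R′ ∸_)
    inner-leg {R′} refl = down-leg R′ (~-sym G (line (≤-trans (<⇒≤ R<2R) 2R≤3R) (<⇒≢ (<⇒≤ R<2R)))) (<⇒≤ r<R) (<⇒≤ (<⇒≤ R<2R)) (inj₂ ≤-refl)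

    outer-leg : Leg R (suc R) (suc R + (r + 0)) (jump (suc R) 0 0)
    outer-leg = up-leg (suc R) (line (≤-trans R<2R 2R≤3R) (<⇒≢ R<2R))
      (s≤s (≤-trans (+-monoʳ-≤ R (<⇒≤ r<R)) (≤-reflexive (cong (R +_) (sym (+-identityʳ R)))))) ≤-refl 1<r

    third-leg : Leg R (suc (2 * R)) (suc (2 * R) + r) (suc (2 * R) +_)
    third-leg = branch-leg (suc (2 * R)) branch ≤-refl
      (s≤s (≤-trans (+-monoʳ-≤ (2 * R) (<⇒≤ r<R)) (≤-reflexive (+-comm (2 * R) R)))) (s≤s (<⇒≤ R<2R))

    pred-R : suc (pred R) ≡ R
    pred-R = suc-pred R {{>-nonZero (≤-trans (s≤s z≤n) r<R)}}

    small : Fin 3 → ℕ → Fin n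
    small = claw R (three (pred R ∸_) (jump (suc R) 0 0) (suc (2 * R) +_)) id

    a₁₂ : Apart (suc (pred R) ∸ r) (suc (pred R)) (suc R) (suc R + (r + 0))
    a₁₂ = inj₁ (≤-trans (≤-reflexive pred-R) (n≤1+n R))
    a₁₃ : Apart (suc (pred R) ∸ r) (suc (pred R)) (suc (2 * R)) (suc (2 * R) + r)
    a₁₃ = inj₁ (≤-trans (≤-reflexive pred-R) (≤-trans (<⇒≤ R<2R) (n≤1+n _)))
    a₂₃ : Apart (suc R) (suc R + (r + 0)) (suc (2 * R)) (suc (2 * R) + r)
    a₂₃ = inj₁ (s≤s (≤-trans (+-monoʳ-≤ R (≤-trans (≤-reflexive (+-identityʳ r)) (<⇒≤ r<R))) (≤-reflexive (cong (R +_) (sym (+-identityʳ R))))))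

  small-claw : Σ (Fin 3 → ℕ → Fin n) λ t → IsTrip G r t × (∀ ℓ {k} → k ≤ r → ∃ λ i → i ≤ 3 * R × t ℓ k ≡ w i)
  small-claw = small ,
    claw-isTrip (<⇒≤ 1<r) (<⇒≤ (≤-trans R<2R 2R≤3R)) (inner-leg pred-R) outer-leg third-leg a₁₂ a₁₃ a₂₃ id (λ _ _ → id) ,
    claw-inside (<⇒≤ 1<r) (<⇒≤ (≤-trans R<2R 2R≤3R)) (inner-leg pred-R) outer-leg third-leg a₁₂ a₁₃ a₂₃ id (λ _ _ → id)

module ManyClaws {m n : ℕ} {H : Graph m} {G : Graph n} (C : Coord H) (Q : ℕ) {U : List (Fin n)}
  (cs : Claws {G = G} (claw-length m Q) (Q + Q + m) U) where

  open Coord C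
  open Claws cs

  private
    r R : ℕ
    r = claw-size m
    R = claw-length m Q

    1<r : 1 < r
    1<r = s≤s (s≤s z≤n)

    m≤r : m ≤ r
    m≤r = ≤-trans (n≤1+n m) (n≤1+n _)

    r<R : r < R
    r<R = ≤-trans (≤-trans (≤-reflexive (+-comm 1 r)) (+-mono-≤ (m≤m+n r _) (s≤s (z≤n {3})))) (m≤n+m (4 * r + 4) _)

    small : ∀ i → Σ (Fin 3 → ℕ → Fin n) λ t → IsTrip G r t × (∀ ℓ {k} → k ≤ r → ∃ λ j → j ≤ 3 * R × t ℓ k ≡ Claw.w (claw i) j)
    small i = small-claw r<R 1<r (claw i)

    Inside : Fin (Q + Q + m) → (Fin 3 → ℕ → Fin n) → Set
    Inside i t = ∀ ℓ {k} → k ≤ r → ∃ λ j → j ≤ 3 * R × t ℓ k ≡ Claw.w (claw i) j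

    embedding : (ι : Fin m → Fin (Q + Q + m)) → (∀ {i j} → ι i ≡ ι j → i ≡ j) → (τ : Fin m → Fin 3 → ℕ → Fin n) →
      (∀ i → IsTrip G r (τ i)) → (∀ i → Inside (ι i) (τ i)) → Emb H G
    embedding ι ι-inj τ trip ins = embed-claws C r m≤r τ trip λ {i} {j} i≢j ℓ ℓ′ p q e →
      let (a , a≤ , e₁) = ins i ℓ p
          (b , b≤ , e₂) = ins j ℓ′ q
      in disjoint (i≢j ∘ ι-inj) a≤ b≤ (trans (sym e₁) (trans e e₂))

    spare : Fin m → Fin (Q + Q + m)
    spare = (Q + Q) ↑ʳ_

  spare-embedding : Emb H G
  spare-embedding = embedding spare (↑ʳ-injective (Q + Q) _ _) (proj₁ ∘ small ∘ spare) (λ i → proj₁ (proj₂ (small (spare i)))) (λ i → proj₂ (proj₂ (small (spare i))))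

  module _ {x y : Fin m} (stuck : ∀ (e : Emb H G) → adj G (fn e x) (fn e y) ≡ true) where

    private
      pos≤ : ∀ z → pos z ≤ r
      pos≤ z = ≤-trans (<⇒≤ (pos< z)) m≤r

    -- The component of `x` may be put into any of the first Q claws, independently the component of
    -- `y` into any of the next Q, and all others into spare claws. Each of the Q times Q choices
    -- forces one edge.
    different-components : comp x ≢ comp y → Biclique G Q U
    different-components x≢y = biclique-tabulate G (λ α → vertex-of x (first α)) (λ β → vertex-of y (second β))
      (λ {α} {β} → apart x (first-inj {α} {β})) (λ {α} {β} → apart y (second-inj {α} {β})) (λ α → in-U x (first α)) (λ β → in-U y (second β)) edge
      where
      first second : Fin Q → Fin (Q + Q + m)
      first α = (α ↑ˡ Q) ↑ˡ m
      second β = (Q ↑ʳ β) ↑ˡ m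
      first-inj : ∀ {α β} → first α ≡ first β → α ≡ β
      first-inj e = ↑ˡ-injective Q _ _ (↑ˡ-injective m _ _ e)
      second-inj : ∀ {α β} → second α ≡ second β → α ≡ β
      second-inj e = ↑ʳ-injective Q _ _ (↑ˡ-injective m _ _ e)
      vertex-of : Fin m → Fin (Q + Q + m) → Fin n
      vertex-of z i = proj₁ (small i) (leg z) (pos z)
      in-claw : ∀ z i → ∃ λ j → j ≤ 3 * R × vertex-of z i ≡ Claw.w (claw i) j
      in-claw z i = proj₂ (proj₂ (small i)) (leg z) (pos≤ z)
      in-U : ∀ z i → vertex-of z i ∈ U
      in-U z i = let (j , j≤ , e) = in-claw z i in subst (_∈ U) (sym e) (Claw.w∈ (claw i) j≤)
      apart : ∀ z {ι : Fin Q → Fin (Q + Q + m)} {α β} → (ι α ≡ ι β → α ≡ β) → vertex-of z (ι α) ≡ vertex-of z (ι β) → α ≡ β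
      apart z {ι} {α} {β} ι-inj e with ι α ≟ ι β
      ... | yes p = ι-inj p
      ... | no p = let (j , j≤ , e₁) = in-claw z (ι α) ; (k , k≤ , e₂) = in-claw z (ι β)
                   in ⊥-elim (disjoint p j≤ k≤ (trans (sym e₁) (trans e e₂)))
      edge : ∀ α β → adj G (vertex-of x (first α)) (vertex-of y (second β)) ≡ true
      edge α β = subst₂ (λ i j → adj G (vertex-of x i) (vertex-of y j) ≡ true) ι-x ι-y
        (stuck (embedding ι ι-inj (proj₁ ∘ small ∘ ι) (λ i → proj₁ (proj₂ (small (ι i)))) (λ i → proj₂ (proj₂ (small (ι i))))))
        where
        ι : Fin m → Fin (Q + Q + m)
        ι i with i ≟ comp x | i ≟ comp y
        ... | yes _ | _ = first α
        ... | no _ | yes _ = second β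
        ... | no _ | no _ = spare i
        ι-x : ι (comp x) ≡ first α
        ι-x with comp x ≟ comp x
        ... | yes _ = refl
        ... | no p = ⊥-elim (p refl)
        ι-y : ι (comp y) ≡ second β
        ι-y with comp y ≟ comp x | comp y ≟ comp y
        ... | yes p | _ = ⊥-elim (x≢y (sym p))
        ... | no _ | yes _ = refl
        ... | no _ | no p = ⊥-elim (p refl)
        clash : ∀ {A B} {i : Fin A} {j : Fin B} → i ↑ˡ B ≢ A ↑ʳ j
        clash {A} {B} {i} {j} e = case trans (sym (splitAt-↑ˡ A i B)) (trans (cong (splitAt A) e) (splitAt-↑ʳ A B j)) of λ ()
        ι-inj : ∀ {i j} → ι i ≡ ι j → i ≡ j
        ι-inj {i} {j} e with i ≟ comp x | i ≟ comp y | j ≟ comp x | j ≟ comp y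
        ... | yes p | _ | yes q | _ = trans p (sym q)
        ... | no _ | yes p | no _ | yes q = trans p (sym q)
        ... | no _ | no _ | no _ | no _ = ↑ʳ-injective (Q + Q) _ _ e
        ... | yes _ | _ | no _ | yes _ = ⊥-elim (clash (↑ˡ-injective m _ _ e))
        ... | yes _ | _ | no _ | no _ = ⊥-elim (clash e)
        ... | no _ | yes _ | yes _ | _ = ⊥-elim (clash (↑ˡ-injective m _ _ (sym e)))
        ... | no _ | yes _ | no _ | no _ = ⊥-elim (clash e)
        ... | no _ | no _ | yes _ | _ = ⊥-elim (clash (sym e))
        ... | no _ | no _ | no _ | yes _ = ⊥-elim (clash (sym e))

    -- Only the component of `x` and `y` is moved: it may use any small claw inside its spare large
    -- claw while the other components stay put. This supplies the hypothesis `Φ` of `Forced`.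
    forced : comp x ≡ comp y → ∀ t → IsTrip G r t → Inside (spare (comp x)) t →
      adj G (t (leg x) (pos x)) (t (leg y) (pos y)) ≡ true
    forced x≡y t trip ins = subst₂ (λ s s′ → adj G (s (leg x) (pos x)) (s′ (leg y) (pos y)) ≡ true) (τ-x refl) (τ-x (sym x≡y))
      (stuck (embedding spare (↑ʳ-injective (Q + Q) _ _) τ τ-trip τ-in))
      where
      τ : Fin m → Fin 3 → ℕ → Fin n
      τ i with i ≟ comp x
      ... | yes _ = t
      ... | no _ = proj₁ (small (spare i))
      τ-x : ∀ {i} → i ≡ comp x → τ i ≡ t
      τ-x {i} e with i ≟ comp x
      ... | yes _ = refl
      ... | no p = ⊥-elim (p e)
      τ-trip : ∀ i → IsTrip G r (τ i)
      τ-trip i with i ≟ comp x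
      ... | yes _ = trip
      ... | no _ = proj₁ (proj₂ (small (spare i)))
      τ-in : ∀ i → Inside (spare i) (τ i)
      τ-in i with i ≟ comp x
      ... | yes refl = ins
      ... | no _ = proj₂ (proj₂ (small (spare i)))

  private
    room-across : ∀ {s t} → suc s ≤ r → t ≤ r → (Q * (suc s + t) + suc s * Q + Q) * (suc s + t) + (4 * r + 4) ≤ R
    room-across {s} {t} p q = +-monoˡ-≤ (4 * r + 4)
      (*-mono-≤ (≤-trans (+-monoˡ-≤ Q (+-mono-≤ (*-monoʳ-≤ Q D≤) (*-monoˡ-≤ Q p))) (m≤m+n _ _)) D≤)
      where
      D≤ : suc s + t ≤ 2 * r
      D≤ = ≤-trans (+-mono-≤ p q) (≤-reflexive (cong (r +_) (sym (+-identityʳ r))))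

    room-spread : ∀ {D} → suc D ≤ r → (r + Q + Q) * suc D + (4 * r + 4) ≤ R
    room-spread p = +-monoˡ-≤ (4 * r + 4) (*-mono-≤ (m≤n+m (r + Q + Q) (Q * (2 * r) + r * Q + Q)) (≤-trans p (m≤m+n r (r + 0))))

    from-shape : ∀ (c : Claw G R U) {ℓ s ℓ′ s′} → s ≤ r → s′ ≤ r → Shape ℓ s ℓ′ s′ →
      (∀ t → IsTrip G r t → (∀ ℓ {k} → k ≤ r → ∃ λ j → j ≤ 3 * R × t ℓ k ≡ Claw.w c j) → adj G (t ℓ s) (t ℓ′ s′) ≡ true) →
      Biclique G Q U
    from-shape c {ℓ} {s} {ℓ′} {s′} s≤ s′≤ (centre-leg refl p) Φ with m≤n⇒∃[o]m+o≡n p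
    ... | D , refl = CentreLeg.biclique ℓ ℓ′ D Q s′≤ Φ (room-spread (≤-trans (n≤1+n _) s′≤))
      where
      open Claw c
      open Forced G R r w line branch w-inj 1<r U w∈
    from-shape c {ℓ} {suc s} {ℓ′} {suc t} s≤ s′≤ (across ℓ≢ _ _) Φ =
      Across.biclique ℓ ℓ′ ℓ≢ s t Q s≤ s′≤ Φ (room-across s≤ (<⇒≤ s′≤))
      where
      open Claw c
      open Forced G R r w line branch w-inj 1<r U w∈
    from-shape c {ℓ} {suc s} {ℓ′} {s′} s≤ s′≤ (along refl _ p) Φ with m≤n⇒∃[o]m+o≡n p
    ... | D , refl = Along.biclique ℓ s D Q (≤-trans (≤-reflexive (eq s D)) s′≤)
        (λ t tr ins → subst (λ k → adj G (t ℓ (suc s)) (t ℓ k) ≡ true) (sym (eq s D)) (Φ t tr ins))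
        (room-spread (≤-trans (≤-trans (s≤s (m≤n+m D s)) (≤-trans (n≤1+n _) (n≤1+n _))) s′≤))
      where
      open Claw c
      open Forced G R r w line branch w-inj 1<r U w∈
      eq : ∀ s D → suc s + suc (suc D) ≡ 2 + suc s + D
      eq = solve-∀

  stuck⇒biclique : ∀ {x y} → Stuck {H = H} {G} x y → Biclique G Q U
  stuck⇒biclique {x} {y} (x≢y , nxy , stuck) with comp x ≟ comp y
  ... | no c≢ = different-components stuck c≢
  ... | yes c≡ with shape x≢y nxy c≡
  ...   | inj₁ sh = from-shape (claw (spare (comp x))) (pos≤′ x) (pos≤′ y) sh (forced stuck c≡)
    where
    pos≤′ : ∀ z → pos z ≤ r
    pos≤′ z = ≤-trans (<⇒≤ (pos< z)) m≤r
  ...   | inj₂ sh = from-shape (claw (spare (comp x))) (pos≤′ y) (pos≤′ x) sh (λ t tr ins → ~-sym G (forced stuck c≡ t tr ins))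
    where
    pos≤′ : ∀ z → pos z ≤ r
    pos≤′ z = ≤-trans (<⇒≤ (pos< z)) m≤r

  ¬SI⇒biclique : ¬ SI G H → Biclique G Q U
  ¬SI⇒biclique ¬si = let (_ , _ , s) = stuck-pair ¬si spare-embedding in stuck⇒biclique s

-- Large bicliques

unique-⊆-length : ∀ {a} {A : Set a} {xs ys : List A} → Unique xs → All (_∈ ys) xs → length xs ≤ length ys
unique-⊆-length {xs = xs} u al with extract u al
... | _ , perm = ≤-trans (m≤m+n (length xs) _) (≤-reflexive (sym (trans (↭-length perm) (length-++ xs))))

odd : ℕ → Bool
odd zero = false
odd (suc k) = not (odd k)

odd-+-suc : ∀ k → odd (k + suc k) ≡ true
odd-+-suc zero = refl
odd-+-suc (suc k) rewrite +-suc k (suc k) = trans (Boolₚ.not-involutive _) (odd-+-suc k)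

shape-pos : ∀ {ℓ s ℓ′ s′} → Shape ℓ s ℓ′ s′ → 1 ≤ s′
shape-pos (centre-leg _ p) = ≤-trans (s≤s z≤n) p
shape-pos (along _ _ p) = ≤-trans (s≤s z≤n) p
shape-pos (across _ _ p) = p

shape-not-outer : ∀ {ℓ s ℓ′ s′} → Shape ℓ s ℓ′ s′ → ℓ ≡ ℓ′ → s′ ≤ s → ⊥
shape-not-outer (centre-leg refl p) _ q = <⇒≱ (≤-trans (s≤s z≤n) p) q
shape-not-outer (along _ _ p) _ q = <⇒≱ (≤-trans (n≤1+n _) p) q
shape-not-outer (across ne _ _) e _ = ne e

module Reservoir {m n : ℕ} {H : Graph m} {G : Graph n} (bip : Bipartite G) (C : Coord H) (¬si : ¬ SI G H)
  (A B : List (Fin n)) (complete : ∀ {a b} → a ∈ A → b ∈ B → adj G a b ≡ true)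
  (uA : Unique A) (uB : Unique B) (lenA : m + (m + 3) ≤ length A) (lenB : m + (m + 3) ≤ length B) where

  open Coord C

  private
    V = Fin n

    abstract
      _∈ₗ?_ : (x : V) (xs : List V) → Dec (x ∈ xs)
      _∈ₗ?_ = MemDec._∈?_ _≟_

  _∖_ : List V → List V → List V
  xs ∖ F = filter (λ x → ¬? (x ∈ₗ? F)) xs

  ∖-∈ : ∀ {x} xs F → x ∈ xs ∖ F → x ∈ xs × x ∉ F
  ∖-∈ xs F = ∈-filter⁻ (λ x → ¬? (x ∈ₗ? F)) {xs = xs}

  ∖-unique : ∀ {xs} F → Unique xs → Unique (xs ∖ F)
  ∖-unique F = Uniqueₚ.filter⁺ (λ x → ¬? (x ∈ₗ? F))

  ∖-length : ∀ {xs} F {k} → Unique xs → k + length F ≤ length xs → k ≤ length (xs ∖ F)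
  ∖-length {xs} F {k} u p = +-cancelʳ-≤ (length F) k _ (≤-trans p (≤-trans
    (≤-reflexive (trans (↭-length (filter-split (_∈ₗ? F) xs)) (trans (length-++ (filter (_∈ₗ? F) xs)) (+-comm (length (filter (_∈ₗ? F) xs)) _))))
    (+-monoʳ-≤ (length (xs ∖ F)) (unique-⊆-length (Uniqueₚ.filter⁺ (_∈ₗ? F) u) (All.tabulate λ x∈ → proj₂ (∈-filter⁻ (_∈ₗ? F) {xs = xs} x∈))))))

  AB-disjoint : ∀ {x} → x ∈ A → x ∈ B → ⊥
  AB-disjoint p q = irrefl′ G (complete p q)

  private
    module Places (As Bs : List V) (⊆A : ∀ {x} → x ∈ As → x ∈ A) (⊆B : ∀ {x} → x ∈ Bs → x ∈ B)
      (uAs : Unique As) (uBs : Unique Bs) (lenAs : m ≤ length As) (lenBs : m ≤ length Bs) (d : V) where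

      aₚ bₚ : Fin m → V
      aₚ i = nth d As (toℕ i)
      bₚ i = nth d Bs (toℕ i)

      aₚ∈ : ∀ i → aₚ i ∈ As
      aₚ∈ i = nth-∈ As (<-≤-trans (toℕ<n i) lenAs)
      bₚ∈ : ∀ i → bₚ i ∈ Bs
      bₚ∈ i = nth-∈ Bs (<-≤-trans (toℕ<n i) lenBs)

      aₚ-inj : ∀ {i j} → aₚ i ≡ aₚ j → i ≡ j
      aₚ-inj {i} {j} e = toℕ-injective (nth-inj uAs (<-≤-trans (toℕ<n i) lenAs) (<-≤-trans (toℕ<n j) lenAs) e)
      bₚ-inj : ∀ {i j} → bₚ i ≡ bₚ j → i ≡ j
      bₚ-inj {i} {j} e = toℕ-injective (nth-inj uBs (<-≤-trans (toℕ<n i) lenBs) (<-≤-trans (toℕ<n j) lenBs) e)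

    module Inside (side : Fin m → Bool) (alternate : ∀ {u v} → Next u v → side v ≡ not (side u)) (d : V) where
      open Places A B id id uA uB (≤-trans (m≤m+n m _) lenA) (≤-trans (m≤m+n m _) lenB) d

      f : Fin m → V
      f u = if side u then aₚ u else bₚ u

      f-inj : Injective _≡_ _≡_ f
      f-inj {u} {v} e with side u | side v
      ... | true | true = aₚ-inj e
      ... | false | false = bₚ-inj e
      ... | true | false = ⊥-elim (AB-disjoint (aₚ∈ u) (subst (_∈ B) (sym e) (bₚ∈ v)))
      ... | false | true = ⊥-elim (AB-disjoint (aₚ∈ v) (subst (_∈ B) e (bₚ∈ u)))

      f-next : ∀ {u v} → Next u v → adj G (f u) (f v) ≡ true
      f-next {u} {v} p with side u | side v | alternate p
      ... | true | .false | refl = complete (aₚ∈ u) (bₚ∈ v)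
      ... | false | .true | refl = ~-sym G (complete (aₚ∈ v) (bₚ∈ u))

      embedding : Emb H G
      embedding = record { fn = f ; inj = f-inj ; hom = λ e → [ f-next , (λ p → ~-sym G (f-next p)) ]′ (adj⇒next e) }

      same-side : ∀ {u v} → side u ≡ side v → adj G (f u) (f v) ≡ false
      same-side {u} {v} e with side u | side v
      same-side {u} {v} refl | true | .true = non-adjacent G bip (same-colour G bip (complete (aₚ∈ u) (bₚ∈ u)) (~-sym G (complete (aₚ∈ v) (bₚ∈ u))))
      same-side {u} {v} refl | false | .false = non-adjacent G bip (same-colour G bip (~-sym G (complete (aₚ∈ u) (bₚ∈ u))) (complete (aₚ∈ u) (bₚ∈ v)))

    default : V
    default = head A (≤-trans (≤-trans (s≤s z≤n) (≤-trans (m≤n+m 3 m) (m≤n+m (m + 3) m))) lenA)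
      where
      head : ∀ xs → 0 < length xs → V
      head (x ∷ _) _ = x

    odd-next : ∀ {u v} → Next u v → odd (pos v) ≡ not (odd (pos u))
    odd-next (_ , p , _) = cong odd p

    pair : ∃₂ (Stuck {H = H} {G})
    pair = stuck-pair ¬si (Inside.embedding (odd ∘ pos) odd-next default)

    -- The parity of `pos` distributes `H` over the two sides, and each component may exchange its
    -- sides. If necessary this is done for the component of `y`; then `x` and `y` are on the same
    -- side, whose vertices are non-adjacent because `G` is bipartite.
    different-components : ∀ {x y} → Stuck {H = H} {G} x y → comp x ≢ comp y → ⊥
    different-components {x} {y} (_ , _ , stuck) c≢ =
      case trans (sym (stuck (Inside.embedding side alternate default))) (Inside.same-side side alternate default {x} {y} equal) of λ ()
      where
      _xor_ : Bool → Bool → Bool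
      true xor b = not b
      false xor b = b
      not-xor : ∀ a b → not a xor b ≡ not (a xor b)
      not-xor true b = sym (Boolₚ.not-involutive b)
      not-xor false b = refl
      flip : Fin m → Bool
      flip c = ⌊ c ≟ comp y ⌋ ∧ (odd (pos x) xor odd (pos y))
      side : Fin m → Bool
      side u = odd (pos u) xor flip (comp u)
      alternate : ∀ {u v} → Next u v → side v ≡ not (side u)
      alternate {u} {v} (c , p , l) = trans (cong₂ _xor_ (odd-next {u} {v} (c , p , l)) (cong flip (sym c))) (not-xor (odd (pos u)) _)
      equal : side x ≡ side y
      equal with comp x ≟ comp y | comp y ≟ comp y
      ... | yes p | _ = ⊥-elim (c≢ p)
      ... | no _ | no p = ⊥-elim (p refl)
      ... | no _ | yes _ = lemma (odd (pos x)) (odd (pos y))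
        where
        lemma : ∀ a b → a xor false ≡ b xor (a xor b)
        lemma true true = refl
        lemma true false = refl
        lemma false true = refl
        lemma false false = refl

  -- x goes to the start o of a path outside the reservoirs, its leg continues along that path, its inner
  -- neighbour goes to a and y to the non-neighbour a* of o (or to the side of the biclique that o cannot see).
  module Outside {o : V} (O′ : List V) (a a* : V) (pathO : Path G (o ∷ O′)) (uO : Unique (o ∷ O′)) (lenO : length (o ∷ O′) ≡ m)
    (a∈ : a ∈ A) (a*∈ : a* ∈ A) (a∉ : a ∉ o ∷ O′) (a*∉ : a* ∉ o ∷ O′) (a≢ : a ≢ a*) (oa : adj G a o ≡ true) (oa* : adj G o a* ≡ false)
    {x y : Fin m} (1≤x : 1 ≤ pos x) (not-outer : ¬ (comp y ≡ comp x × leg y ≡ leg x × pos x ≤ pos y)) (nxy : adj H x y ≡ false) where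

    private
      O F As Bs : List V
      O = o ∷ O′
      F = O ++ a ∷ a* ∷ []
      As = A ∖ F
      Bs = B ∖ F

      lenF : length F ≡ m + 2
      lenF = trans (length-++ O) (cong (_+ 2) lenO)

      room : ∀ {k} → m + (m + 3) ≤ k → m + length F ≤ k
      room p = ≤-trans (≤-trans (≤-reflexive (cong (m +_) lenF)) (+-monoʳ-≤ m (+-monoʳ-≤ m (s≤s (s≤s z≤n))))) p

      open Places As Bs (proj₁ ∘ ∖-∈ A F) (proj₁ ∘ ∖-∈ B F) (∖-unique F uA) (∖-unique F uB) (∖-length F uA (room lenA)) (∖-length F uB (room lenB)) o

      data Slot : Set where
        out : ∀ k → k < m → Slot
        inn star : Slot
        left right : Fin m → Slot

      place : Slot → V
      place (out k _) = nth o O k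
      place inn = a
      place star = a*
      place (left i) = aₚ i
      place (right i) = bₚ i

      out∈ : ∀ {k} → k < m → nth o O k ∈ O
      out∈ p = nth-∈ O (≤-trans p (≤-reflexive (sym lenO)))

      in-F : ∀ {v} → v ∈ O → v ∈ F
      in-F = ∈-++⁺ˡ

      left∉F : ∀ i → aₚ i ∉ F
      left∉F i = proj₂ (∖-∈ A F (aₚ∈ i))
      right∉F : ∀ i → bₚ i ∉ F
      right∉F i = proj₂ (∖-∈ B F (bₚ∈ i))
      a∈F : a ∈ F
      a∈F = ∈-++⁺ʳ O (here refl)
      a*∈F : a* ∈ F
      a*∈F = ∈-++⁺ʳ O (there (here refl))

      left≢right : ∀ {i j} → aₚ i ≢ bₚ j
      left≢right {i} {j} e = AB-disjoint (proj₁ (∖-∈ A F (aₚ∈ i))) (subst (_∈ B) (sym e) (proj₁ (∖-∈ B F (bₚ∈ j))))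

      data SameSlot : Slot → Slot → Set where
        outs : ∀ {k p q} → SameSlot (out k p) (out k q)
        other : ∀ {s} → SameSlot s s

      place-inj : ∀ s t → place s ≡ place t → SameSlot s t
      place-inj (out k p) (out j q) e with nth-inj uO (≤-trans p (≤-reflexive (sym lenO))) (≤-trans q (≤-reflexive (sym lenO))) e
      ... | refl = outs
      place-inj (out k p) inn e = ⊥-elim (a∉ (subst (_∈ O) e (out∈ p)))
      place-inj (out k p) star e = ⊥-elim (a*∉ (subst (_∈ O) e (out∈ p)))
      place-inj (out k p) (left i) e = ⊥-elim (left∉F i (in-F (subst (_∈ O) e (out∈ p))))
      place-inj (out k p) (right i) e = ⊥-elim (right∉F i (in-F (subst (_∈ O) e (out∈ p))))
      place-inj inn (out k p) e = ⊥-elim (a∉ (subst (_∈ O) (sym e) (out∈ p)))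
      place-inj inn inn e = other
      place-inj inn star e = ⊥-elim (a≢ e)
      place-inj inn (left i) e = ⊥-elim (left∉F i (subst (_∈ F) e a∈F))
      place-inj inn (right i) e = ⊥-elim (right∉F i (subst (_∈ F) e a∈F))
      place-inj star (out k p) e = ⊥-elim (a*∉ (subst (_∈ O) (sym e) (out∈ p)))
      place-inj star inn e = ⊥-elim (a≢ (sym e))
      place-inj star star e = other
      place-inj star (left i) e = ⊥-elim (left∉F i (subst (_∈ F) e a*∈F))
      place-inj star (right i) e = ⊥-elim (right∉F i (subst (_∈ F) e a*∈F))
      place-inj (left i) (out k p) e = ⊥-elim (left∉F i (in-F (subst (_∈ O) (sym e) (out∈ p))))
      place-inj (left i) inn e = ⊥-elim (left∉F i (subst (_∈ F) (sym e) a∈F))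
      place-inj (left i) star e = ⊥-elim (left∉F i (subst (_∈ F) (sym e) a*∈F))
      place-inj (left i) (left j) e with aₚ-inj {i} {j} e
      ... | refl = other
      place-inj (left i) (right j) e = ⊥-elim (left≢right {i} {j} e)
      place-inj (right i) (out k p) e = ⊥-elim (right∉F i (in-F (subst (_∈ O) (sym e) (out∈ p))))
      place-inj (right i) inn e = ⊥-elim (right∉F i (subst (_∈ F) (sym e) a∈F))
      place-inj (right i) star e = ⊥-elim (right∉F i (subst (_∈ F) (sym e) a*∈F))
      place-inj (right i) (left j) e = ⊥-elim (left≢right {j} {i} (sym e))
      place-inj (right i) (right j) e with bₚ-inj {i} {j} e
      ... | refl = other

      Outer : Fin m → Set
      Outer u = comp u ≡ comp x × leg u ≡ leg x × pos x ≤ pos u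

      abstract
        outer? : ∀ u → Dec (Outer u)
        outer? u = (comp u ≟ comp x) ×-dec (leg u ≟ leg x) ×-dec (pos x ℕₚ.≤? pos u)

        next? : ∀ u v → Dec (Next u v)
        next? u v = (comp u ≟ comp v) ×-dec (pos v ℕₚ.≟ suc (pos u)) ×-dec ((pos u ℕₚ.≟ 0) ⊎-dec (leg u ≟ leg v))

      -- The vertex `o` has the neighbour `a` in `A`, so it has the colour of `B`. Since `x` goes to
      -- `o`, the vertices whose parity differs from that of `x` belong in `A`.
      aside : Fin m → Bool
      aside u = odd (pos u + pos x)

      slot : Fin m → Slot
      slot u with outer? u | next? u x | aside u | u ≟ y
      ... | yes _ | _ | _ | _ = out (pos u ∸ pos x) (≤-<-trans (m∸n≤m (pos u) (pos x)) (pos< u))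
      ... | no _ | yes _ | _ | _ = inn
      ... | no _ | no _ | true | yes _ = star
      ... | no _ | no _ | true | no _ = left u
      ... | no _ | no _ | false | _ = right u

      Fits : Slot → Fin m → Set
      Fits (out k _) u = comp u ≡ comp x × leg u ≡ leg x × pos u ≡ pos x + k
      Fits inn u = Next u x
      Fits star u = u ≡ y
      Fits (left i) u = u ≡ i
      Fits (right i) u = u ≡ i

      fits : ∀ u → Fits (slot u) u
      fits u with outer? u | next? u x | aside u | u ≟ y
      ... | yes (c , l , p) | _ | _ | _ = c , l , sym (m+[n∸m]≡n p)
      ... | no _ | yes p | _ | _ = p
      ... | no _ | no _ | true | yes p = p
      ... | no _ | no _ | true | no _ = refl
      ... | no _ | no _ | false | _ = refl

      fits-out : ∀ {k p q u v} → Fits (out k p) u → Fits (out k q) v → u ≡ v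
      fits-out (cu , lu , pu) (cv , lv , pv) = coord-inj (trans cu (sym cv)) (trans pu (sym pv)) (inj₂ (trans lu (sym lv)))

      fits-unique : ∀ {s t u v} → SameSlot s t → Fits s u → Fits t v → u ≡ v
      fits-unique (outs {p = p} {q}) = fits-out {p = p} {q}
      fits-unique (other {out k p}) = fits-out {p = p} {p}
      fits-unique {u = u} {v} (other {inn}) (cu , pu , lu) (cv , pv , lv) =
        coord-inj (trans cu (sym cv)) pos≡ (same-leg lu lv)
        where
        pos≡ : pos u ≡ pos v
        pos≡ = suc-injective (trans (sym pu) pv)
        same-leg : pos u ≡ 0 ⊎ leg u ≡ leg x → pos v ≡ 0 ⊎ leg v ≡ leg x → pos u ≡ 0 ⊎ leg u ≡ leg v
        same-leg (inj₁ p) _ = inj₁ p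
        same-leg (inj₂ _) (inj₁ q) = inj₁ (trans pos≡ q)
        same-leg (inj₂ p) (inj₂ q) = inj₂ (trans p (sym q))
      fits-unique (other {star}) p q = trans p (sym q)
      fits-unique (other {left _}) p q = trans p (sym q)
      fits-unique (other {right _}) p q = trans p (sym q)

      f : Fin m → V
      f u = place (slot u)

      f-outer : ∀ {u} → Outer u → f u ≡ nth o O (pos u ∸ pos x)
      f-outer {u} p with outer? u
      ... | yes _ = refl
      ... | no q = ⊥-elim (q p)

      f-inner : ∀ {u} → ¬ Outer u → Next u x → f u ≡ a
      f-inner {u} q p with outer? u | next? u x
      ... | yes r | _ = ⊥-elim (q r)
      ... | no _ | yes _ = refl
      ... | no _ | no r = ⊥-elim (r p)

      f-aside : ∀ {u} → ¬ Outer u → aside u ≡ true → f u ∈ A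
      f-aside {u} q e with outer? u | next? u x | aside u | u ≟ y
      ... | yes r | _ | _ | _ = ⊥-elim (q r)
      ... | no _ | yes _ | _ | _ = a∈
      ... | no _ | no _ | true | yes _ = a*∈
      ... | no _ | no _ | true | no _ = proj₁ (∖-∈ A F (aₚ∈ u))

      f-beside : ∀ {u} → ¬ Outer u → aside u ≡ false → f u ∈ B
      f-beside {u} q e with outer? u | next? u x | aside u in eq | u ≟ y
      ... | yes r | _ | _ | _ = ⊥-elim (q r)
      ... | no _ | yes (_ , p , _) | _ | _ =
        case trans (sym e) (trans (sym eq) (trans (cong (λ k → odd (pos u + k)) p) (odd-+-suc (pos u)))) of λ ()
      ... | no _ | no _ | false | _ = proj₁ (∖-∈ B F (bₚ∈ u))

      f-y : aside y ≡ true → f y ≡ a*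
      f-y e with outer? y | next? y x | aside y | y ≟ y
      ... | yes r | _ | _ | _ = ⊥-elim (not-outer r)
      ... | no _ | yes p | _ | _ = case trans (sym nxy) (trans (adj-sym H x y) (next⇒adj p)) of λ ()
      ... | no _ | no _ | true | yes _ = refl
      ... | no _ | no _ | true | no q = ⊥-elim (q refl)

      aside-next : ∀ {u v} → Next u v → aside v ≡ not (aside u)
      aside-next (_ , p , _) = cong (λ k → odd (k + pos x)) p

      f-next : ∀ {u v} → Next u v → adj G (f u) (f v) ≡ true
      f-next {u} {v} nx@(c , p , l) = go (outer? u) (outer? v)
        where
        back-leg : Outer v → pos x ≤ pos u → Outer u
        back-leg (cv , lv , _) le = trans c cv , [ (λ z → ⊥-elim (<⇒≱ 1≤x (≤-trans le (≤-reflexive z)))) , (λ q → trans q lv) ]′ l , le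
        on-leg : Outer u → Outer v
        on-leg (cu , lu , pu) = trans (sym c) cu ,
          trans (sym ([ (λ z → ⊥-elim (<⇒≱ 1≤x (≤-trans pu (≤-reflexive z)))) , id ]′ l)) lu ,
          ≤-trans pu (≤-trans (n≤1+n _) (≤-reflexive (sym p)))
        go : Dec (Outer u) → Dec (Outer v) → adj G (f u) (f v) ≡ true
        go (yes ou) (no nv) = ⊥-elim (nv (on-leg ou))
        go (yes ou@(_ , _ , pu)) (yes ov) = subst₂ (λ s t → adj G s t ≡ true) (sym (f-outer ou)) (sym (trans (f-outer ov) (cong (nth o O) k≡)))
          (nth-linked O pathO (≤-trans (s≤s (≤-reflexive (sym k≡))) (≤-trans (≤-<-trans (m∸n≤m (pos v) (pos x)) (pos< v)) (≤-reflexive (sym lenO)))))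
          where
          k≡ : pos v ∸ pos x ≡ suc (pos u ∸ pos x)
          k≡ = trans (cong (_∸ pos x) p) (+-∸-assoc 1 pu)
        go (no nu) (yes ov@(cv , lv , pv)) = subst₂ (λ s t → adj G s t ≡ true) (sym (f-inner nu inner)) (sym (trans (f-outer ov) (cong (nth o O) k≡))) oa
          where
          x≡ : pos x ≡ suc (pos u)
          x≡ = ≤-antisym (≤-trans pv (≤-reflexive p)) (≰⇒> (nu ∘ back-leg ov))
          inner : Next u x
          inner = trans c cv , x≡ , [ inj₁ , (λ q → inj₂ (trans q lv)) ]′ l
          k≡ : pos v ∸ pos x ≡ 0
          k≡ = trans (cong₂ _∸_ p x≡) (n∸n≡0 (suc (pos u)))
        go (no nu) (no nv) = by-side (aside u) refl
          where
          by-side : ∀ b → aside u ≡ b → adj G (f u) (f v) ≡ true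
          by-side true eq = complete (f-aside nu eq) (f-beside nv (trans (aside-next nx) (cong not eq)))
          by-side false eq = ~-sym G (complete (f-aside nv (trans (aside-next nx) (cong not eq))) (f-beside nu eq))

    embedding : Emb H G
    embedding = record { fn = f ; inj = λ {u} {v} e → fits-unique (place-inj (slot u) (slot v) e) (fits u) (fits v)
                       ; hom = λ e → [ f-next , (λ p → ~-sym G (f-next p)) ]′ (adj⇒next e) }

    -- If the parity of `y` puts it into `A`, it was placed at `a*`, a non-neighbour of `o`.
    -- Otherwise it lies in `B` and has the same colour as `o`.
    separated : adj G (fn embedding x) (fn embedding y) ≡ false
    separated = by-side (aside y) refl
      where
      f-x : f x ≡ o
      f-x = trans (f-outer (refl , refl , ≤-refl)) (cong (nth o O) (n∸n≡0 (pos x)))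
      by-side : ∀ b → aside y ≡ b → adj G (f x) (f y) ≡ false
      by-side true eq = subst₂ (λ s t → adj G s t ≡ false) (sym f-x) (sym (f-y eq)) oa*
      by-side false eq = subst (λ s → adj G s (f y) ≡ false) (sym f-x)
        (non-adjacent G bip (same-colour G bip (~-sym G oa) (complete a∈ (f-beside not-outer eq))))

  no-config : ∀ {o} O′ a a* → Path G (o ∷ O′) → Unique (o ∷ O′) → m ≤ length (o ∷ O′) → a ∈ A → a* ∈ A →
    a ∉ o ∷ O′ → a* ∉ o ∷ O′ → a ≢ a* → adj G a o ≡ true → adj G o a* ≡ false → ⊥
  no-config {o} O′ a a* pathO uO lenO a∈ a*∈ a∉ a*∉ a≢ oa oa* = apply pair
    where
    use : ∀ {x y} → Stuck {H = H} {G} y x → comp x ≡ comp y → Shape (leg y) (pos y) (leg x) (pos x) → ⊥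
    use {x} {y} (_ , nyx , stuck) c sh = by-m m refl
      where
      not-outer : ¬ (comp y ≡ comp x × leg y ≡ leg x × pos x ≤ pos y)
      not-outer (_ , l , p) = shape-not-outer sh l p
      -- The path is cut to exactly `m` vertices, and it must still begin with `o`; this needs `m`
      -- in the form of a successor.
      by-m : ∀ k → k ≡ m → ⊥
      by-m zero refl = case pos< x of λ ()
      by-m (suc k) refl = case trans (sym (stuck emb)) (trans (adj-sym G (fn emb y) (fn emb x)) sep) of λ ()
        where
        open Outside {o} (take k O′) a a* (linked-take (suc k) pathO) (unique-take (suc k) uO) (length-take-≤ (suc k) {o ∷ O′} lenO)
          a∈ a*∈ (a∉ ∘ ∈-take⁻ (suc k)) (a*∉ ∘ ∈-take⁻ (suc k)) a≢ oa oa* {x} {y} (shape-pos sh) not-outer (trans (adj-sym H x y) nyx)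
          renaming (embedding to emb; separated to sep)
    apply : ∃₂ (Stuck {H = H} {G}) → ⊥
    apply (x , y , s@(x≢y , nxy , stuck)) with comp x ≟ comp y
    ... | no c≢ = different-components s c≢
    ... | yes c≡ with shape x≢y nxy c≡
    ...   | inj₁ sh = use s (sym c≡) sh
    ...   | inj₂ sh = use {x} {y} (≢-sym x≢y , trans (adj-sym H y x) nxy , λ e → trans (adj-sym G (fn e y) (fn e x)) (stuck e)) c≡ sh

module Ears {m n : ℕ} {H : Graph m} {G : Graph n} (bip : Bipartite G) (C : Coord H) (¬si : ¬ SI G H)
  (A B : List (Fin n)) (complete : ∀ {a b} → a ∈ A → b ∈ B → adj G a b ≡ true)
  (uA : Unique A) (uB : Unique B) (lenA : m + (m + 3) ≤ length A) (lenB : m + (m + 3) ≤ length B)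
  (X : List (Fin n)) (XA : ∀ {x} → x ∈ X → x ∉ A) (XB : ∀ {x} → x ∈ X → x ∉ B)
  (non-neighbour : ∀ {v} → v ∈ X → ∃ λ a → a ∈ A × adj G v a ≡ false) where

  open Reservoir {G = G} bip C ¬si A B complete uA uB lenA lenB

  private
    V = Fin n

    zig : List V → List V → List V
    zig (x ∷ xs) (y ∷ ys) = x ∷ y ∷ zig xs ys
    zig _ _ = []

    zig-∈ : ∀ {v} xs ys → v ∈ zig xs ys → v ∈ xs ⊎ v ∈ ys
    zig-∈ (x ∷ xs) (y ∷ ys) (here p) = inj₁ (here p)
    zig-∈ (x ∷ xs) (y ∷ ys) (there (here p)) = inj₂ (here p)
    zig-∈ (x ∷ xs) (y ∷ ys) (there (there p)) with zig-∈ xs ys p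
    ... | inj₁ q = inj₁ (there q)
    ... | inj₂ q = inj₂ (there q)

    zig-unique : ∀ {xs ys} → Unique xs → Unique ys → (∀ {v} → v ∈ xs → v ∈ ys → ⊥) → Unique (zig xs ys)
    zig-unique {[]} _ _ _ = []
    zig-unique {x ∷ xs} {[]} _ _ _ = []
    zig-unique {x ∷ xs} {y ∷ ys} (px ∷ ux) (py ∷ uy) d =
      unique-∷⁺ x∉ (unique-∷⁺ y∉ (zig-unique ux uy λ p q → d (there p) (there q)))
      where
      y∉ : y ∉ zig xs ys
      y∉ p with zig-∈ xs ys p
      ... | inj₁ q = d (there q) (here refl)
      ... | inj₂ q = All.lookup py q refl
      x∉ : x ∉ y ∷ zig xs ys
      x∉ (here refl) = d (here refl) (here refl)
      x∉ (there p) with zig-∈ xs ys p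
      ... | inj₁ q = All.lookup px q refl
      ... | inj₂ q = d (here refl) (there q)

    zig-length : ∀ k xs ys → k ≤ length xs → k ≤ length ys → k ≤ length (zig xs ys)
    zig-length zero _ _ _ _ = z≤n
    zig-length (suc k) (x ∷ xs) (y ∷ ys) (s≤s p) (s≤s q) = s≤s (m≤n⇒m≤1+n (zig-length k xs ys p q))

    zig-path : ∀ {w} xs ys → (∀ {p} → p ∈ xs → adj G w p ≡ true) → (∀ {p q} → p ∈ xs → q ∈ ys → adj G p q ≡ true) → Path G (w ∷ zig xs ys)
    zig-path [] _ _ _ = [-]
    zig-path (x ∷ xs) [] _ _ = [-]
    zig-path (x ∷ xs) (y ∷ ys) wx c = wx (here refl) ∷ c (here refl) (here refl) ∷
      zig-path xs ys (λ p → ~-sym G (c (there p) (here refl))) (λ p q → c (there p) (there q))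

    chain-∷ : ∀ {u v qs} → Chain G u v qs → ∃ λ qs′ → qs ≡ u ∷ qs′
    chain-∷ stop = [] , refl
    chain-∷ (_ ◅ _) = _ , refl

    in-AB : V → Set
    in-AB w = w ∈ A ⊎ w ∈ B

    -- `no-config` asks for a path of at least `m` vertices. A path that re-enters the biclique at
    -- `w` can be prolonged by zigzagging between the two sides, avoiding the three reserved
    -- vertices `w`, `a` and `a*`.
    ear₀ : ∀ {v a a* z qs w} → v ∈ X → a ∈ A → adj G a v ≡ true → a* ∈ A → adj G v a* ≡ false → Chain G v z qs → Unique qs →
      All (_∈ X) qs → w ≢ a → w ≢ a* → adj G z w ≡ true → in-AB w → ⊥
    ear₀ {v} {a} {a*} {z} {qs} {w} v∈ a∈ av a*∈ va* c u al w≢a w≢a* zw w∈ with chain-∷ c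
    ... | qs′ , refl = no-config (qs′ ++ w ∷ T w∈) a a*
        (linked-join (v ∷ qs′) (chain⇒path G (chain-++ G c zw stop)) (T-path w∈))
        (unique-++⁺ u (unique-∷⁺ (w∉T w∈) (T-unique w∈)) λ { (p , here refl) → X∌ (All.lookup al p) w∈ ; (p , there q) → X∌ (All.lookup al p) (T∈ w∈ q) })
        (≤-trans (T-length w∈) (≤-trans (≤-trans (n≤1+n _) (m≤n+m _ (length (v ∷ qs′)))) (≤-reflexive (sym (length-++ (v ∷ qs′))))))
        a∈ a*∈ (a∉ a∈ w≢a (there (here refl))) (a∉ a*∈ w≢a* (there (there (here refl)))) (λ { refl → case trans (sym va*) (~-sym G av) of λ () }) av va*
      where
      F = w ∷ a ∷ a* ∷ []
      T : in-AB w → List V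
      T (inj₁ _) = zig (B ∖ F) (A ∖ F)
      T (inj₂ _) = zig (A ∖ F) (B ∖ F)
      T-split : ∀ d {t} → t ∈ T d → t ∈ A ∖ F ⊎ t ∈ B ∖ F
      T-split (inj₁ _) p = [ inj₂ , inj₁ ]′ (zig-∈ (B ∖ F) (A ∖ F) p)
      T-split (inj₂ _) p = zig-∈ (A ∖ F) (B ∖ F) p
      T∈ : ∀ d {t} → t ∈ T d → in-AB t
      T∈ d p = [ (λ q → inj₁ (proj₁ (∖-∈ A F q))) , (λ q → inj₂ (proj₁ (∖-∈ B F q))) ]′ (T-split d p)
      T∉F : ∀ d {t} → t ∈ T d → t ∉ F
      T∉F d p = [ (λ q → proj₂ (∖-∈ A F q)) , (λ q → proj₂ (∖-∈ B F q)) ]′ (T-split d p)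
      w∉T : ∀ d → w ∉ T d
      w∉T d p = T∉F d p (here refl)
      disj : ∀ {t} → t ∈ A ∖ F → t ∈ B ∖ F → ⊥
      disj p q = AB-disjoint (proj₁ (∖-∈ A F p)) (proj₁ (∖-∈ B F q))
      T-unique : ∀ d → Unique (T d)
      T-unique (inj₁ _) = zig-unique (∖-unique F uB) (∖-unique F uA) (λ p q → disj q p)
      T-unique (inj₂ _) = zig-unique (∖-unique F uA) (∖-unique F uB) disj
      mA : m ≤ length (A ∖ F)
      mA = ∖-length F uA (≤-trans (m≤n+m (m + 3) m) lenA)
      mB : m ≤ length (B ∖ F)
      mB = ∖-length F uB (≤-trans (m≤n+m (m + 3) m) lenB)
      T-length : ∀ d → m ≤ length (T d)
      T-length (inj₁ _) = zig-length m (B ∖ F) (A ∖ F) mB mA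
      T-length (inj₂ _) = zig-length m (A ∖ F) (B ∖ F) mA mB
      T-path : ∀ d → Path G (w ∷ T d)
      T-path (inj₁ w∈A) = zig-path (B ∖ F) (A ∖ F) (λ p → complete w∈A (proj₁ (∖-∈ B F p)))
        (λ p q → ~-sym G (complete (proj₁ (∖-∈ A F q)) (proj₁ (∖-∈ B F p))))
      T-path (inj₂ w∈B) = zig-path (A ∖ F) (B ∖ F) (λ p → ~-sym G (complete (proj₁ (∖-∈ A F p)) w∈B))
        (λ p q → complete (proj₁ (∖-∈ A F p)) (proj₁ (∖-∈ B F q)))
      X∌ : ∀ {t} → t ∈ X → in-AB t → ⊥
      X∌ p (inj₁ q) = XA p q
      X∌ p (inj₂ q) = XB p q
      a∉ : ∀ {a′} → a′ ∈ A → w ≢ a′ → a′ ∈ F → a′ ∉ (v ∷ qs′) ++ w ∷ T w∈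
      a∉ a′∈ ne a′F p with ∈-++⁻ (v ∷ qs′) p
      ... | inj₁ q = XA (All.lookup al q) a′∈
      ... | inj₂ (here q) = ne (sym q)
      ... | inj₂ (there q) = T∉F w∈ q a′F

  long : ∀ {v a u qs} → v ∈ X → a ∈ A → adj G a v ≡ true → Chain G v u qs → Unique qs → All (_∈ X) qs → length qs ≤ m
  long {v} {a} {qs = qs} v∈ a∈ av c u al with chain-∷ c
  ... | qs′ , refl = ≮⇒≥ λ lt → let (a* , a*∈ , va*) = non-neighbour v∈ in
    no-config qs′ a a* (chain⇒path G c) u (<⇒≤ lt) a∈ a*∈ (λ p → XA (All.lookup al p) a∈) (λ p → XA (All.lookup al p) a*∈)
      (λ { refl → case trans (sym va*) (~-sym G av) of λ () }) av va*

  -- For `ear₀` the non-neighbour of `v` must differ from `w`. A third vertex `x` of `A` settles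
  -- this: if `x` is not adjacent to `v`, it is the required vertex; if it is, then `v` alone forms
  -- an ear between `a` and `x`, and the given non-neighbour of `v` serves.
  ear : ∀ {v a z qs w} → v ∈ X → a ∈ A → adj G a v ≡ true → Chain G v z qs → Unique qs →
    All (_∈ X) qs → w ≢ a → adj G z w ≡ true → w ∈ A ⊎ w ∈ B → ⊥
  ear {v} {a} {z} {qs} {w} v∈ a∈ av c u al w≢a zw w∈ = go (A ∖ (a ∷ w ∷ [])) (λ p → ∖-∈ A (a ∷ w ∷ []) p)
      (∖-length (a ∷ w ∷ []) uA (≤-trans (≤-trans (m≤n+m 3 m) (m≤n+m (m + 3) m)) lenA))
    where
    two-neighbours : ∀ {w′} → w′ ∈ A → w′ ≢ a → adj G v w′ ≡ true → ⊥
    two-neighbours {w′} w′∈ ne vw′ = let (a* , a*∈ , va*) = non-neighbour v∈ in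
      ear₀ v∈ a∈ av a*∈ va* stop ([] ∷ []) (v∈ ∷ []) ne (λ { refl → case trans (sym va*) vw′ of λ () }) vw′ (inj₁ w′∈)
    go : ∀ l → (∀ {x} → x ∈ l → x ∈ A × x ∉ a ∷ w ∷ []) → 1 ≤ length l → ⊥
    go (x ∷ _) sub _ with adj G v x in eq
    ... | true = two-neighbours (proj₁ (sub (here refl))) (λ { refl → proj₂ (sub (here refl)) (here refl) }) eq
    ... | false = ear₀ v∈ a∈ av (proj₁ (sub (here refl))) eq c u al w≢a (λ { refl → proj₂ (sub (here refl)) (there (here refl)) }) zw w∈

-- The value `t + p * t` of `good-blocks`. Three classes suffice across a cut: spine vertices in
-- `A`, which see the undrawn part of `B`; those in `B`, which see that of `A`; and the pieces,
-- which see nothing. Each block is a spine vertex with a piece of depth `m`.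
hub-size : ℕ → ℕ
hub-size m = 3 + (2 + (m + m)) * 3

module Hub {m n : ℕ} {H : Graph m} {G : Graph n} (bip : Bipartite G) (C : Coord H) (¬si : ¬ SI G H)
  (U : List (Fin n)) (uU : Unique U) (bic : Biclique G (m + (m + 3)) U) where

  private
    V = Fin n
    open Biclique bic using (as; bs)

    allAdj? : ∀ l v → Dec (All (λ b → adj G v b ≡ true) l)
    allAdj? l v = All.all? (λ b → adj G v b Boolₚ.≟ true) l

    non-adj : ∀ l {v} → ¬ All (λ b → adj G v b ≡ true) l → ∃ λ b → b ∈ l × adj G v b ≡ false
    non-adj l {v} ¬all = let (b , b∈ , e) = find (Allₚ.¬All⇒Any¬ (λ b → adj G v b Boolₚ.≟ true) l ¬all)
                         in b , b∈ , Boolₚ.¬-not e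

    -- A closure of the given biclique: `B` consists of all common neighbours of `as`, and `A` of
    -- all common neighbours of `B`. The result is a maximal biclique in `U`, so every vertex
    -- outside has a non-neighbour on either side.
    A B : List V
    B = filter (allAdj? as) U
    A = filter (allAdj? B) U

    A⁻ : ∀ {x} → x ∈ A → x ∈ U × All (λ b → adj G x b ≡ true) B
    A⁻ = ∈-filter⁻ (allAdj? B)
    B⁻ : ∀ {x} → x ∈ B → x ∈ U × All (λ b → adj G x b ≡ true) as
    B⁻ = ∈-filter⁻ (allAdj? as)

    complete : ∀ {a b} → a ∈ A → b ∈ B → adj G a b ≡ true
    complete a∈ b∈ = All.lookup (proj₂ (A⁻ a∈)) b∈

    as⊆A : ∀ {a} → a ∈ as → a ∈ A
    as⊆A a∈ = ∈-filter⁺ (allAdj? B) (All.lookup (Biclique.as⊆ bic) a∈)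
      (All.tabulate λ b∈ → ~-sym G (All.lookup (proj₂ (B⁻ b∈)) a∈))
    bs⊆B : ∀ {b} → b ∈ bs → b ∈ B
    bs⊆B b∈ = ∈-filter⁺ (allAdj? as) (All.lookup (Biclique.bs⊆ bic) b∈)
      (All.tabulate λ a∈ → ~-sym G (All.lookup (All.lookup (Biclique.complete bic) a∈) b∈))

    uA : Unique A
    uA = Uniqueₚ.filter⁺ (allAdj? B) uU
    uB : Unique B
    uB = Uniqueₚ.filter⁺ (allAdj? as) uU

    lenA : m + (m + 3) ≤ length A
    lenA = ≤-trans (≤-reflexive (sym (Biclique.len-as bic))) (unique-⊆-length (Biclique.uniq-as bic) (All.tabulate as⊆A))
    lenB : m + (m + 3) ≤ length B
    lenB = ≤-trans (≤-reflexive (sym (Biclique.len-bs bic))) (unique-⊆-length (Biclique.uniq-bs bic) (All.tabulate bs⊆B))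

    ps : List V
    ps = A ++ B

    uPs : Unique ps
    uPs = unique-++⁺ uA uB (λ (p , q) → irrefl′ G (complete p q))

    ps⊆U : ∀ {x} → x ∈ ps → x ∈ U
    ps⊆U p = [ proj₁ ∘ A⁻ , proj₁ ∘ B⁻ ]′ (∈-++⁻ A p)

    X : List V
    X = proj₁ (extract uPs (All.tabulate ps⊆U))
    permX : U ↭ ps ++ X
    permX = proj₂ (extract uPs (All.tabulate ps⊆U))

  module Sides (A B X : List V) (complete : ∀ {a b} → a ∈ A → b ∈ B → adj G a b ≡ true)
    (uA : Unique A) (uB : Unique B) (lenA : m + (m + 3) ≤ length A) (lenB : m + (m + 3) ≤ length B)
    (permX : U ↭ (A ++ B) ++ X) (uX : Unique ((A ++ B) ++ X))
    (non-A : ∀ {v} → v ∈ X → ∃ λ a → a ∈ A × adj G v a ≡ false) (non-B : ∀ {v} → v ∈ X → ∃ λ b → b ∈ B × adj G v b ≡ false) where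

    private
      XA : ∀ {x} → x ∈ X → x ∉ A
      XA p q = proj₂ (proj₂ (unique-++⁻ (A ++ B) uX)) (∈-++⁺ˡ q , p)
      XB : ∀ {x} → x ∈ X → x ∉ B
      XB p q = proj₂ (proj₂ (unique-++⁻ (A ++ B) uX)) (∈-++⁺ʳ A q , p)

      module EA = Ears {G = G} bip C ¬si A B complete uA uB lenA lenB X XA XB non-A
      module EB = Ears {G = G} bip C ¬si B A (λ b∈ a∈ → ~-sym G (complete a∈ b∈)) uB uA lenB lenA X XB XA non-B

      short : ∀ {p v u qs} → p ∈ A ++ B → v ∈ X → adj G p v ≡ true → Chain G v u qs → Unique qs → All (_∈ X) qs → length qs ≤ m
      short p∈ v∈ = [ EA.long v∈ , EB.long v∈ ]′ (∈-++⁻ A p∈)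

      no-ear : ∀ {v p z qs w} → p ∈ A ++ B → v ∈ X → adj G p v ≡ true → Chain G v z qs → Unique qs →
        All (_∈ X) qs → w ≢ p → adj G z w ≡ true → w ∈ A ++ B → ⊥
      no-ear p∈ v∈ pv c u al ne zw w∈ =
        [ (λ a∈ → EA.ear v∈ a∈ pv c u al ne zw (∈-++⁻ A w∈)) , (λ b∈ → EB.ear v∈ b∈ pv c u al ne zw (Sum.swap (∈-++⁻ A w∈))) ]′ (∈-++⁻ A p∈)

      first : ∀ (l : List V) → 1 ≤ length l → ∃ λ x → x ∈ l
      first (x ∷ _) _ = x , here refl

      3≤ : ∀ {k} → m + (m + 3) ≤ k → 1 ≤ k
      3≤ p = ≤-trans (≤-trans (s≤s z≤n) (≤-trans (m≤n+m 3 m) (m≤n+m (m + 3) m))) p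

      inside-A : ∀ {a a′} → a ∈ A → a′ ∈ A → adj G a a′ ≡ false
      inside-A p q = let (b , b∈) = first B (3≤ lenB) in non-adjacent G bip (same-colour G bip (complete p b∈) (~-sym G (complete q b∈)))
      inside-B : ∀ {b b′} → b ∈ B → b′ ∈ B → adj G b b′ ≡ false
      inside-B p q = let (a , a∈) = first A (3≤ lenA) in non-adjacent G bip (same-colour G bip (~-sym G (complete a∈ p)) (complete a∈ q))

      abstract
        _∈ₗ?_ : (x : V) (xs : List V) → Dec (x ∈ xs)
        _∈ₗ?_ = MemDec._∈?_ _≟_

    component : ∃₂ λ W S → U ↭ W ++ S × 0 < length W × Good G (hub-size m) W × Sep G W S
    component with attach G m (A ++ B) X uX short
    ... | Ds , S , map≡ , permD , goods , later , seps , hungs =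
      catRev bls , S , perm , pos , good-blocks G bls (Allₚ.map⁺ goods) cut , sepW
      where
      block : V × List V → List V
      block (p , D) = p ∷ D
      bls = map block Ds
      concat-bls : ∀ Es → concat (map block Es) ↭ map proj₁ Es ++ concat (map proj₂ Es)
      concat-bls [] = ↭-refl
      concat-bls ((p , D) ∷ Es) = prep p (↭-trans (↭-++⁺ˡ D (concat-bls Es)) (shifts D (map proj₁ Es)))
      perm : U ↭ catRev bls ++ S
      perm = ↭-trans permX (↭-trans (↭-++⁺ˡ (A ++ B) permD) (↭-trans (↭-reflexive (sym (++-assoc (A ++ B) _ S)))
        (↭-++⁺ʳ S (↭-trans (↭-reflexive (cong (_++ concat (map proj₂ Ds)) (sym map≡))) (↭-trans (↭-sym (concat-bls Ds)) (↭-sym (catRev-↭ bls)))))))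
      pos : 0 < length (catRev bls)
      pos with first A (3≤ lenA)
      ... | a , a∈ = ∈-length (∈-resp-↭ (↭-sym (catRev-↭ bls)) (∈-resp-↭ (↭-sym (concat-bls Ds)) (∈-++⁺ˡ (subst (a ∈_) (sym map≡) (∈-++⁺ˡ a∈)))))
      sepW : Sep G (catRev bls) S
      sepW x∈ z∈ with ∈-concat⁻′ bls (∈-resp-↭ (catRev-↭ bls) x∈)
      ... | b , x∈b , b∈ with ∈-map⁻ block b∈
      ...   | (p , D) , d∈ , refl with x∈b
      ...     | here refl = proj₁ (All.lookup seps d∈) (here refl) z∈
      ...     | there x∈D = proj₂ (All.lookup seps d∈) x∈D z∈

      D⊆X : ∀ {p D} → (p , D) ∈ Ds → ∀ {x} → x ∈ D → x ∈ X
      D⊆X d∈ x∈ = ∈-resp-↭ (↭-sym permD) (∈-++⁺ˡ (∈-concat⁺′ x∈ (∈-map⁺ proj₂ d∈)))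

      p∈AB : ∀ {p D} → (p , D) ∈ Ds → p ∈ A ++ B
      p∈AB d∈ = subst (_ ∈_) map≡ (∈-map⁺ proj₁ d∈)

      -- Otherwise a path through the piece at `p` would start at `p` and end at another vertex `q`
      -- of the biclique, which `ear` excludes. The path recorded by `Hung` runs towards `p` and is
      -- therefore reversed.
      foreign : ∀ {p D q E z} → (p , D) ∈ Ds → (q , E) ∈ Ds → q ≢ p → z ∈ D → adj G q z ≡ false
      foreign {z = z} d∈ e∈ ne z∈ = Boolₚ.¬-not λ e →
        let (v , qs , pv , c , u , al) = All.lookup hungs d∈ z∈
        in no-ear (p∈AB d∈) (D⊆X d∈ (All.lookup al (∈-reverse⁻ (chain-head∈ G (chain-reverse G c))))) pv (chain-reverse G c) (unique-reverse u)
             (All.tabulate λ x∈ → D⊆X d∈ (All.lookup al (∈-reverse⁻ x∈))) ne (~-sym G e) (p∈AB e∈)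

      cut : ∀ pre post → bls ≡ pre ++ post → Lab G 3 (concat post) (concat pre)
      cut pre post bs≡ with map-++⁻ block Ds {pre} {post} bs≡
      ... | Dpre , Dpost , refl , refl , refl = record
          { lab = side ; same = λ x∈ x′∈ e z∈ → trans (value x∈ z∈) (trans (cong (λ l → sees l _) e) (sym (value x′∈ z∈))) }
        where
        side : V → Fin 3
        side x = if ⌊ x ∈ₗ? A ⌋ then suc zero else if ⌊ x ∈ₗ? B ⌋ then suc (suc zero) else zero
        sees : Fin 3 → V → Bool
        sees zero _ = false
        sees (suc zero) z = ⌊ z ∈ₗ? B ⌋
        sees (suc (suc zero)) z = ⌊ z ∈ₗ? A ⌋
        sees-X : ∀ l {z} → z ∈ X → sees l z ≡ false
        sees-X zero _ = refl
        sees-X (suc zero) {z} z∈ with z ∈ₗ? B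
        ... | yes p = ⊥-elim (XB z∈ p)
        ... | no _ = refl
        sees-X (suc (suc zero)) {z} z∈ with z ∈ₗ? A
        ... | yes p = ⊥-elim (XA z∈ p)
        ... | no _ = refl
        side-X : ∀ {x} → x ∈ X → side x ≡ zero
        side-X {x} x∈ with x ∈ₗ? A | x ∈ₗ? B
        ... | yes p | _ = ⊥-elim (XA x∈ p)
        ... | no _ | yes p = ⊥-elim (XB x∈ p)
        ... | no _ | no _ = refl
        centres : ∀ {x z} → x ∈ A ++ B → z ∈ A ++ B → adj G x z ≡ sees (side x) z
        centres {x} {z} x∈ z∈ with x ∈ₗ? A | x ∈ₗ? B
        centres {x} {z} x∈ z∈ | yes p | _ with z ∈ₗ? B
        ... | yes q = complete p q
        ... | no q = inside-A p ([ id , ⊥-elim ∘ q ]′ (∈-++⁻ A z∈))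
        centres {x} {z} x∈ z∈ | no _ | yes p with z ∈ₗ? A
        ... | yes q = ~-sym G (complete q p)
        ... | no q = inside-B p ([ ⊥-elim ∘ q , id ]′ (∈-++⁻ A z∈))
        centres {x} {z} x∈ z∈ | no p | no q = ⊥-elim ([ p , q ]′ (∈-++⁻ A x∈))
        value : ∀ {x z} → x ∈ concat (map block Dpost) → z ∈ concat (map block Dpre) → adj G x z ≡ sees (side x) z
        value x∈ z∈ with ∈-concat⁻′ (map block Dpost) x∈ | ∈-concat⁻′ (map block Dpre) z∈
        ... | b , x∈b , b∈ | b′ , z∈b′ , b′∈ with ∈-map⁻ block b∈ | ∈-map⁻ block b′∈
        ...   | (q , E) , e∈ , refl | (p , D) , d∈ , refl = go x∈b z∈b′
          where
          lat : Later G (p , D) (q , E)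
          lat = allPairs-++⁻ Dpre later d∈ e∈
          e∈Ds : (q , E) ∈ Dpre ++ Dpost
          e∈Ds = ∈-++⁺ʳ Dpre e∈
          d∈Ds : (p , D) ∈ Dpre ++ Dpost
          d∈Ds = ∈-++⁺ˡ d∈
          q≢p : q ≢ p
          q≢p refl = proj₂ (proj₂ (unique-++⁻ (map proj₁ Dpre) (subst Unique (trans (sym map≡) (map-++ proj₁ Dpre Dpost)) (proj₁ (unique-++⁻ (A ++ B) uX)))))
            (∈-map⁺ proj₁ d∈ , ∈-map⁺ proj₁ e∈)
          go : ∀ {x z} → x ∈ q ∷ E → z ∈ p ∷ D → adj G x z ≡ sees (side x) z
          go {x} {z} (there x∈E) (here refl) = trans (trans (adj-sym G x z) (proj₁ lat (here refl) x∈E)) (sym (cong (λ l → sees l z) (side-X (D⊆X e∈Ds x∈E))))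
          go {x} {z} (there x∈E) (there z∈D) = trans (trans (adj-sym G x z) (proj₂ lat z∈D x∈E)) (sym (sees-X (side x) (D⊆X d∈Ds z∈D)))
          go {x} {z} (here refl) (there z∈D) = trans (foreign d∈Ds e∈Ds q≢p z∈D) (sym (sees-X (side x) (D⊆X d∈Ds z∈D)))
          go {x} {z} (here refl) (here refl) = centres (p∈AB e∈Ds) (p∈AB d∈Ds)

  component : ∃₂ λ W S → U ↭ W ++ S × 0 < length W × Good G (hub-size m) W × Sep G W S
  component = Sides.component A B X complete uA uB lenA lenB permX uX non-A non-B
    where
    uX : Unique (ps ++ X)
    uX = unique-↭ permX uU
    in-U : ∀ {v} → v ∈ X → v ∈ U
    in-U v∈ = ∈-resp-↭ (↭-sym permX) (∈-++⁺ʳ ps v∈)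
    non-A : ∀ {v} → v ∈ X → ∃ λ a → a ∈ A × adj G v a ≡ false
    non-A v∈ = let (a , a∈ , e) = non-adj as (λ al → proj₂ (proj₂ (unique-++⁻ ps uX)) (∈-++⁺ʳ A (∈-filter⁺ (allAdj? as) (in-U v∈) al) , v∈))
               in a , as⊆A a∈ , e
    non-B : ∀ {v} → v ∈ X → ∃ λ b → b ∈ B × adj G v b ≡ false
    non-B v∈ = non-adj B (λ al → proj₂ (proj₂ (unique-++⁻ ps uX)) (∈-++⁺ˡ (∈-filter⁺ (allAdj? B) (in-U v∈) al) , v∈))

-- The clique-width bound from one excluded graph with coordinates

module Upper (m : ℕ) where

  -- A side of the biclique must offer `m` places for `H` beside the `m + 2` vertices blocked in
  -- `Outside`, or beside the three blocked in `ear₀`. The claws are two families, one for each side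
  -- of a forced biclique, and `m` spare ones. The width adds the bound for a hub, the number of
  -- deleted claw vertices and the bound for a claw-free rest.
  biclique-order claw-order claw-count order-width : ℕ
  biclique-order = m + (m + 3)
  claw-order = claw-length m biclique-order
  claw-count = biclique-order + biclique-order + m
  order-width = hub-size m + (claw-count * suc (3 * claw-order) + suc (component-size claw-order))

  module _ {n : ℕ} {H : Graph m} {G : Graph n} (bip : Bipartite G) (C : Coord H) (¬si : ¬ SI G H) where

    private
      Split : List (Fin n) → Set
      Split U = ∃₂ λ W S → U ↭ W ++ S × 0 < length W × Good G order-width W × Sep G W S × Unique S

    -- As long as a large biclique remains, its component is cut off. Without one, the whole rest is
    -- a single piece: many disjoint claws in it would force a large biclique in it, so deleting few
    -- vertices destroys all long claws, and these vertices are put in front of the order.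
    split : ∀ u U → Unique (u ∷ U) → Split (u ∷ U)
    split u U uU with biclique? G biclique-order (u ∷ U)
    ... | yes b = from-hub (Hub.component {G = G} bip C ¬si (u ∷ U) uU b)
      where
      from-hub : (∃₂ λ W S → u ∷ U ↭ W ++ S × 0 < length W × Good G (hub-size m) W × Sep G W S) → Split (u ∷ U)
      from-hub (W , S , perm , pos , good , sep) =
        W , S , perm , pos , good-mono G (m≤m+n (hub-size m) _) good , sep , proj₁ (proj₂ (unique-++⁻ W (unique-↭ perm uU)))
    ... | no ¬b = from-claws (find-claws {G = G} claw-order claw-order-pos claw-count (u ∷ U) uU)
      where
      claw-order-pos : 0 < claw-order
      claw-order-pos = ≤-trans (s≤s z≤n) (≤-trans (m≤n+m 4 (4 * claw-size m)) (m≤n+m (4 * claw-size m + 4) _))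
      from-claws : Claws {G = G} claw-order claw-count (u ∷ U) ⊎
        (∃₂ λ Z U′ → u ∷ U ↭ Z ++ U′ × length Z ≤ claw-count * suc (3 * claw-order) × ¬ Trip G claw-order U′) → Split (u ∷ U)
      from-claws (inj₁ cs) = ⊥-elim (¬b (ManyClaws.¬SI⇒biclique C biclique-order cs ¬si))
      from-claws (inj₂ (Z , U′ , perm , lenZ , ¬t)) = from-order
        (clawFree⇒good G claw-order U′ (proj₁ (proj₂ (unique-++⁻ Z (unique-↭ perm uU)))) ¬t)
        where
        from-order : (∃ λ xs → U′ ↭ xs × Good G (suc (component-size claw-order)) xs) → Split (u ∷ U)
        from-order (xs , perm′ , good) = Z ++ xs , [] , perm₂ , ≤-trans (s≤s z≤n) (≤-reflexive (↭-length perm₁)) ,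
          good-mono G (≤-trans (+-monoˡ-≤ _ lenZ) (m≤n+m _ (hub-size m))) (good-prefix G Z good) , (λ _ ()) , []
          where
          perm₁ : u ∷ U ↭ Z ++ xs
          perm₁ = ↭-trans perm (↭-++⁺ˡ Z perm′)
          perm₂ : u ∷ U ↭ (Z ++ xs) ++ []
          perm₂ = ↭-trans perm₁ (↭-reflexive (sym (++-identityʳ (Z ++ xs))))

    clique-width-bound : CWAtMost G (suc (suc order-width + suc order-width))
    clique-width-bound = assemble (peel G Unique (_≡ []) (Good G order-width) strip (allFin n) (Uniqueₚ.allFin⁺ n))
      where
      strip : ∀ U → Unique U → U ≡ [] ⊎ Split U
      strip [] _ = inj₁ refl
      strip (u ∷ U) uU = inj₂ (split u U uU)
      assemble : (∃₂ λ bs S → allFin n ↭ concat bs ++ S × All (Good G order-width) bs × AllPairs (Sep G) bs ×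
        Sep G (concat bs) S × S ≡ [] × Unique S) → CWAtMost G (suc (suc order-width + suc order-width))
      assemble (bs , .[] , perm , goods , seps , _ , refl , _) = good⇒cw G (suc order-width)
        (↭-trans (catRev-↭ bs) (↭-sym (↭-trans perm (↭-reflexive (++-identityʳ _))))) (good-separated G bs goods seps)

-- Forests with at most three leaves per component

module _ {m : ℕ} (H : Graph m) where

  private
    V = Fin m
    infix 4 _~_
    _~_ : V → V → Set
    u ~ v = adj H u v ≡ true

  -- Non-backtracking walks stand in for paths: the condition is local, so walks can be glued and
  -- prolonged by looking at one junction only, and in a forest they are exactly the paths.
  data NonBack : List V → Set where
    one  : ∀ {x} → NonBack [ x ]
    two  : ∀ {x y} → x ~ y → NonBack (x ∷ y ∷ [])
    more : ∀ {x y z zs} → x ~ y → x ≢ z → NonBack (y ∷ z ∷ zs) → NonBack (x ∷ y ∷ z ∷ zs)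

  endOf : V → List V → V
  endOf c [] = c
  endOf c (u ∷ p) = endOf u p

  beforeEnd : V → V → List V → V
  beforeEnd x y [] = x
  beforeEnd x y (z ∷ p) = beforeEnd y z p

  endOf∈ : ∀ u p → endOf u p ∈ u ∷ p
  endOf∈ u [] = here refl
  endOf∈ u (v ∷ p) = there (endOf∈ v p)

  endOf-++ : ∀ c p y → endOf c (p ++ [ y ]) ≡ y
  endOf-++ c [] y = refl
  endOf-++ c (u ∷ p) y = endOf-++ u p y

  endOf-++′ : ∀ c p a A → endOf c (p ++ a ∷ A) ≡ endOf a A
  endOf-++′ c [] a A = refl
  endOf-++′ c (u ∷ p) a A = endOf-++′ u p a A

  nb-tail : ∀ {x y p} → NonBack (x ∷ y ∷ p) → NonBack (y ∷ p)
  nb-tail (two _) = one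
  nb-tail (more _ _ w) = w

  nb-head : ∀ {x y p} → NonBack (x ∷ y ∷ p) → x ~ y
  nb-head (two e) = e
  nb-head (more e _ _) = e

  nb-glue : ∀ as {x c y ys} → NonBack (as ++ x ∷ c ∷ []) → NonBack (c ∷ y ∷ ys) → x ≢ y → NonBack (as ++ x ∷ c ∷ y ∷ ys)
  nb-glue [] (two e) w ne = more e ne w
  nb-glue (a ∷ []) (more e n w′) w ne = more e n (nb-glue [] w′ w ne)
  nb-glue (a ∷ b ∷ []) (more e n w′) w ne = more e n (nb-glue [ b ] w′ w ne)
  nb-glue (a ∷ b ∷ c ∷ as) (more e n w′) w ne = more e n (nb-glue (b ∷ c ∷ as) w′ w ne)

  nb-append : ∀ {x y} p {a A} → NonBack (x ∷ y ∷ p) → NonBack (endOf y p ∷ a ∷ A) → beforeEnd x y p ≢ a → NonBack (x ∷ y ∷ p ++ a ∷ A)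
  nb-append [] (two e) w ne = more e ne w
  nb-append (z ∷ p) (more e n w′) w ne = more e n (nb-append p w′ w ne)

  nb-reverse : ∀ {qs} → NonBack qs → NonBack (reverse qs)
  nb-reverse one = one
  nb-reverse (two e) = two (~-sym H e)
  nb-reverse {x ∷ y ∷ z ∷ zs} (more e n w) =
    subst NonBack (sym rev₃) (nb-glue (reverse zs) (subst NonBack rev₂ (nb-reverse w)) (two (~-sym H e)) (≢-sym n))
    where
    rev₂ : reverse (y ∷ z ∷ zs) ≡ reverse zs ++ z ∷ y ∷ []
    rev₂ = trans (unfold-reverse y (z ∷ zs)) (trans (cong (_++ [ y ]) (unfold-reverse z zs)) (++-assoc (reverse zs) [ z ] [ y ]))
    rev₃ : reverse (x ∷ y ∷ z ∷ zs) ≡ reverse zs ++ z ∷ y ∷ x ∷ []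
    rev₃ = trans (unfold-reverse x (y ∷ z ∷ zs)) (trans (cong (_++ [ x ]) rev₂) (++-assoc (reverse zs) (z ∷ y ∷ []) [ x ]))

  nb⇒path : ∀ {qs} → NonBack qs → Path H qs
  nb⇒path one = [-]
  nb⇒path (two e) = e ∷ [-]
  nb⇒path (more e _ w) = e ∷ nb⇒path w

  nb? : ∀ qs → Dec (NonBack qs)
  nb? [] = no λ ()
  nb? (x ∷ []) = yes one
  nb? (x ∷ y ∷ []) = map′ two (λ { (two e) → e }) (adj H x y Boolₚ.≟ true)
  nb? (x ∷ y ∷ z ∷ zs) = map′ (λ (e , n , w) → more e n w) (λ { (more e n w) → e , n , w })
    ((adj H x y Boolₚ.≟ true) ×-dec ¬? (x ≟ z) ×-dec nb? (y ∷ z ∷ zs))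

  reach-trans : ∀ {u v w} → Reach H u v → Reach H v w → Reach H u w
  reach-trans here r = r
  reach-trans (step e q) r = step e (reach-trans q r)

  reach-sym : ∀ {u v} → Reach H u v → Reach H v u
  reach-sym here = here
  reach-sym (step e q) = reach-trans (reach-sym q) (step (~-sym H e) here)

  nb⇒reach : ∀ c p → NonBack (c ∷ p) → Reach H c (endOf c p)
  nb⇒reach c [] _ = here
  nb⇒reach c (u ∷ p) w = step (nb-head w) (nb⇒reach u p (nb-tail w))

  nb⇒reach∈ : ∀ c p → NonBack (c ∷ p) → ∀ {v} → v ∈ c ∷ p → Reach H c v
  nb⇒reach∈ c p w (here refl) = here
  nb⇒reach∈ c (u ∷ p) w (there q) = step (nb-head w) (nb⇒reach∈ u p (nb-tail w) q)

  reach⇒nb : ∀ {u v} → Reach H u v → ∃ λ p → NonBack (u ∷ p) × endOf u p ≡ v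
  reach⇒nb here = [] , one , refl
  reach⇒nb {u} (step {v = v} e r) with reach⇒nb r
  ... | [] , w , eq = v ∷ [] , two e , eq
  ... | z ∷ p , w , eq with u ≟ z
  ...   | yes refl = p , nb-tail w , eq
  ...   | no u≢z = v ∷ z ∷ p , more e u≢z w , eq

  split-end : ∀ r u p → NonBack (r ∷ u ∷ p) → ∃ λ q → u ∷ p ≡ q ++ [ endOf u p ] × NonBack (r ∷ q) × endOf r q ~ endOf u p × endOf r q ≡ beforeEnd r u p
  split-end r u [] w = [] , refl , one , nb-head w , refl
  split-end r u (v ∷ []) (more e _ w) = u ∷ [] , refl , two e , nb-head w , refl
  split-end r u (v ∷ z ∷ p) (more e n w) with split-end u v (z ∷ p) w
  ... | q , eq , w′ , e′ , eq′ = u ∷ q , cong (u ∷_) eq , lemma q eq w′ , e′ , eq′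
    where
    lemma : ∀ q → v ∷ z ∷ p ≡ q ++ [ endOf z p ] → NonBack (u ∷ q) → NonBack (r ∷ u ∷ q)
    lemma [] _ _ = two e
    lemma (_ ∷ q) eq w′ with ∷-injectiveˡ eq
    ... | refl = more e n w′

  neighbours : V → List V
  neighbours v = filterᵇ (adj H v) (allFin m)

  ∈-neighbours⁻ : ∀ {v u} → u ∈ neighbours v → v ~ u
  ∈-neighbours⁻ {v} {u} p = T⇒≡ (proj₂ (∈-filter⁻ (λ u → T? (adj H v u)) {xs = allFin m} p))
    where
    T⇒≡ : ∀ {b} → IsTrue b → b ≡ true
    T⇒≡ {true} _ = refl

  ∈-neighbours⁺ : ∀ {v u} → v ~ u → u ∈ neighbours v
  ∈-neighbours⁺ {v} {u} e = ∈-filter⁺ (λ u → T? (adj H v u)) (∈-allFin u) (≡⇒T e)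
    where
    ≡⇒T : ∀ {b} → b ≡ true → IsTrue b
    ≡⇒T refl = tt

  neighbours-unique : ∀ v → Unique (neighbours v)
  neighbours-unique v = Uniqueₚ.filter⁺ (λ u → T? (adj H v u)) (Uniqueₚ.allFin⁺ m)

  leaf⁻ : ∀ {v a b} → Leaf H v → v ~ a → v ~ b → a ≡ b
  leaf⁻ {v} leaf ea eb with neighbours v in eq | leaf
  ... | x ∷ [] | _ = trans (only (subst (_ ∈_) eq (∈-neighbours⁺ ea))) (sym (only (subst (_ ∈_) eq (∈-neighbours⁺ eb))))
    where
    only : ∀ {y} → y ∈ x ∷ [] → y ≡ x
    only (here p) = p

  leaf⁺ : ∀ {v u} → v ~ u → (∀ z → v ~ z → z ≡ u) → Leaf H v
  leaf⁺ {v} {u} e only = go (neighbours v) (neighbours-unique v) (∈-neighbours⁺ e) (λ z∈ → only _ (∈-neighbours⁻ z∈))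
    where
    go : ∀ l → Unique l → u ∈ l → (∀ {z} → z ∈ l → z ≡ u) → length l ≡ 1
    go (x ∷ []) _ _ _ = refl
    go (x ∷ y ∷ l) (p ∷ _) _ h = ⊥-elim (All.lookup p (here refl) (trans (h (here refl)) (sym (h (there (here refl))))))

  record Deg3 (c : V) : Set where
    constructor deg3
    field
      {n₁ n₂ n₃} : V
      e₁ : c ~ n₁
      e₂ : c ~ n₂
      e₃ : c ~ n₃
      n₁₂ : n₁ ≢ n₂
      n₁₃ : n₁ ≢ n₃
      n₂₃ : n₂ ≢ n₃

  deg3? : ∀ c → Dec (Deg3 c)
  deg3? c = map′ (λ (_ , _ , _ , e₁ , e₂ , e₃ , a , b , d) → deg3 e₁ e₂ e₃ a b d)
    (λ (deg3 e₁ e₂ e₃ a b d) → _ , _ , _ , e₁ , e₂ , e₃ , a , b , d)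
    (any? λ x → any? λ y → any? λ z → (adj H c x Boolₚ.≟ true) ×-dec (adj H c y Boolₚ.≟ true) ×-dec (adj H c z Boolₚ.≟ true)
      ×-dec ¬? (x ≟ y) ×-dec ¬? (x ≟ z) ×-dec ¬? (y ≟ z))

  module Acyclic (acyclic : ¬ Cycle H) where

    -- The tail has distinct vertices by induction, so a return to the first vertex closes a cycle.
    -- It has at least three vertices because the walk does not turn back.
    nb-unique : ∀ {qs} → NonBack qs → Unique qs
    nb-unique one = [] ∷ []
    nb-unique {x ∷ p} w@(two e) = unique-∷⁺ (λ { (here refl) → irrefl′ H e }) ([] ∷ [])
    nb-unique {x ∷ y ∷ z ∷ zs} w@(more e n w′) = unique-∷⁺ x∉ u′
      where
      u′ : Unique (y ∷ z ∷ zs)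
      u′ = nb-unique w′
      consecutive : ∀ v l → Path H (v ∷ l) → ∀ (i : Fin (length l)) → lookup (v ∷ l) (inject₁ i) ~ lookup (v ∷ l) (suc i)
      consecutive v (u ∷ l) (e ∷ _) zero = e
      consecutive v (u ∷ l) (_ ∷ p) (suc i) = consecutive u l p i
      last : ∀ v l {t ts} → Path H (v ∷ l ++ t ∷ ts) → lookup (v ∷ l) (fromℕ (length l)) ~ t
      last v [] (e ∷ _) = e
      last v (u ∷ l) (_ ∷ p) = last u l p
      x∉ : x ∉ y ∷ z ∷ zs
      x∉ (here refl) = irrefl′ H e
      x∉ (there (here refl)) = n refl
      x∉ (there (there q)) with ∈-∃++ q
      ... | as , bs , refl = acyclic (length as , lookup (x ∷ y ∷ z ∷ as) , lookup-unique (unique-∷⁺ x∉as uas) ,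
          consecutive x (y ∷ z ∷ as) (linked-++⁻ˡ (x ∷ y ∷ z ∷ as) path) , last x (y ∷ z ∷ as) path)
        where
        path : Path H (x ∷ y ∷ z ∷ as ++ x ∷ bs)
        path = nb⇒path w
        uas : Unique (y ∷ z ∷ as)
        uas = proj₁ (unique-++⁻ (y ∷ z ∷ as) u′)
        x∉as : x ∉ y ∷ z ∷ as
        x∉as p = proj₂ (proj₂ (unique-++⁻ (y ∷ z ∷ as) u′)) (p , here refl)

    -- One ray reversed and followed by the other does not backtrack at `c`, since the rays start
    -- differently; so this walk has distinct vertices.
    rays-disjoint : ∀ {c u p u′ p′ v} → NonBack (c ∷ u ∷ p) → NonBack (c ∷ u′ ∷ p′) → u ≢ u′ → v ∈ u ∷ p → v ∈ u′ ∷ p′ → ⊥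
    rays-disjoint {c} {u} {p} {u′} {p′} w w′ ne v∈ v∈′ =
      proj₂ (proj₂ (unique-++⁻ (reverse (u ∷ p)) (subst Unique eq (nb-unique (nb-glue (reverse p) (subst NonBack rev (nb-reverse w)) w′ ne)))))
        (∈-reverse⁺ v∈ , there v∈′)
      where
      rev : reverse (c ∷ u ∷ p) ≡ reverse p ++ u ∷ c ∷ []
      rev = trans (unfold-reverse c (u ∷ p)) (trans (cong (_++ [ c ]) (unfold-reverse u p)) (++-assoc (reverse p) [ u ] [ c ]))
      eq : reverse p ++ u ∷ c ∷ u′ ∷ p′ ≡ reverse (u ∷ p) ++ c ∷ u′ ∷ p′
      eq = sym (trans (cong (_++ c ∷ u′ ∷ p′) (unfold-reverse u p)) (++-assoc (reverse p) [ u ] (c ∷ u′ ∷ p′)))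

    nb-determined : ∀ {c} p p′ → NonBack (c ∷ p) → NonBack (c ∷ p′) → endOf c p ≡ endOf c p′ → p ≡ p′
    nb-determined [] [] _ _ _ = refl
    nb-determined {c} [] (u ∷ p′) _ w e = ⊥-elim (Unique[x∷xs]⇒x∉xs (nb-unique w) (subst (_∈ u ∷ p′) (sym e) (endOf∈ u p′)))
    nb-determined {c} (u ∷ p) [] w _ e = ⊥-elim (Unique[x∷xs]⇒x∉xs (nb-unique w) (subst (_∈ u ∷ p) e (endOf∈ u p)))
    nb-determined (u ∷ p) (u′ ∷ p′) w w′ e with u ≟ u′
    ... | yes refl = cong (u ∷_) (nb-determined p p′ (nb-tail w) (nb-tail w′) e)
    ... | no ne = ⊥-elim (rays-disjoint w w′ ne (endOf∈ u p) (subst (_∈ u′ ∷ p′) (sym e) (endOf∈ u′ p′)))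

    -- A reachable vertex is the end of a non-backtracking walk, which in a forest has at most `m`
    -- vertices. This makes the search finite.
    reach? : ∀ u v → Dec (Reach H u v)
    reach? u v = map′
      (λ { (_ , p , _ , w , refl) → nb⇒reach u p w })
      (λ r → let (p , w , e) = reach⇒nb r in fromℕ< (unique-length (nb-unique w)) , p , sym (toℕ-fromℕ< (unique-length (nb-unique w))) , w , e)
      (any? λ (k : Fin m) → anyList? (toℕ k) {P = λ p → NonBack (u ∷ p) × endOf u p ≡ v} λ p → nb? (u ∷ p) ×-dec (endOf u p ≟ v))

    -- Continue without turning back until this is impossible, which happens only at a leaf. A walk
    -- that survived `m` extensions would have `m + 2` distinct vertices.
    ray-to-leaf : ∀ {c u} → c ~ u → ∃ λ p → NonBack (c ∷ u ∷ p) × Leaf H (endOf u p)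
    ray-to-leaf {c} {u} e with extend m c u e
      where
      extend : ∀ k c u → c ~ u → (∃ λ p → NonBack (c ∷ u ∷ p) × Leaf H (endOf u p)) ⊎ (∃ λ p → NonBack (c ∷ u ∷ p) × length p ≡ k)
      extend zero c u e = inj₂ ([] , two e , refl)
      extend (suc k) c u e with any? (λ z → (adj H u z Boolₚ.≟ true) ×-dec ¬? (z ≟ c))
      ... | no none = inj₁ ([] , two e , leaf⁺ (~-sym H e) λ z uz → decidable-stable (z ≟ c) λ z≢c → none (z , uz , z≢c))
      ... | yes (z , uz , z≢c) with extend k u z uz
      ...   | inj₁ (p , w , leaf) = inj₁ (z ∷ p , more e (≢-sym z≢c) w , leaf)
      ...   | inj₂ (p , w , len) = inj₂ (z ∷ p , more e (≢-sym z≢c) w , cong suc len)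
    ... | inj₁ r = r
    ... | inj₂ (p , w , len) = ⊥-elim (<⇒≱ (s≤s (m≤n⇒m≤1+n (≤-reflexive (sym len)))) (unique-length (nb-unique w)))

    -- Coordinates are read off the unique walk from the root of the component: its branching vertex if there is one.
    module Local (no-four : ∀ {c} → length (neighbours c) ≤ 3)
      (one-branching : ∀ {c c′} → Deg3 c → Deg3 c′ → Reach H c c′ → c ≡ c′) where

      private
        headOr : V → List V → V
        headOr d [] = d
        headOr d (x ∷ _) = x

        headOr-∈ : ∀ d l → headOr d l ≡ d ⊎ headOr d l ∈ l
        headOr-∈ d [] = inj₁ refl
        headOr-∈ d (x ∷ l) = inj₂ (here refl)

        headOr-cong : ∀ {d d′ x} l → x ∈ l → headOr d l ≡ headOr d′ l
        headOr-cong (_ ∷ _) _ = refl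

        reachable branching : V → List V
        reachable x = filter (reach? x) (allFin m)
        branching x = filter (λ y → reach? x y ×-dec deg3? y) (allFin m)

        base : V → V
        base x = headOr x (reachable x)

      abstract
        root : V → V
        root x = headOr (base x) (branching x)

        base-reach : ∀ x → Reach H x (base x)
        base-reach x with headOr-∈ x (reachable x)
        ... | inj₁ e = subst (Reach H x) (sym e) here
        ... | inj₂ p = proj₂ (∈-filter⁻ (reach? x) {xs = allFin m} p)

        root-reach : ∀ x → Reach H x (root x)
        root-reach x with headOr-∈ (base x) (branching x)
        ... | inj₁ e = subst (Reach H x) (sym e) (base-reach x)
        ... | inj₂ p = proj₁ (proj₂ (∈-filter⁻ (λ y → reach? x y ×-dec deg3? y) {xs = allFin m} p))

        -- The choice looks only at the lists of reachable and of branching vertices, and these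
        -- lists are literally equal for two vertices of one component.
        root-≡ : ∀ {x y} → Reach H x y → root x ≡ root y
        root-≡ {x} {y} r = cong₂ headOr base≡ branching≡
          where
          to : ∀ {z} → Reach H x z → Reach H y z
          to = reach-trans (reach-sym r)
          from : ∀ {z} → Reach H y z → Reach H x z
          from = reach-trans r
          reachable≡ : reachable x ≡ reachable y
          reachable≡ = filter-≐ (reach? x) (reach? y) (to , from) (allFin m)
          branching≡ : branching x ≡ branching y
          branching≡ = filter-≐ (λ z → reach? x z ×-dec deg3? z) (λ z → reach? y z ×-dec deg3? z)
            ((λ (a , b) → to a , b) , (λ (a , b) → from a , b)) (allFin m)
          base≡ : base x ≡ base y
          base≡ = trans (cong (headOr x) reachable≡) (headOr-cong (reachable y) (∈-filter⁺ (reach? y) (∈-allFin y) here))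

        other-≢-deg3 : ∀ {y} → Deg3 y → y ≡ root y
        other-≢-deg3 {y} d with headOr-∈ (base y) (branching y)
        ... | inj₂ p = let (_ , r , d′) = ∈-filter⁻ (λ z → reach? y z ×-dec deg3? z) {xs = allFin m} p in one-branching d d′ r
        ... | inj₁ _ with branching y in eq
        ...   | x ∷ _ = let (_ , r , d′) = ∈-filter⁻ (λ z → reach? y z ×-dec deg3? z) {xs = allFin m} (subst (x ∈_) (sym eq) (here refl)) in one-branching d d′ r
        ...   | [] = case subst (y ∈_) eq (∈-filter⁺ (λ z → reach? y z ×-dec deg3? z) (∈-allFin y) (here , d)) of λ ()

        walk : V → List V
        walk x = proj₁ (reach⇒nb (reach-sym (root-reach x)))
        walk-nb : ∀ x → NonBack (root x ∷ walk x)
        walk-nb x = proj₁ (proj₂ (reach⇒nb (reach-sym (root-reach x))))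
        walk-end : ∀ x → endOf (root x) (walk x) ≡ x
        walk-end x = proj₂ (proj₂ (reach⇒nb (reach-sym (root-reach x))))

        leg-of : V → List V → Fin 3
        leg-of r [] = zero
        leg-of r (u ∷ _) with MemDec._∈?_ _≟_ u (neighbours r)
        ... | yes p = inject≤ (Any.index p) no-four
        ... | no _ = zero

        leg-of-inj : ∀ {r u p u′ p′} → r ~ u → r ~ u′ → leg-of r (u ∷ p) ≡ leg-of r (u′ ∷ p′) → u ≡ u′
        leg-of-inj {r} {u} {p} {u′} e e′ q with MemDec._∈?_ _≟_ u (neighbours r) | MemDec._∈?_ _≟_ u′ (neighbours r)
        ... | yes a | yes b = trans (Anyₚ.lookup-index a) (trans (cong (lookup (neighbours r)) (Finₚ.inject≤-injective no-four no-four _ _ q)) (sym (Anyₚ.lookup-index b)))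
        ... | no a | _ = ⊥-elim (a (∈-neighbours⁺ e))
        ... | yes _ | no b = ⊥-elim (b (∈-neighbours⁺ e′))

        leg-of-≡ : ∀ r u p p′ → leg-of r (u ∷ p) ≡ leg-of r (u ∷ p′)
        leg-of-≡ r u p p′ with MemDec._∈?_ _≟_ u (neighbours r)
        ... | yes _ = refl
        ... | no _ = refl

      private
        walk-≡ : ∀ {r x} q → root x ≡ r → NonBack (r ∷ q) → endOf r q ≡ x → walk x ≡ q
        walk-≡ {x = x} q refl w e = nb-determined (walk x) q (walk-nb x) w (trans (walk-end x) (sym e))

        simple : ∀ {r u p y} → root r ≡ r → NonBack (r ∷ u ∷ p) → y ∈ u ∷ p → ¬ Deg3 y
        simple {r} {u} {p} {y} rr w y∈ d = Unique[x∷xs]⇒x∉xs (nb-unique w)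
          (subst (_∈ u ∷ p) (trans (other-≢-deg3 d) (trans (sym (root-≡ (nb⇒reach∈ r (u ∷ p) w (there y∈)))) rr)) y∈)

        -- Away from the root no vertex branches, so the first step determines the whole
        -- continuation. This makes leg and position a coordinate system.
        deterministic : ∀ {x y} p p′ → NonBack (x ∷ y ∷ p) → NonBack (x ∷ y ∷ p′) → (∀ {z} → z ∈ y ∷ p → ¬ Deg3 z) → length p ≡ length p′ → p ≡ p′
        deterministic [] [] _ _ _ _ = refl
        deterministic (z ∷ p) (z′ ∷ p′) (more e n w) (more e′ n′ w′) s len with z ≟ z′
        ... | yes refl = cong (z ∷_) (deterministic p p′ w w′ (s ∘ there) (suc-injective len))
        ... | no ne = ⊥-elim (s (here refl) (deg3 (~-sym H e) (nb-head w) (nb-head w′) n n′ ne))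

        same-leaf : ∀ {x y} p p′ → NonBack (x ∷ y ∷ p) → NonBack (x ∷ y ∷ p′) → (∀ {z} → z ∈ y ∷ p → ¬ Deg3 z) →
          Leaf H (endOf y p) → Leaf H (endOf y p′) → endOf y p ≡ endOf y p′
        same-leaf [] [] _ _ _ _ _ = refl
        same-leaf [] (z ∷ p) _ (more e n w) _ leaf _ = ⊥-elim (n (leaf⁻ leaf (~-sym H e) (nb-head w)))
        same-leaf (z ∷ p) [] (more e n w) _ _ _ leaf = ⊥-elim (n (leaf⁻ leaf (~-sym H e) (nb-head w)))
        same-leaf (z ∷ p) (z′ ∷ p′) (more e n w) (more e′ n′ w′) s leaf leaf′ with z ≟ z′
        ... | yes refl = same-leaf p p′ w w′ (s ∘ there) leaf leaf′
        ... | no ne = ⊥-elim (s (here refl) (deg3 (~-sym H e) (nb-head w) (nb-head w′) n n′ ne))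

        root-root : ∀ x → root (root x) ≡ root x
        root-root x = sym (root-≡ (root-reach x))

      coord : Coord H
      coord = record
        { comp = root ; leg = λ x → leg-of (root x) (walk x) ; pos = λ x → length (walk x)
        ; pos< = λ x → unique-length (nb-unique (walk-nb x))
        ; coord-inj = c-inj ; adj⇒next = to-next ; next⇒adj = from-next }
        where
        legs : V → Fin 3
        legs x = leg-of (root x) (walk x)
        Nx : V → V → Set
        Nx x y = root x ≡ root y × length (walk y) ≡ suc (length (walk x)) × (length (walk x) ≡ 0 ⊎ legs x ≡ legs y)

        inj-walks : ∀ {r x y} p q → root r ≡ r → NonBack (r ∷ p) → NonBack (r ∷ q) → endOf r p ≡ x → endOf r q ≡ y → length p ≡ length q →
          length p ≡ 0 ⊎ leg-of r p ≡ leg-of r q → x ≡ y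
        inj-walks [] [] _ _ _ refl refl _ _ = refl
        inj-walks {r} (u ∷ p) (u′ ∷ q) rr w w′ refl refl len (inj₂ l) with leg-of-inj {r} {u} {p} {u′} {q} (nb-head w) (nb-head w′) l
        ... | refl = cong (endOf u) (deterministic p q w w′ (simple rr w) (suc-injective len))

        c-inj : ∀ {x y} → root x ≡ root y → length (walk x) ≡ length (walk y) → length (walk x) ≡ 0 ⊎ legs x ≡ legs y → x ≡ y
        c-inj {x} {y} r≡ len l = inj-walks {root x} (walk x) (walk y) (root-root x) (walk-nb x) (subst (λ r → NonBack (r ∷ walk y)) (sym r≡) (walk-nb y))
          (walk-end x) (trans (cong (λ r → endOf r (walk y)) r≡) (walk-end y)) len (Sum.map₂ (λ e → trans e (cong (λ r → leg-of r (walk y)) (sym r≡))) l)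

        next-of : ∀ {x y} → root x ≡ root y → walk y ≡ walk x ++ [ y ] → Nx x y
        next-of {x} {y} r≡ e = r≡ , trans (cong length e) (trans (length-++ (walk x)) (+-comm _ 1)) , same-leg (walk x) refl
          where
          same-leg : ∀ p → p ≡ walk x → length (walk x) ≡ 0 ⊎ legs x ≡ legs y
          same-leg [] e′ = inj₁ (cong length (sym e′))
          same-leg (u ∷ p) e′ = inj₂ (trans (cong (leg-of (root x)) (sym e′)) (trans (leg-of-≡ (root x) u p (p ++ [ y ]))
            (trans (cong (λ r → leg-of r (u ∷ p ++ [ y ])) r≡) (cong (leg-of (root y)) (sym (trans e (cong (_++ [ y ]) (sym e′))))))))

        to-next : ∀ {x y} → x ~ y → Nx x y ⊎ Nx y x
        to-next {x} {y} e = go (walk x) refl (walk-nb x) (walk-end x)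
          where
          r≡ : root x ≡ root y
          r≡ = root-≡ (step e here)
          go : ∀ p → p ≡ walk x → NonBack (root x ∷ p) → endOf (root x) p ≡ x → Nx x y ⊎ Nx y x
          go [] e′ w end = inj₁ (next-of r≡ (trans (walk-≡ {root x} [ y ] (sym r≡) (two (subst (_~ y) (sym end) e)) refl) (cong (_++ [ y ]) e′)))
          go (u ∷ p) e′ w end with beforeEnd (root x) u p ≟ y
          ... | no ne = inj₁ (next-of r≡ (trans (walk-≡ {root x} (u ∷ p ++ [ y ]) (sym r≡)
                  (nb-append p w (two (subst (_~ y) (sym end) e)) ne) (endOf-++ u p y)) (cong (_++ [ y ]) e′)))
          ... | yes b≡ with split-end (root x) u p w
          ...   | q , eq , w′ , _ , eq′ = inj₂ (next-of (sym r≡)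
                  (trans (sym e′) (trans eq (cong₂ (λ a b → a ++ [ b ]) (sym (walk-≡ {root x} q (sym r≡) w′ (trans eq′ b≡))) end))))

        from-next : ∀ {x y} → Nx x y → x ~ y
        from-next {x} {y} (r≡ , len , l) = go (walk y) refl (walk-nb y) (walk-end y)
          where
          go : ∀ p → p ≡ walk y → NonBack (root y ∷ p) → endOf (root y) p ≡ y → x ~ y
          go [] e′ _ _ = case trans (cong length e′) len of λ ()
          go (u ∷ p) e′ w end with split-end (root y) u p w
          ... | q , eq , w′ , q~ , _ = subst₂ _~_ (sym x≡) end q~
            where
            len-q : length (walk x) ≡ length q
            len-q = suc-injective (trans (sym len) (trans (cong length (trans (sym e′) eq)) (trans (length-++ q) (+-comm _ 1))))
            leg-q : ∀ q′ → q′ ≡ q → length (walk x) ≡ 0 ⊎ leg-of (root x) (walk x) ≡ leg-of (root x) q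
            leg-q [] e″ = inj₁ (trans len-q (cong length (sym e″)))
            leg-q (t ∷ q′) refl with ∷-injectiveˡ eq
            ... | refl = Sum.map₂ (λ a → trans a (trans (cong₂ leg-of (sym r≡) (sym e′)) (leg-of-≡ (root x) u p q′))) l
            x≡ : x ≡ endOf (root y) q
            x≡ = inj-walks {root x} (walk x) q (root-root x) (walk-nb x) (subst (λ r → NonBack (r ∷ q)) (sym r≡) w′) (walk-end x)
              (cong (λ r → endOf r q) r≡) len-q (leg-q q refl)

      -- Two leaves reached from the root by the same first step coincide. If the root is one of
      -- four leaves, it has a single neighbour, so two others share their first step; if it is not,
      -- four leaves compete for three first steps. This direction is used for the subgraphs of the
      -- host.
      at-most-three-leaves : AtMostThreeLeavesPerComponent H
      at-most-three-leaves (l , l-inj , leaves , connected) = by-root (any? λ i → l i ≟ r)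
        where
        r : V
        r = root (l zero)
        r≡ : ∀ i → root (l i) ≡ r
        r≡ i = root-≡ (connected i zero)
        wk : Fin 4 → List V
        wk i = walk (l i)
        wk-nb : ∀ i → NonBack (r ∷ wk i)
        wk-nb i = subst (λ r → NonBack (r ∷ wk i)) (r≡ i) (walk-nb (l i))
        wk-end : ∀ i → endOf r (wk i) ≡ l i
        wk-end i = trans (cong (λ r → endOf r (wk i)) (sym (r≡ i))) (walk-end (l i))
        same-first : ∀ {i j u p u′ p′} → i ≢ j → wk i ≡ u ∷ p → wk j ≡ u′ ∷ p′ → u ≢ u′
        same-first {i} {j} {u} {p} {u′} {p′} i≢j e e′ refl = i≢j (l-inj (trans (sym end-i) (trans
            (same-leaf p p′ w w′ (simple (root-root (l zero)) w) (subst (Leaf H) (sym end-i) (leaves i)) (subst (Leaf H) (sym end-j) (leaves j))) end-j)))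
          where
          w = subst (λ q → NonBack (r ∷ q)) e (wk-nb i)
          w′ = subst (λ q → NonBack (r ∷ q)) e′ (wk-nb j)
          end-i : endOf u p ≡ l i
          end-i = trans (cong (endOf r) (sym e)) (wk-end i)
          end-j : endOf u p′ ≡ l j
          end-j = trans (cong (endOf r) (sym e′)) (wk-end j)
        proper : ∀ i → l i ≢ r → ∃₂ λ u p → wk i ≡ u ∷ p × r ~ u
        proper i ne with wk i | wk-nb i | wk-end i
        ... | [] | _ | e = ⊥-elim (ne (sym e))
        ... | u ∷ p | w | _ = u , p , refl , nb-head w
        by-root : Dec (∃ λ i → l i ≡ r) → ⊥
        by-root (yes (i , li≡r)) = two-others (others i)
          where
          others : ∀ (i : Fin 4) → ∃₂ λ j k → j ≢ i × k ≢ i × j ≢ k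
          others zero = suc zero , suc (suc zero) , (λ ()) , (λ ()) , (λ ())
          others (suc zero) = zero , suc (suc zero) , (λ ()) , (λ ()) , (λ ())
          others (suc (suc _)) = zero , suc zero , (λ ()) , (λ ()) , (λ ())
          not-root : ∀ {j} → j ≢ i → l j ≢ r
          not-root ne e = ne (l-inj (trans e (sym li≡r)))
          two-others : (∃₂ λ j k → j ≢ i × k ≢ i × j ≢ k) → ⊥
          two-others (j , k , j≢i , k≢i , j≢k) with proper j (not-root j≢i) | proper k (not-root k≢i)
          ... | u , p , e , ru | u′ , p′ , e′ , ru′ = same-first j≢k e e′ (leaf⁻ (subst (Leaf H) li≡r (leaves i)) ru ru′)
        by-root (no none) with pigeonhole (s≤s (s≤s (s≤s (s≤s z≤n)))) (λ (i : Fin 4) → leg-of r (wk i))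
        ... | i , j , i<j , e with proper i (λ p → none (i , p)) | proper j (λ p → none (j , p))
        ...   | u , p , eᵢ , ru | u′ , p′ , eⱼ , ru′ =
          same-first (Finₚ.<⇒≢ i<j) eᵢ eⱼ (leg-of-inj {r} {u} {p} {u′} {p′} ru ru′ (trans (cong (leg-of r) (sym eᵢ)) (trans e (cong (leg-of r) eⱼ))))

    module FewLeaves (few : AtMostThreeLeavesPerComponent H) where

      private
        four-leaves : ∀ {c} l₀ l₁ l₂ l₃ → Leaf H l₀ → Leaf H l₁ → Leaf H l₂ → Leaf H l₃ →
          Reach H c l₀ → Reach H c l₁ → Reach H c l₂ → Reach H c l₃ →
          l₀ ≢ l₁ → l₀ ≢ l₂ → l₀ ≢ l₃ → l₁ ≢ l₂ → l₁ ≢ l₃ → l₂ ≢ l₃ → ⊥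
        four-leaves {c} l₀ l₁ l₂ l₃ f₀ f₁ f₂ f₃ r₀ r₁ r₂ r₃ n₀₁ n₀₂ n₀₃ n₁₂ n₁₃ n₂₃ =
          few (lookup ls , lookup-unique u , leaf , λ i j → reach-trans (reach-sym (reach i)) (reach j))
          where
          ls = l₀ ∷ l₁ ∷ l₂ ∷ l₃ ∷ []
          u : Unique ls
          u = (n₀₁ ∷ n₀₂ ∷ n₀₃ ∷ []) ∷ (n₁₂ ∷ n₁₃ ∷ []) ∷ (n₂₃ ∷ []) ∷ [] ∷ []
          leaf : ∀ i → Leaf H (lookup ls i)
          leaf zero = f₀
          leaf (suc zero) = f₁
          leaf (suc (suc zero)) = f₂
          leaf (suc (suc (suc zero))) = f₃
          reach : ∀ i → Reach H c (lookup ls i)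
          reach zero = r₀
          reach (suc zero) = r₁
          reach (suc (suc zero)) = r₂
          reach (suc (suc (suc zero))) = r₃

        ends-differ : ∀ {c u p u′ p′} → NonBack (c ∷ u ∷ p) → NonBack (c ∷ u′ ∷ p′) → u ≢ u′ → endOf u p ≢ endOf u′ p′
        ends-differ {u = u} {p} {u′} {p′} w w′ ne e = rays-disjoint w w′ ne (endOf∈ u p) (subst (_∈ u′ ∷ p′) (sym e) (endOf∈ u′ p′))

        two-away : ∀ {c} t → Deg3 c → ∃₂ λ a b → c ~ a × c ~ b × a ≢ b × t ≢ a × t ≢ b
        two-away t (deg3 {a} {b} {d} ea eb ed a≢b a≢d b≢d) with t ≟ a | t ≟ b
        ... | yes refl | _ = b , d , eb , ed , b≢d , a≢b , a≢d
        ... | no t≢a | yes refl = a , d , ea , ed , a≢d , t≢a , b≢d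
        ... | no t≢a | no t≢b = a , b , ea , eb , a≢b , t≢a , t≢b

      no-four : ∀ {c} → length (neighbours c) ≤ 3
      no-four {c} = ≮⇒≥ λ lt → go (neighbours c) (neighbours-unique c) ∈-neighbours⁻ lt
        where
        go : ∀ l → Unique l → (∀ {u} → u ∈ l → c ~ u) → 3 < length l → ⊥
        go (x₀ ∷ x₁ ∷ x₂ ∷ x₃ ∷ _) ((n₀₁ ∷ n₀₂ ∷ n₀₃ ∷ _) ∷ (n₁₂ ∷ n₁₃ ∷ _) ∷ (n₂₃ ∷ _) ∷ _) e _
          with ray-to-leaf (e (here refl)) | ray-to-leaf (e (there (here refl)))
             | ray-to-leaf (e (there (there (here refl)))) | ray-to-leaf (e (there (there (there (here refl)))))
        ... | p₀ , w₀ , f₀ | p₁ , w₁ , f₁ | p₂ , w₂ , f₂ | p₃ , w₃ , f₃ =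
          four-leaves {c} _ _ _ _ f₀ f₁ f₂ f₃ (nb⇒reach c _ w₀) (nb⇒reach c _ w₁) (nb⇒reach c _ w₂) (nb⇒reach c _ w₃)
            (ends-differ w₀ w₁ n₀₁) (ends-differ w₀ w₂ n₀₂) (ends-differ w₀ w₃ n₀₃) (ends-differ w₁ w₂ n₁₂) (ends-differ w₁ w₃ n₁₃) (ends-differ w₂ w₃ n₂₃)
        go [] _ _ ()
        go (_ ∷ []) _ _ (s≤s ())
        go (_ ∷ _ ∷ []) _ _ (s≤s (s≤s ()))
        go (_ ∷ _ ∷ _ ∷ []) _ _ (s≤s (s≤s (s≤s ())))

      -- From each of two branching vertices, two rays lead away from the other one. In a forest
      -- their four ends are distinct leaves of one component.
      one-branching : ∀ {c c′} → Deg3 c → Deg3 c′ → Reach H c c′ → c ≡ c′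
      one-branching {c} {c′} d d′ r with reach⇒nb r
      ... | [] , _ , e = e
      ... | u ∷ p , w , refl with two-away u d | two-away (beforeEnd c u p) d′
      ...   | a , b , ca , cb , a≢b , u≢a , u≢b | a′ , b′ , ca′ , cb′ , a′≢b′ , t≢a′ , t≢b′
        with ray-to-leaf ca | ray-to-leaf cb | ray-to-leaf ca′ | ray-to-leaf cb′
      ...     | A , wA , fA | B , wB , fB | A′ , wA′ , fA′ | B′ , wB′ , fB′ = ⊥-elim
        (four-leaves {c} _ _ _ _ fA fB fA′ fB′ (nb⇒reach c _ wA) (nb⇒reach c _ wB)
          (reach-trans (nb⇒reach c _ w) (nb⇒reach _ _ wA′)) (reach-trans (nb⇒reach c _ w) (nb⇒reach _ _ wB′))
          (ends-differ wA wB a≢b) (far wA u≢a wA′ t≢a′) (far wA u≢a wB′ t≢b′) (far wB u≢b wA′ t≢a′) (far wB u≢b wB′ t≢b′) (ends-differ wA′ wB′ a′≢b′))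
        where
        far : ∀ {x X y Y} → NonBack (c ∷ x ∷ X) → u ≢ x → NonBack (endOf u p ∷ y ∷ Y) → beforeEnd c u p ≢ y → endOf x X ≢ endOf y Y
        far {x} {X} {y} {Y} wX u≢x wY t≢y e = ends-differ wX (nb-append p w wY t≢y) (≢-sym u≢x) (trans e (sym (endOf-++′ u p y Y)))

  coordinates : InS H → Coord H
  coordinates (forest , few) = Local.coord no-four one-branching
    where
    open Acyclic forest
    open FewLeaves few

-- Sparse graphs of large clique-width

-- The rows (i , i) are long paths. For i ≢ j the line (i , j) is a long path that joins row i to row j; its ends
-- are attached at the positions out j and inn i of the rows. Attachments are multiples of D = E + E.
module Host (N E : ℕ) (0<E : 0 < E) where

  D L : ℕ
  D = E + E
  L = suc ((2 * N + 2) * D)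

  Vertex : Set
  Vertex = Fin N × Fin N × Fin L

  -- Outgoing lines use odd multiples of `D` and incoming lines even ones, so no row vertex carries
  -- two attachments. The largest is at most 2N times `D`, below the end of a row.
  out inn : Fin N → ℕ
  out j = suc (2 * toℕ j) * D
  inn i = suc (suc (2 * toℕ i)) * D

  data Adj : Vertex → Vertex → Set where
    up   : ∀ {i j p p′} → suc (toℕ p) ≡ toℕ p′ → Adj (i , j , p) (i , j , p′)
    down : ∀ {i j p p′} → toℕ p ≡ suc (toℕ p′) → Adj (i , j , p) (i , j , p′)
    out0 : ∀ {i j p s} → i ≢ j → toℕ p ≡ 0 → toℕ s ≡ out j → Adj (i , j , p) (i , i , s)
    outL : ∀ {i j p s} → i ≢ j → suc (toℕ p) ≡ L → toℕ s ≡ inn i → Adj (i , j , p) (j , j , s)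
    in0  : ∀ {i j p s} → i ≢ j → toℕ p ≡ 0 → toℕ s ≡ out j → Adj (i , i , s) (i , j , p)
    inL  : ∀ {i j p s} → i ≢ j → suc (toℕ p) ≡ L → toℕ s ≡ inn i → Adj (j , j , s) (i , j , p)

  Adj-sym : ∀ {u v} → Adj u v → Adj v u
  Adj-sym (up e) = down (sym e)
  Adj-sym (down e) = up (sym e)
  Adj-sym (out0 a b c) = in0 a b c
  Adj-sym (outL a b c) = inL a b c
  Adj-sym (in0 a b c) = out0 a b c
  Adj-sym (inL a b c) = outL a b c

  0<D : 0 < D
  0<D = ≤-trans 0<E (m≤m+n E E)

  private
    Step Out In : Vertex → Vertex → Set
    Step (i , j , p) (i′ , j′ , p′) = i ≡ i′ × j ≡ j′ × suc (toℕ p) ≡ toℕ p′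
    Out (i , j , p) (i′ , j′ , s) = i ≢ j × i ≡ i′ × i ≡ j′ × toℕ p ≡ 0 × toℕ s ≡ out j
    In (i , j , p) (i′ , j′ , s) = i ≢ j × j ≡ i′ × j ≡ j′ × suc (toℕ p) ≡ L × toℕ s ≡ inn i

    step? : ∀ u v → Dec (Step u v)
    step? (i , j , p) (i′ , j′ , p′) = (i ≟ i′) ×-dec (j ≟ j′) ×-dec (suc (toℕ p) ℕₚ.≟ toℕ p′)
    out? : ∀ u v → Dec (Out u v)
    out? (i , j , p) (i′ , j′ , s) = ¬? (i ≟ j) ×-dec (i ≟ i′) ×-dec (i ≟ j′) ×-dec (toℕ p ℕₚ.≟ 0) ×-dec (toℕ s ℕₚ.≟ out j)
    in? : ∀ u v → Dec (In u v)
    in? (i , j , p) (i′ , j′ , s) = ¬? (i ≟ j) ×-dec (j ≟ i′) ×-dec (j ≟ j′) ×-dec (suc (toℕ p) ℕₚ.≟ L) ×-dec (toℕ s ℕₚ.≟ inn i)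

    Half : Vertex → Vertex → Set
    Half u v = Step u v ⊎ Out u v ⊎ In u v

    half⇒Adj : ∀ u v → Half u v → Adj u v
    half⇒Adj _ _ (inj₁ (refl , refl , e)) = up e
    half⇒Adj _ _ (inj₂ (inj₁ (a , refl , refl , b , c))) = out0 a b c
    half⇒Adj _ _ (inj₂ (inj₂ (a , refl , refl , b , c))) = outL a b c

    Adj⇒half : ∀ {u v} → Adj u v → Half u v ⊎ Half v u
    Adj⇒half (up e) = inj₁ (inj₁ (refl , refl , e))
    Adj⇒half (down e) = inj₂ (inj₁ (refl , refl , sym e))
    Adj⇒half (out0 a b c) = inj₁ (inj₂ (inj₁ (a , refl , refl , b , c)))
    Adj⇒half (outL a b c) = inj₁ (inj₂ (inj₂ (a , refl , refl , b , c)))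
    Adj⇒half (in0 a b c) = inj₂ (inj₂ (inj₁ (a , refl , refl , b , c)))
    Adj⇒half (inL a b c) = inj₂ (inj₂ (inj₂ (a , refl , refl , b , c)))

    half? : ∀ u v → Dec (Half u v)
    half? u v = step? u v ⊎-dec out? u v ⊎-dec in? u v

  abstract
    Adj? : ∀ u v → Dec (Adj u v)
    Adj? u v = map′ [ half⇒Adj u v , (λ h → Adj-sym (half⇒Adj v u h)) ]′ Adj⇒half (half? u v ⊎-dec half? v u)

  private
    multiple-inj : ∀ {a b} → a * D ≡ b * D → a ≡ b
    multiple-inj {a} {b} e = *-cancelʳ-≡ a b D {{>-nonZero 0<D}} e

    odd-double : ∀ x → odd (x + x) ≡ false
    odd-double zero = refl
    odd-double (suc x) = trans (cong (not ∘ odd) (+-suc x x)) (trans (Boolₚ.not-involutive _) (odd-double x))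

    odd-multiple : ∀ a → odd (a * D) ≡ false
    odd-multiple a = trans (cong odd (*-distribˡ-+ a E E)) (odd-double (a * E))

    ≡-vertex : ∀ {i j : Fin N} {p p′ : Fin L} → toℕ p ≡ toℕ p′ → (i , j , p) ≡ (i , j , p′)
    ≡-vertex {i} {j} e = cong (λ p → i , j , p) (toℕ-injective e)

    out≢inn : ∀ {j i} → out j ≢ inn i
    out≢inn {j} {i} e = case trans (sym (odd-2 (suc (2 * toℕ j)) (toℕ j) refl)) (trans (cong odd (multiple-inj {suc (2 * toℕ j)} {suc (suc (2 * toℕ i))} e)) (even (toℕ i))) of λ ()
      where
      odd-2 : ∀ k x → k ≡ suc (2 * x) → odd k ≡ true
      odd-2 _ x refl = cong not (trans (cong (λ y → odd (x + y)) (+-identityʳ x)) (odd-double x))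
      even : ∀ x → odd (suc (suc (2 * x))) ≡ false
      even x = trans (Boolₚ.not-involutive _) (trans (cong (λ y → odd (x + y)) (+-identityʳ x)) (odd-double x))

    out-inj : ∀ {j j′} → out j ≡ out j′ → j ≡ j′
    out-inj {j} {j′} e = toℕ-injective (*-cancelˡ-≡ (toℕ j) (toℕ j′) 2 (suc-injective (multiple-inj {suc (2 * toℕ j)} {suc (2 * toℕ j′)} e)))

    inn-inj : ∀ {i i′} → inn i ≡ inn i′ → i ≡ i′
    inn-inj {i} {i′} e = toℕ-injective (*-cancelˡ-≡ (toℕ i) (toℕ i′) 2 (suc-injective (suc-injective (multiple-inj {suc (suc (2 * toℕ i))} {suc (suc (2 * toℕ i′))} e))))

    0≢L : ∀ {x} → x ≡ 0 → suc x ≢ L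
    0≢L refl e = <⇒≢ (≤-trans 0<D (≤-trans (m≤m+n D _) (≤-reflexive (cong (_* D) (+-comm 2 (2 * N)))))) (suc-injective e)

  -- The three ports of a vertex: its successor and its predecessor on the line, and one attachment.
  -- By `tag-inj` the host has maximum degree at most three.
  tag : ∀ {u v} → Adj u v → Fin 3
  tag (up _) = zero
  tag (down _) = suc zero
  tag _ = suc (suc zero)

  tag-inj : ∀ {u v w} (a : Adj u v) (b : Adj u w) → tag a ≡ tag b → v ≡ w
  tag-inj (up e) (up e′) _ = ≡-vertex (trans (sym e) e′)
  tag-inj (down e) (down e′) _ = ≡-vertex (suc-injective (trans (sym e) e′))
  tag-inj (out0 _ _ c) (out0 _ _ c′) _ = ≡-vertex (trans c (sym c′))
  tag-inj (out0 _ b _) (outL _ b′ _) _ = ⊥-elim (0≢L b b′)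
  tag-inj (out0 a _ _) (in0 _ _ _) _ = ⊥-elim (a refl)
  tag-inj (out0 a _ _) (inL _ _ _) _ = ⊥-elim (a refl)
  tag-inj (outL _ b _) (out0 _ b′ _) _ = ⊥-elim (0≢L b′ b)
  tag-inj (outL _ _ c) (outL _ _ c′) _ = ≡-vertex (trans c (sym c′))
  tag-inj (outL a _ _) (in0 _ _ _) _ = ⊥-elim (a refl)
  tag-inj (outL a _ _) (inL _ _ _) _ = ⊥-elim (a refl)
  tag-inj (in0 _ _ _) (out0 a _ _) _ = ⊥-elim (a refl)
  tag-inj (in0 _ _ _) (outL a _ _) _ = ⊥-elim (a refl)
  tag-inj (in0 {i} {j} _ b c) (in0 {j = j′} _ b′ c′) _ with out-inj {j} {j′} (trans (sym c) c′)
  ... | refl = ≡-vertex (trans b (sym b′))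
  tag-inj (in0 {j = j} _ _ c) (inL {i = i} _ _ c′) _ = ⊥-elim (out≢inn {j} {i} (trans (sym c) c′))
  tag-inj (inL _ _ _) (out0 a _ _) _ = ⊥-elim (a refl)
  tag-inj (inL _ _ _) (outL a _ _) _ = ⊥-elim (a refl)
  tag-inj (inL {i = i} _ _ c) (in0 {j = j} _ _ c′) _ = ⊥-elim (out≢inn {j} {i} (trans (sym c′) c))
  tag-inj (inL {i} {j} _ b c) (inL {i = i′} _ b′ c′) _ with inn-inj {i} {i′} (trans (sym c) c′)
  ... | refl = ≡-vertex (suc-injective (trans b (sym b′)))
  tag-inj (up _) (down _) ()
  tag-inj (up _) (out0 _ _ _) ()
  tag-inj (up _) (outL _ _ _) ()
  tag-inj (up _) (in0 _ _ _) ()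
  tag-inj (up _) (inL _ _ _) ()
  tag-inj (down _) (up _) ()
  tag-inj (down _) (out0 _ _ _) ()
  tag-inj (down _) (outL _ _ _) ()
  tag-inj (down _) (in0 _ _ _) ()
  tag-inj (down _) (inL _ _ _) ()
  tag-inj (out0 _ _ _) (up _) ()
  tag-inj (out0 _ _ _) (down _) ()
  tag-inj (outL _ _ _) (up _) ()
  tag-inj (outL _ _ _) (down _) ()
  tag-inj (in0 _ _ _) (up _) ()
  tag-inj (in0 _ _ _) (down _) ()
  tag-inj (inL _ _ _) (up _) ()
  tag-inj (inL _ _ _) (down _) ()

  -- Both ends of a line and all attachment positions are even, because `D` is even. Reversing the
  -- colours on the joining lines therefore makes the attaching edges proper.
  colour : Vertex → Bool
  colour (i , j , p) = if ⌊ i ≟ j ⌋ then odd (toℕ p) else not (odd (toℕ p))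

  private
    colour-row : ∀ i s → colour (i , i , s) ≡ odd (toℕ s)
    colour-row i s with i ≟ i
    ... | yes _ = refl
    ... | no p = ⊥-elim (p refl)

    colour-link : ∀ {i j} p → i ≢ j → colour (i , j , p) ≡ not (odd (toℕ p))
    colour-link {i} {j} p ne with i ≟ j
    ... | yes q = ⊥-elim (ne q)
    ... | no _ = refl

    colour-step : ∀ {i j p p′} → suc (toℕ p) ≡ toℕ p′ → colour (i , j , p) ≢ colour (i , j , p′)
    colour-step {i} {j} {p} {p′} e c with i ≟ j
    ... | yes _ = Boolₚ.not-¬ {odd (toℕ p)} refl (trans c (cong odd (sym e)))
    ... | no _ = Boolₚ.not-¬ {not (odd (toℕ p))} refl (trans c (cong (not ∘ odd) (sym e)))

    colour-end : ∀ {i j r} p s a → i ≢ j → odd (toℕ p) ≡ false → toℕ s ≡ a * D → colour (i , j , p) ≢ colour (r , r , s)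
    colour-end {r = r} p s a ne e e′ c = case trans (sym (cong not e)) (trans (sym (colour-link p ne)) (trans c (trans (colour-row r s) (trans (cong odd e′) (odd-multiple a))))) of λ ()

    odd-last : ∀ x → suc x ≡ L → odd x ≡ false
    odd-last _ refl = odd-multiple (2 * N + 2)

  colour-proper : ∀ {u v} → Adj u v → colour u ≢ colour v
  colour-proper (up {p = p} {p′} e) = colour-step {p = p} {p′} e
  colour-proper (down {p = p} {p′} e) c = colour-step {p = p′} {p} (sym e) (sym c)
  colour-proper (out0 {j = j} {p} {s} a b c) = colour-end p s (suc (2 * toℕ j)) a (cong odd b) c
  colour-proper (outL {i = i} {p = p} {s} a b c) = colour-end p s (suc (suc (2 * toℕ i))) a (odd-last (toℕ p) b) c
  colour-proper (in0 {j = j} {p} {s} a b c) e = colour-end p s (suc (2 * toℕ j)) a (cong odd b) c (sym e)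
  colour-proper (inL {i = i} {p = p} {s} a b c) e = colour-end p s (suc (suc (2 * toℕ i))) a (odd-last (toℕ p) b) c (sym e)

  -- All multiples of `D` on rows, whether or not a line is attached there. They include every
  -- vertex of degree three, and the regular spacing keeps distances between them simple.
  Base : Vertex → Set
  Base (i , j , p) = i ≡ j × ∃ λ a → toℕ p ≡ a * D

  -- Dir k u v: the edge from u to v is the k-th one on its way from a base vertex.
  data Dir (k : ℕ) : Vertex → Vertex → Set where
    row↑  : ∀ {i p p′} a → toℕ p′ ≡ a * D + k → suc (toℕ p) ≡ toℕ p′ → Dir k (i , i , p) (i , i , p′)
    row↓  : ∀ {i p p′} a → toℕ p′ + k ≡ a * D → toℕ p ≡ suc (toℕ p′) → Dir k (i , i , p) (i , i , p′)
    link↑ : ∀ {i j p p′} → i ≢ j → suc (toℕ p′) ≡ k → suc (toℕ p) ≡ toℕ p′ → Dir k (i , j , p) (i , j , p′)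
    link↓ : ∀ {i j p p′} → i ≢ j → toℕ p′ + k ≡ L → toℕ p ≡ suc (toℕ p′) → Dir k (i , j , p) (i , j , p′)
    in↑   : ∀ {i j s p} → i ≢ j → toℕ p ≡ 0 → toℕ s ≡ out j → k ≡ 1 → Dir k (i , i , s) (i , j , p)
    in↓   : ∀ {i j s p} → i ≢ j → suc (toℕ p) ≡ L → toℕ s ≡ inn i → k ≡ 1 → Dir k (j , j , s) (i , j , p)

  private
    between : ∀ {k a b x} → 0 < k → k < D → x ≡ a * D + k → x ≡ b * D → ⊥
    between {k} {a} {b} pos lt e e′ with <-cmp a b
    ... | tri< a<b _ _ = <⇒≢ (<-≤-trans (+-monoʳ-< (a * D) lt) (≤-trans (≤-reflexive (+-comm (a * D) D)) (*-monoˡ-≤ D a<b))) (trans (sym e) e′)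
    ... | tri≈ _ refl _ = <⇒≢ (m<m+n (a * D) pos) (trans (sym e′) e)
    ... | tri> _ _ b<a = <⇒≢ (≤-<-trans (*-monoˡ-≤ D (<⇒≤ b<a)) (m<m+n (a * D) pos)) (trans (sym e′) e)

    between′ : ∀ {k a b x} → 0 < k → k < D → x + k ≡ a * D → x ≡ b * D → ⊥
    between′ {k} {a} {b} pos lt e e′ = between {k} {b} {a} pos lt (trans (sym e) (cong (_+ k) e′)) refl

    D<L : D < L
    D<L = s≤s (≤-trans (m≤m+n D _) (≤-reflexive (cong (_* D) (+-comm 2 (2 * N)))))

  -- Together with `dir-start` and `dir-next` this shows that a non-backtracking walk which leaves a
  -- base vertex meets no base vertex during its next `D ∸ 1` steps.
  dir-base : ∀ {k u v} → 0 < k → k < D → Dir k u v → ¬ Base v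
  dir-base pos lt (row↑ a e _) (_ , b , e′) = between {a = a} {b} pos lt e e′
  dir-base pos lt (row↓ a e _) (_ , b , e′) = between′ {a = a} {b} pos lt e e′
  dir-base pos lt (link↑ ne _ _) (e , _) = ne e
  dir-base pos lt (link↓ ne _ _) (e , _) = ne e
  dir-base pos lt (in↑ ne _ _ _) (e , _) = ne e
  dir-base pos lt (in↓ ne _ _ _) (e , _) = ne e

  dir-start : ∀ {u v} → Base u → Adj u v → Dir 1 u v
  dir-start (refl , a , e) (up e′) = row↑ a (trans (sym e′) (trans (cong suc e) (+-comm 1 _))) e′
  dir-start (refl , a , e) (down e′) = row↓ a (trans (+-comm _ 1) (trans (sym e′) e)) e′
  dir-start (refl , _) (out0 ne _ _) = ⊥-elim (ne refl)
  dir-start (refl , _) (outL ne _ _) = ⊥-elim (ne refl)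
  dir-start _ (in0 a b c) = in↑ a b c refl
  dir-start _ (inL a b c) = in↓ a b c refl

  dir-next : ∀ {k u v w} → 0 < k → k < D → Dir k u v → Adj v w → w ≢ u → Dir (suc k) v w
  dir-next pos lt (row↑ a e e′) (up f) _ = row↑ a (trans (sym f) (trans (cong suc e) (sym (+-suc _ _)))) f
  dir-next pos lt (row↑ a e e′) (down f) ne = ⊥-elim (ne (≡-vertex (suc-injective (trans (sym f) (sym e′)))))
  dir-next pos lt (row↑ a e e′) (out0 ne _ _) _ = ⊥-elim (ne refl)
  dir-next pos lt (row↑ a e e′) (outL ne _ _) _ = ⊥-elim (ne refl)
  dir-next pos lt (row↑ a e e′) (in0 {j = j} _ _ c) _ = ⊥-elim (between {a = a} {suc (2 * toℕ j)} pos lt e c)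
  dir-next pos lt (row↑ a e e′) (inL {i = i} _ _ c) _ = ⊥-elim (between {a = a} {suc (suc (2 * toℕ i))} pos lt e c)
  dir-next pos lt (row↓ a e e′) (down f) _ = row↓ a (trans (+-suc _ _) (trans (cong (_+ _) (sym f)) e)) f
  dir-next pos lt (row↓ a e e′) (up f) ne = ⊥-elim (ne (≡-vertex (trans (sym f) (sym e′))))
  dir-next pos lt (row↓ a e e′) (out0 ne _ _) _ = ⊥-elim (ne refl)
  dir-next pos lt (row↓ a e e′) (outL ne _ _) _ = ⊥-elim (ne refl)
  dir-next pos lt (row↓ a e e′) (in0 {j = j} _ _ c) _ = ⊥-elim (between′ {a = a} {suc (2 * toℕ j)} pos lt e c)
  dir-next pos lt (row↓ a e e′) (inL {i = i} _ _ c) _ = ⊥-elim (between′ {a = a} {suc (suc (2 * toℕ i))} pos lt e c)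
  dir-next pos lt (link↑ ne e e′) (up f) _ = link↑ ne (cong suc (trans (sym f) e)) f
  dir-next pos lt (link↑ ne e e′) (down f) n = ⊥-elim (n (≡-vertex (suc-injective (trans (sym f) (sym e′)))))
  dir-next pos lt (link↑ ne e e′) (out0 _ b _) _ = case trans e′ b of λ ()
  dir-next pos lt (link↑ ne e e′) (outL _ b _) _ = ⊥-elim (<⇒≢ (<-trans lt D<L) (trans (sym e) b))
  dir-next pos lt (link↑ ne e e′) (in0 _ _ _) _ = ⊥-elim (ne refl)
  dir-next pos lt (link↑ ne e e′) (inL _ _ _) _ = ⊥-elim (ne refl)
  dir-next pos lt (link↓ ne e e′) (down f) _ = link↓ ne (trans (+-suc _ _) (trans (cong (_+ _) (sym f)) e)) f
  dir-next pos lt (link↓ ne e e′) (up f) n = ⊥-elim (n (≡-vertex (trans (sym f) (sym e′))))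
  dir-next {k} pos lt (link↓ ne e e′) (out0 _ b _) _ = ⊥-elim (<⇒≢ (<-trans lt D<L) (trans (cong (_+ k) (sym b)) e))
  dir-next pos lt (link↓ {p = p} ne e e′) (outL _ b _) _ = ⊥-elim (<⇒≢ (toℕ<n p) (trans e′ b))
  dir-next pos lt (link↓ ne e e′) (in0 _ _ _) _ = ⊥-elim (ne refl)
  dir-next pos lt (link↓ ne e e′) (inL _ _ _) _ = ⊥-elim (ne refl)
  dir-next pos lt (in↑ ne b c refl) (up f) _ = link↑ ne (cong suc (trans (sym f) (cong suc b))) f
  dir-next pos lt (in↑ ne b c refl) (down f) _ = case trans (sym b) f of λ ()
  dir-next pos lt (in↑ ne b c refl) (out0 _ _ c′) n = ⊥-elim (n (≡-vertex (trans c′ (sym c))))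
  dir-next pos lt (in↑ ne b c refl) (outL _ b′ _) _ = ⊥-elim (0≢L b b′)
  dir-next pos lt (in↑ ne b c refl) (in0 _ _ _) _ = ⊥-elim (ne refl)
  dir-next pos lt (in↑ ne b c refl) (inL _ _ _) _ = ⊥-elim (ne refl)
  dir-next pos lt (in↓ {p = p} ne b c refl) (up {p′ = p′} f) _ = ⊥-elim (<⇒≢ (toℕ<n p′) (trans (sym f) b))
  dir-next pos lt (in↓ ne b c refl) (down f) _ = link↓ ne (trans (+-comm _ 2) (trans (cong suc (sym f)) b)) f
  dir-next pos lt (in↓ ne b c refl) (out0 _ b′ _) _ = ⊥-elim (0≢L b′ b)
  dir-next pos lt (in↓ ne b c refl) (outL _ _ c′) n = ⊥-elim (n (≡-vertex (trans c′ (sym c))))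
  dir-next pos lt (in↓ ne b c refl) (in0 _ _ _) _ = ⊥-elim (ne refl)
  dir-next pos lt (in↓ ne b c refl) (inL _ _ _) _ = ⊥-elim (ne refl)

  position : Vertex → ℕ
  position (_ , _ , p) = toℕ p

  data Climb : Vertex → Vertex → Set where
    climb : ∀ {i j p p′} → suc (toℕ p) ≡ toℕ p′ → Climb (i , j , p) (i , j , p′)

  plain-edge : ∀ {u v} → ¬ Base u → ¬ Base v → Adj u v → Climb u v ⊎ Climb v u
  plain-edge _ _ (up e) = inj₁ (climb e)
  plain-edge _ _ (down e) = inj₂ (climb (sym e))
  plain-edge _ nb (out0 {j = j} _ _ c) = ⊥-elim (nb (refl , suc (2 * toℕ j) , c))
  plain-edge _ nb (outL {i = i} _ _ c) = ⊥-elim (nb (refl , suc (suc (2 * toℕ i)) , c))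
  plain-edge nb _ (in0 {j = j} _ _ c) = ⊥-elim (nb (refl , suc (2 * toℕ j) , c))
  plain-edge nb _ (inL {i = i} _ _ c) = ⊥-elim (nb (refl , suc (suc (2 * toℕ i)) , c))

  climb-unique : ∀ {u v w} → Climb u v → Climb w v → u ≡ w
  climb-unique (climb e) (climb e′) = ≡-vertex (suc-injective (trans e (sym e′)))

  climb-unique′ : ∀ {u v w} → Climb u v → Climb u w → v ≡ w
  climb-unique′ (climb e) (climb e′) = ≡-vertex (trans (sym e) e′)

  -- The two directions along a line, with the attaching edges at its ends counted as continuations.
  -- For a vertex that is not a base vertex, `side-inj` leaves at most two neighbours.
  side : ∀ {u v} → Adj u v → Bool
  side (up _) = true
  side (down _) = false
  side (out0 _ _ _) = false
  side (outL _ _ _) = true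
  side (in0 _ _ _) = true
  side (inL _ _ _) = true

  side-inj : ∀ {u v w} → ¬ Base u → (a : Adj u v) (b : Adj u w) → side a ≡ side b → v ≡ w
  side-inj nb a b e with tag a ≟ tag b
  ... | yes t = tag-inj a b t
  side-inj nb (in0 {j = j} _ _ c) b e | no t = ⊥-elim (nb (refl , suc (2 * toℕ j) , c))
  side-inj nb (inL {i = i} _ _ c) b e | no t = ⊥-elim (nb (refl , suc (suc (2 * toℕ i)) , c))
  side-inj nb a (in0 {j = j} _ _ c) e | no t = ⊥-elim (nb (refl , suc (2 * toℕ j) , c))
  side-inj nb a (inL {i = i} _ _ c) e | no t = ⊥-elim (nb (refl , suc (suc (2 * toℕ i)) , c))
  side-inj nb (up _) (up _) e | no t = ⊥-elim (t refl)
  side-inj nb (down _) (down _) e | no t = ⊥-elim (t refl)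
  side-inj nb (up {p′ = p′} e′) (outL _ b _) e | no t = ⊥-elim (<⇒≢ (toℕ<n p′) (trans (sym e′) b))
  side-inj nb (outL _ b _) (up {p′ = p′} e′) e | no t = ⊥-elim (<⇒≢ (toℕ<n p′) (trans (sym e′) b))
  side-inj nb (down e′) (out0 _ b _) e | no t = case trans (sym b) e′ of λ ()
  side-inj nb (out0 _ b _) (down e′) e | no t = case trans (sym b) e′ of λ ()
  side-inj nb (out0 _ _ _) (out0 _ _ _) e | no t = ⊥-elim (t refl)
  side-inj nb (outL _ _ _) (outL _ _ _) e | no t = ⊥-elim (t refl)
  side-inj nb (up _) (down _) () | no t
  side-inj nb (up _) (out0 _ _ _) () | no t
  side-inj nb (down _) (up _) () | no t
  side-inj nb (down _) (outL _ _ _) () | no t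
  side-inj nb (out0 _ _ _) (up _) () | no t
  side-inj nb (out0 _ _ _) (outL _ _ _) () | no t
  side-inj nb (outL _ _ _) (down _) () | no t
  side-inj nb (outL _ _ _) (out0 _ _ _) () | no t

  Base? : ∀ v → Dec (Base v)
  Base? (i , j , p) = (i ≟ j) ×-dec map′ (λ (divides a e) → a , e) (λ (a , e) → divides a e) (D ∣? toℕ p)

  order : ℕ
  order = N * (N * L)

  abstract
    decode : Fin order → Vertex
    decode x = let (i , y) = remQuot (N * L) x in i , remQuot L y

    encode : Vertex → Fin order
    encode (i , j , p) = combine i (combine j p)

    decode-encode : ∀ v → decode (encode v) ≡ v
    decode-encode (i , j , p) = trans (cong (λ (i , y) → i , remQuot L y) (remQuot-combine i (combine j p)))
      (cong (i ,_) (remQuot-combine j p))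

    encode-decode : ∀ x → encode (decode x) ≡ x
    encode-decode x = trans (cong (combine (proj₁ (remQuot {N} (N * L) x))) (combine-remQuot {N} L (proj₂ (remQuot {N} (N * L) x)))) (combine-remQuot {N} (N * L) x)

  decode-inj : ∀ {x y} → decode x ≡ decode y → x ≡ y
  decode-inj {x} {y} e = trans (sym (encode-decode x)) (trans (cong encode e) (encode-decode y))

  abstract
    host : Graph order
    host = record
      { adj = λ x y → ⌊ Adj? (decode x) (decode y) ⌋
      ; sym = λ x y → iff (Adj? (decode x) (decode y)) (Adj? (decode y) (decode x)) Adj-sym Adj-sym
      ; irrefl = λ x → none (Adj? (decode x) (decode x)) λ a → colour-proper a refl }
      where
      iff : ∀ {P Q : Set} (p : Dec P) (q : Dec Q) → (P → Q) → (Q → P) → ⌊ p ⌋ ≡ ⌊ q ⌋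
      iff (yes _) (yes _) _ _ = refl
      iff (no _) (no _) _ _ = refl
      iff (yes p) (no q) f _ = ⊥-elim (q (f p))
      iff (no p) (yes q) _ g = ⊥-elim (p (g q))
      none : ∀ {P : Set} (p : Dec P) → ¬ P → ⌊ p ⌋ ≡ false
      none (yes p) np = ⊥-elim (np p)
      none (no _) _ = refl

    host⁻ : ∀ {x y} → adj host x y ≡ true → Adj (decode x) (decode y)
    host⁻ {x} {y} e with Adj? (decode x) (decode y)
    ... | yes a = a
    host⁻ () | no _

    host⁺ : ∀ {x y} → Adj (decode x) (decode y) → adj host x y ≡ true
    host⁺ {x} {y} a with Adj? (decode x) (decode y)
    ... | yes _ = refl
    ... | no n = ⊥-elim (n a)

  host-bipartite : Bipartite host
  host-bipartite = colour ∘ decode , λ _ _ e → colour-proper (host⁻ e)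

  -- Small subgraphs of the host

  module Subgraph {m : ℕ} (H : Graph m) (m<D : suc m < D) (e : Emb H host) where

    private
      V = Fin m
      at : V → Vertex
      at v = decode (fn e v)
      at-inj : ∀ {u v} → at u ≡ at v → u ≡ v
      at-inj p = inj e (decode-inj p)
      edge : ∀ {u v} → adj H u v ≡ true → Adj (at u) (at v)
      edge p = host⁻ (hom e p)

    no-four : ∀ {c} → length (neighbours H c) ≤ 3
    no-four {c} = injective⇒≤ {f = λ i → tag (edge {c} (∈-neighbours⁻ H (∈-lookup i)))} λ {i} {j} q →
      lookup-unique (neighbours-unique H c) (at-inj (tag-inj (edge (∈-neighbours⁻ H (∈-lookup i))) (edge (∈-neighbours⁻ H (∈-lookup j))) q))

    branching-base : ∀ {c} → Deg3 H c → Base (at c)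
    branching-base {c} (deg3 e₁ e₂ e₃ n₁₂ n₁₃ n₂₃) with Base? (at c)
    ... | yes b = b
    ... | no nb = ⊥-elim (pigeon (side (edge e₁)) (side (edge e₂)) (side (edge e₃))
        (n₁₂ ∘ at-inj ∘ side-inj nb (edge e₁) (edge e₂)) (n₁₃ ∘ at-inj ∘ side-inj nb (edge e₁) (edge e₃)) (n₂₃ ∘ at-inj ∘ side-inj nb (edge e₂) (edge e₃)))
      where
      pigeon : ∀ a b c → a ≢ b → a ≢ c → b ≢ c → ⊥
      pigeon true true _ p _ _ = p refl
      pigeon false false _ p _ _ = p refl
      pigeon true false true _ p _ = p refl
      pigeon false true false _ p _ = p refl
      pigeon true false false _ _ p = p refl
      pigeon false true true _ _ p = p refl

    module Cyclic (z : ℕ → V) (z~ : ∀ k → adj H (z k) (z (suc k)) ≡ true) (z≢ : ∀ k → z k ≢ z (suc (suc k))) where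

      private
        a : ℕ → Vertex
        a k = at (z k)

        -- Without its base vertices the host is a disjoint union of paths, and a walk on a path
        -- that never turns back keeps its direction. Positions thus change by one at every step,
        -- always in the same sense.
        climbing : ∀ s M → (∀ t → t ≤ M → ¬ Base (a (s + t))) →
          (∀ t → t ≤ M → position (a (s + t)) ≡ position (a s) + t) ⊎ (∀ t → t ≤ M → position (a (s + t)) + t ≡ position (a s))
        climbing s zero plain = inj₁ λ { zero z≤n → trans (cong (position ∘ a) (+-identityʳ s)) (sym (+-identityʳ _)) }
        climbing s (suc m′) plain with plain-edge (plain 0 z≤n) (plain 1 (s≤s z≤n)) (subst (Adj (a (s + 0))) (cong a (sym (+-suc s 0))) (edge (z~ (s + 0))))
        ... | inj₁ c = inj₁ λ t t≤ → trans (proj₁ (rise t t≤)) (cong (λ k → position (a k) + t) (+-identityʳ s))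
          where
          rise : ∀ t → t ≤ suc m′ → position (a (s + t)) ≡ position (a (s + 0)) + t × (∀ {u} → u ≡ a (s + suc t) → t < suc m′ → Climb (a (s + t)) u)
          rise zero _ = sym (+-identityʳ _) , λ { refl _ → c }
          rise (suc t) t≤ with rise t (≤-trans (n≤1+n t) t≤)
          ... | p , cl = trans (pos-climb (cl refl t≤)) (trans (cong suc p) (sym (+-suc _ t))) , λ { refl lt → next-up (cl refl t≤) lt }
            where
            pos-climb : ∀ {u v} → Climb u v → position v ≡ suc (position u)
            pos-climb (climb e) = sym e
            next-up : Climb (a (s + t)) (a (s + suc t)) → suc t < suc m′ → Climb (a (s + suc t)) (a (s + suc (suc t)))
            next-up c′ lt with plain-edge (plain (suc t) t≤) (plain (suc (suc t)) lt) (subst (Adj (a (s + suc t))) (cong a (sym (+-suc s (suc t)))) (edge (z~ (s + suc t))))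
            ... | inj₁ c″ = c″
            ... | inj₂ c″ = ⊥-elim (z≢ (s + t) (trans (at-inj (climb-unique c′ c″)) (cong z (trans (+-suc s (suc t)) (cong suc (+-suc s t))))))
        ... | inj₂ c = inj₂ λ t t≤ → trans (proj₁ (fall t t≤)) (cong (λ k → position (a k)) (+-identityʳ s))
          where
          fall : ∀ t → t ≤ suc m′ → position (a (s + t)) + t ≡ position (a (s + 0)) × (∀ {u} → u ≡ a (s + suc t) → t < suc m′ → Climb u (a (s + t)))
          fall zero _ = +-identityʳ _ , λ { refl _ → c }
          fall (suc t) t≤ with fall t (≤-trans (n≤1+n t) t≤)
          ... | p , cl = trans (+-suc _ t) (trans (cong (_+ t) (sym (pos-climb (cl refl t≤)))) p) , λ { refl lt → next-down (cl refl t≤) lt }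
            where
            pos-climb : ∀ {u v} → Climb u v → position v ≡ suc (position u)
            pos-climb (climb e) = sym e
            next-down : Climb (a (s + suc t)) (a (s + t)) → suc t < suc m′ → Climb (a (s + suc (suc t))) (a (s + suc t))
            next-down c′ lt with plain-edge (plain (suc t) t≤) (plain (suc (suc t)) lt) (subst (Adj (a (s + suc t))) (cong a (sym (+-suc s (suc t)))) (edge (z~ (s + suc t))))
            ... | inj₂ c″ = c″
            ... | inj₁ c″ = ⊥-elim (z≢ (s + t) (trans (at-inj (climb-unique′ c′ c″)) (cong z (trans (+-suc s (suc t)) (cong suc (+-suc s t))))))

        -- A monotone run of `m + 1` vertices would be injective, but `H` has only `m` vertices.
        not-plain : ∀ s → ¬ (∀ t → t ≤ m → ¬ Base (a (s + t)))
        not-plain s plain with pigeonhole (n<1+n m) (λ (t : Fin (suc m)) → z (s + toℕ t))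
        ... | i , j , i<j , eq with climbing s m plain
        ...   | inj₁ rise = <⇒≢ i<j (+-cancelˡ-≡ (position (a s)) _ _
                (trans (sym (rise (toℕ i) (≤-pred (toℕ<n i)))) (trans (cong (position ∘ at) eq) (rise (toℕ j) (≤-pred (toℕ<n j))))))
        ...   | inj₂ fall = <⇒≢ i<j (+-cancelˡ-≡ (position (a (s + toℕ i))) _ _
                (trans (fall (toℕ i) (≤-pred (toℕ<n i))) (trans (sym (fall (toℕ j) (≤-pred (toℕ<n j)))) (cong (λ x → position (at x) + toℕ j) (sym eq)))))

        after-base : ∀ s → Base (a s) → ∀ t → t ≤ m → Dir (suc t) (a (t + s)) (a (suc t + s))
        after-base s b zero _ = dir-start b (edge (z~ s))
        after-base s b (suc t) t≤ = dir-next (s≤s z≤n) (≤-<-trans t≤ (<-trans (n<1+n m) m<D)) (after-base s b t (<⇒≤ t≤)) (edge (z~ (suc t + s)))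
          (λ eq → z≢ (t + s) (sym (at-inj eq)))

      -- A base vertex occurs within every `m + 1` consecutive vertices of the walk, yet the `m + 1`
      -- vertices after a base vertex are none, since `m + 1` is less than `D`.
      impossible : ⊥
      impossible = not-plain 0 λ t _ b → not-plain (suc t) λ t′ t′≤ →
        subst (λ k → ¬ Base (a k)) (cong suc (+-comm t′ t)) (dir-base (s≤s z≤n) (≤-<-trans (s≤s t′≤) m<D) (after-base t b t′ t′≤))

    -- Running around a cycle forever gives an infinite walk; it never turns back because the cycle
    -- has at least three vertices.
    acyclic : ¬ Cycle H
    acyclic (l , c , c-inj , consecutive , closing) = Cyclic.impossible (c ∘ z) (λ k → step-edge (z k)) (λ k eq → no-return (z k) (c-inj eq))
      where
      K = suc (suc l)
      nxt : Fin (suc K) → Fin (suc K)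
      nxt i with view i
      ... | ‵fromℕ = zero
      ... | ‵inject₁ j = suc j
      z : ℕ → Fin (suc K)
      z zero = zero
      z (suc k) = nxt (z k)
      step-edge : ∀ i → adj H (c i) (c (nxt i)) ≡ true
      step-edge i with view i
      ... | ‵fromℕ = closing
      ... | ‵inject₁ j = consecutive j
      toℕ-nxt : ∀ i → toℕ (nxt i) ≡ suc (toℕ i) ⊎ (toℕ i ≡ K × toℕ (nxt i) ≡ 0)
      toℕ-nxt i with view i
      ... | ‵fromℕ = inj₂ (toℕ-fromℕ K , refl)
      ... | ‵inject₁ j = inj₁ (cong suc (sym (toℕ-inject₁ j)))
      no-return : ∀ i → i ≢ nxt (nxt i)
      no-return i eq with toℕ-nxt i | toℕ-nxt (nxt i)
      ... | inj₁ p | inj₁ q = <⇒≢ (≤-trans (n<1+n (toℕ i)) (n≤1+n _)) (trans (cong toℕ eq) (trans q (cong suc p)))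
      ... | inj₁ p | inj₂ (q , r) = case trans (cong suc (trans (sym r) (cong toℕ (sym eq)))) (trans (sym p) q) of λ ()
      ... | inj₂ (p , r) | inj₁ q = case trans (sym p) (trans (cong toℕ eq) (trans q (cong suc r))) of λ ()
      ... | inj₂ (p , r) | inj₂ (q , _) = case trans (sym r) q of λ ()

    -- Both vertices are base vertices. A non-backtracking walk between them would have fewer than
    -- `D` edges, since its vertices are distinct vertices of `H`, and so it could not end at a base
    -- vertex.
    one-branching : ∀ {c c′} → Deg3 H c → Deg3 H c′ → Reach H c c′ → c ≡ c′
    one-branching {c} d d′ r with reach⇒nb H r
    ... | [] , _ , eq = eq
    ... | u ∷ p , w , refl = ⊥-elim (go p 1 w (s≤s z≤n) (dir-start (branching-base d) (edge (nb-head H w))) bound (branching-base d′))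
      where
      bound : 1 + length p < D
      bound = ≤-<-trans (≤-trans (n≤1+n _) (unique-length (Acyclic.nb-unique H acyclic w))) (<-trans (n<1+n m) m<D)
      go : ∀ {x y} p k → NonBack H (x ∷ y ∷ p) → 0 < k → Dir k (at x) (at y) → k + length p < D → ¬ Base (at (endOf H y p))
      go [] k _ pos dir lt = dir-base pos (≤-<-trans (m≤m+n k 0) lt) dir
      go (v ∷ p) k (more _ x≢v w) pos dir lt = go p (suc k) w (s≤s z≤n)
        (dir-next pos (≤-<-trans (m≤m+n k _) lt) dir (edge (nb-head H w)) (x≢v ∘ sym ∘ at-inj)) (subst (_< D) (+-suc k (length p)) lt)

    in-S : InS H
    in-S = acyclic , Acyclic.Local.at-most-three-leaves H acyclic no-four one-branching

-- Every subexpression of a k-expression has at most 3k vertices with neighbours outside, hence meets at most 3k rows.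
module Wide (N E : ℕ) (0<E : 0 < E) (k : ℕ) (wide : k * 3 + k * 3 + suc (k * 3) ≤ N) where

  open Host N E 0<E

  private
    K : ℕ
    K = k * 3

    V = Fin order

    encode-inj : ∀ {u v} → encode u ≡ encode v → u ≡ v
    encode-inj {u} {v} e = trans (sym (decode-encode u)) (trans (cong decode e) (decode-encode v))

    encode-edge : ∀ {u v} → Adj u v → adj host (encode u) (encode v) ≡ true
    encode-edge {u} {v} a = host⁺ (subst₂ Adj (sym (decode-encode u)) (sym (decode-encode v)) a)

    pick : ∀ {a} {A : Set a} {c} (l : List A) → c ≤ length l → Fin c → A
    pick l p t = lookup l (inject≤ t p)

    pick∈ : ∀ {a} {A : Set a} {c} (l : List A) (p : c ≤ length l) t → pick l p t ∈ l
    pick∈ l p t = ∈-lookup _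

    pick-inj : ∀ {a} {A : Set a} {c} {l : List A} (p : c ≤ length l) → Unique l → ∀ {s t} → pick l p s ≡ pick l p t → s ≡ t
    pick-inj p u e = Finₚ.inject≤-injective p p _ _ (lookup-unique u e)

  module Part {s : ℕ} (h : Fin s → V) where

    In : V → Set
    In v = ∃ λ a → h a ≡ v

    abstract
      in? : ∀ v → Dec (In v)
      in? v = any? λ a → h a ≟ v

    Boundary : V → Set
    Boundary x = In x × ∃ λ v → ¬ In v × adj host x v ≡ true

    Met : Fin N → Set
    Met i = ∃ λ p → In (encode (i , i , p))

    abstract
      met? : ∀ i → Dec (Met i)
      met? i = any? λ p → in? (encode (i , i , p))

    met : List (Fin N)
    met = filter met? (allFin N)

    met-unique : Unique met
    met-unique = Uniqueₚ.filter⁺ met? (Uniqueₚ.allFin⁺ N)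

    ∈-met : ∀ {i} → i ∈ met → Met i
    ∈-met p = proj₂ (∈-filter⁻ met? {xs = allFin N} p)

    above : ∀ {p p′ : Fin L} {d} → toℕ p + suc d ≡ toℕ p′ → suc (toℕ p) < L
    above {p} {p′} {d} e = ≤-<-trans (≤-trans (m≤m+n (suc (toℕ p)) d) (≤-reflexive (trans (sym (+-suc (toℕ p) d)) e))) (toℕ<n p′)

    below : ∀ {p p′ : Fin L} {d} → toℕ p′ + suc d ≡ toℕ p → toℕ p′ + d < L
    below {p} {p′} {d} e = <-trans (≤-reflexive (trans (sym (+-suc (toℕ p′) d)) e)) (toℕ<n p)

    line-boundary : ∀ i j p p′ → In (encode (i , j , p)) → ¬ In (encode (i , j , p′)) → ∃ λ q → Boundary (encode (i , j , q))
    line-boundary i j p p′ p∈ p∉ with ≤-total (toℕ p) (toℕ p′)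
    ... | inj₁ le = rise (toℕ p′ ∸ toℕ p) p p∈ (m+[n∸m]≡n le)
      where
      rise : ∀ d p → In (encode (i , j , p)) → toℕ p + d ≡ toℕ p′ → ∃ λ q → Boundary (encode (i , j , q))
      rise zero p p∈ e = ⊥-elim (p∉ (subst (λ q → In (encode (i , j , q))) (toℕ-injective (trans (sym (+-identityʳ _)) e)) p∈))
      rise (suc d) p p∈ e with in? (encode (i , j , fromℕ< (above {p} {p′} e)))
      ... | yes q∈ = rise d _ q∈ (trans (cong (_+ d) (toℕ-fromℕ< (above {p} {p′} e))) (trans (sym (+-suc (toℕ p) d)) e))
      ... | no q∉ = p , p∈ , _ , q∉ , encode-edge (up (sym (toℕ-fromℕ< (above {p} {p′} e))))
    ... | inj₂ le = fall (toℕ p ∸ toℕ p′) p p∈ (m+[n∸m]≡n le)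
      where
      fall : ∀ d p → In (encode (i , j , p)) → toℕ p′ + d ≡ toℕ p → ∃ λ q → Boundary (encode (i , j , q))
      fall zero p p∈ e = ⊥-elim (p∉ (subst (λ q → In (encode (i , j , q))) (toℕ-injective (trans (sym e) (+-identityʳ _))) p∈))
      fall (suc d) p p∈ e with in? (encode (i , j , fromℕ< (below {p} {p′} e)))
      ... | yes q∈ = fall d _ q∈ (sym (toℕ-fromℕ< (below {p} {p′} e)))
      ... | no q∉ = p , p∈ , _ , q∉ , encode-edge (down (trans (sym e) (trans (+-suc (toℕ p′) d) (cong suc (sym (toℕ-fromℕ< (below {p} {p′} e)))))))

    private
      slot-bound : ∀ {c} → c ≤ 2 * N → suc c * D < L
      slot-bound {c} p = s≤s (*-monoˡ-≤ D (≤-trans (s≤s p) (≤-trans (≤-reflexive (+-comm 1 (2 * N))) (+-monoʳ-≤ (2 * N) (s≤s z≤n)))))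

      last : Fin L
      last = fromℕ ((2 * N + 2) * D)

      index-bound : ∀ (j : Fin N) → suc (2 * toℕ j) ≤ 2 * N
      index-bound j = ≤-trans (n≤1+n _) (≤-trans (≤-reflexive (sym (*-suc 2 (toℕ j)))) (*-monoʳ-≤ 2 (toℕ<n j)))

      out-slot inn-slot : Fin N → Fin L
      out-slot j = fromℕ< (slot-bound {2 * toℕ j} (<⇒≤ (index-bound j)))
      inn-slot i = fromℕ< (slot-bound {suc (2 * toℕ i)} (index-bound i))

      out-slot-inj : ∀ {j j′} → out-slot j ≡ out-slot j′ → j ≡ j′
      out-slot-inj {j} {j′} e = toℕ-injective (*-cancelˡ-≡ (toℕ j) (toℕ j′) 2 (suc-injective (*-cancelʳ-≡ (suc (2 * toℕ j)) (suc (2 * toℕ j′)) D {{>-nonZero 0<D}}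
        (trans (sym (toℕ-fromℕ< _)) (trans (cong toℕ e) (toℕ-fromℕ< _))))))

    data Located (i j : Fin N) : V → Set where
      on-line : ∀ q → Located i j (encode (i , j , q))
      at-slot : Located i j (encode (i , i , out-slot j))

    located-inj : ∀ {i j j′ x y} → i ≢ j → i ≢ j′ → Located i j x → Located i j′ y → x ≡ y → j ≡ j′
    located-inj _ _ (on-line _) (on-line _) e = cong (proj₁ ∘ proj₂) (encode-inj e)
    located-inj ne _ (on-line _) at-slot e = ⊥-elim (ne (sym (cong (proj₁ ∘ proj₂) (encode-inj e))))
    located-inj _ ne at-slot (on-line _) e = ⊥-elim (ne (cong (proj₁ ∘ proj₂) (encode-inj e)))
    located-inj _ _ at-slot at-slot e = out-slot-inj (cong (proj₂ ∘ proj₂) (encode-inj e))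

    -- Along the line from a full row to an unmet row the part must be left somewhere: at the
    -- attachment on row `i`, inside the line, or at its last vertex, whose neighbour on row `j`
    -- lies outside.
    link-boundary : ∀ {i j} → i ≢ j → (∀ p → In (encode (i , i , p))) → ¬ Met j → ∃ λ x → Boundary x × Located i j x
    link-boundary {i} {j} ne full ¬met with in? (encode (i , j , zero))
    ... | no ∉ = _ , (full (out-slot j) , _ , ∉ , encode-edge (in0 ne refl (toℕ-fromℕ< _))) , at-slot
    ... | yes ∈₀ with in? (encode (i , j , last))
    ...   | no ∉ = let (q , b) = line-boundary i j zero last ∈₀ ∉ in _ , b , on-line q
    ...   | yes ∈ᴸ = _ , (∈ᴸ , encode (j , j , inn-slot i) , (λ q → ¬met (inn-slot i , q)) ,
              encode-edge (outL ne (cong suc (toℕ-fromℕ _)) (toℕ-fromℕ< _))) , on-line last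

  -- What the operations surrounding a subexpression can still do to it. They see its vertices only
  -- through labels: equally labelled vertices get the same outside neighbours, and edges added
  -- inside are a function `later` of the two labels. The invariant passes from an expression to its
  -- parts.
  record Inv (e : Expr k) (h : Fin (size e) → V) : Set where
    open Part h using (In)
    field
      h-inj   : Injective _≡_ _≡_ h
      outside : ∀ {a b} → label e a ≡ label e b → ∀ {v} → ¬ In v → adj host (h a) v ≡ adj host (h b) v
      later   : Fin k → Fin k → Bool
      inside  : ∀ a b → adj host (h a) (h b) ≡ semAdj e a b ∨ later (label e a) (label e b)
  open Inv

  module _ {e : Expr k} {h : Fin (size e) → V} (I : Inv e h) where
    open Part h

    -- For each label one outside neighbour of one boundary vertex is fixed; by `outside` it is
    -- adjacent to all boundary vertices with that label. It has at most three neighbours, so label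
    -- and `tag` together tell boundary vertices apart.
    few-boundary : (β : Fin (suc K) → V) → Injective _≡_ _≡_ β → (∀ t → Boundary (β t)) → ⊥
    few-boundary β β-inj bd = clash (pigeonhole (n<1+n K) code)
      where
      a : Fin (suc K) → Fin (size e)
      a t = proj₁ (proj₁ (bd t))
      a-eq : ∀ t → h (a t) ≡ β t
      a-eq t = proj₂ (proj₁ (bd t))
      outer : Fin (suc K) → V
      outer t = proj₁ (proj₂ (bd t))
      lb : Fin (suc K) → Fin k
      lb t = label e (a t)
      shared : Fin k → V
      shared l with any? (λ t → lb t ≟ l)
      ... | yes (t , _) = outer t
      ... | no _ = outer zero
      shared-adj : ∀ t → adj host (β t) (shared (lb t)) ≡ true
      shared-adj t with any? (λ t′ → lb t′ ≟ lb t)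
      ... | no n = ⊥-elim (n (t , refl))
      ... | yes (t′ , eq) = trans (cong (λ x → adj host x (outer t′)) (sym (a-eq t)))
            (trans (outside I (sym eq) (proj₁ (proj₂ (proj₂ (bd t′))))) (trans (cong (λ x → adj host x (outer t′)) (a-eq t′)) (proj₂ (proj₂ (proj₂ (bd t′))))))
      A : ∀ t → Adj (decode (shared (lb t))) (decode (β t))
      A t = Adj-sym (host⁻ (shared-adj t))
      code : Fin (suc K) → Fin K
      code t = combine (lb t) (tag (A t))
      same-vertex : ∀ {l l′ x y} → l ≡ l′ → (a : Adj (decode (shared l)) x) (b : Adj (decode (shared l′)) y) → tag a ≡ tag b → x ≡ y
      same-vertex refl a b = tag-inj a b
      clash : (∃₂ λ s t → s Fin.< t × code s ≡ code t) → ⊥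
      clash (s , t , lt , eq) with combine-injective _ _ _ _ eq
      ... | l≡ , t≡ = Finₚ.<⇒≢ lt (β-inj (decode-inj (same-vertex l≡ (A s) (A t) t≡)))

    few-met : (∀ i → ∃ λ p → ¬ In (encode (i , i , p))) → length met ≤ K
    few-met open-row = ≮⇒≥ λ lt → few-boundary (β lt)
        (λ {s} {t} eq → pick-inj lt met-unique (cong proj₁ (encode-inj eq))) (λ t → proj₂ (bd lt t))
      where
      bd : ∀ (lt : K < length met) t → ∃ λ q → Boundary (encode (pick met lt t , pick met lt t , q))
      bd lt t = let i = pick met lt t ; (p , p∈) = ∈-met (pick∈ met lt t) ; (p′ , p∉) = open-row i in line-boundary i i p p′ p∈ p∉
      β : K < length met → Fin (suc K) → V
      β lt t = encode (pick met lt t , pick met lt t , proj₁ (bd lt t))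

    -- A full row sends a separate line to each unmet row, and each line supplies its own boundary
    -- vertex by `link-boundary`; more than `K` of them contradict `few-boundary`.
    no-full-row : ∀ ys → Unique ys → (∀ {j} → j ∈ ys → ¬ Met j) → K < length ys → ∀ i → ∃ λ p → ¬ In (encode (i , i , p))
    no-full-row ys uys unmet lt i with any? (λ p → ¬? (in? (encode (i , i , p))))
    ... | yes r = r
    ... | no none = ⊥-elim (few-boundary (λ t → proj₁ (bd t)) (λ {s} {t} eq →
        pick-inj lt uys (located-inj (ne s) (ne t) (proj₂ (proj₂ (bd s))) (proj₂ (proj₂ (bd t))) eq)) (λ t → proj₁ (proj₂ (bd t))))
      where
      full : ∀ p → In (encode (i , i , p))
      full p = decidable-stable (in? _) λ n → none (p , n)
      ne : ∀ t → i ≢ pick ys lt t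
      ne t e = unmet (pick∈ ys lt t) (zero , subst (λ r → In (encode (r , r , zero))) e (full zero))
      bd : ∀ t → ∃ λ x → Boundary x × Located i (pick ys lt t) x
      bd t = link-boundary (ne t) full (unmet (pick∈ ys lt t))

  private
    short-list : ∀ {a} {A : Set a} (l : List A) → Unique l → (∀ {x y} → x ∈ l → y ∈ l → x ≡ y) → length l ≤ 1
    short-list [] _ _ = z≤n
    short-list (x ∷ []) _ _ = s≤s z≤n
    short-list (x ∷ y ∷ l) ((p ∷ _) ∷ _) h = ⊥-elim (p (h (here refl) (there (here refl))))

  -- Only a disjoint union gains rows. It combines at most `K` met rows from either part, so by
  -- `wide` more than `K` rows are unmet; hence no row is full, every met row has a boundary vertex,
  -- and their number is at most `K` again.
  few-rows : ∀ e (h : Fin (size e) → V) → Inv e h → length (Part.met h) ≤ K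
  few-rows empty h I = none (Part.met h) λ p → case proj₂ (Part.∈-met h p) of λ ()
    where
    none : ∀ l → (∀ {i} → i ∈ l → ⊥) → length l ≤ K
    none [] _ = z≤n
    none (x ∷ l) n = ⊥-elim (n (here refl))
  few-rows (vertex i) h I = ≤-trans (short-list (Part.met h) (Part.met-unique h) one-row)
      (≤-trans (s≤s z≤n) (*-monoˡ-≤ 3 (≤-trans (s≤s z≤n) (toℕ<n i))))
    where
    one-row : ∀ {x y} → x ∈ Part.met h → y ∈ Part.met h → x ≡ y
    one-row x∈ y∈ with Part.∈-met h x∈ | Part.∈-met h y∈
    ... | p , zero , e | q , zero , e′ = cong proj₁ (encode-inj (trans (sym e) e′))
  few-rows (e ⊕ f) h I = few-met I (no-full-row I unmet unmet-unique (λ j∈ → proj₂ (∈-filter⁻ (¬? ∘ met?) {xs = allFin N} j∈)) many)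
    where
    open Part h
    h₁ : Fin (size e) → V
    h₁ a = h (a ↑ˡ size f)
    h₂ : Fin (size f) → V
    h₂ b = h (size e ↑ʳ b)
    label₁ : ∀ a → label (e ⊕ f) (a ↑ˡ size f) ≡ label e a
    label₁ a = cong [ label e , label f ]′ (splitAt-↑ˡ (size e) a (size f))
    label₂ : ∀ b → label (e ⊕ f) (size e ↑ʳ b) ≡ label f b
    label₂ b = cong [ label e , label f ]′ (splitAt-↑ʳ (size e) (size f) b)
    sem₁ : ∀ a b → semAdj (e ⊕ f) (a ↑ˡ size f) (b ↑ˡ size f) ≡ semAdj e a b
    sem₁ a b rewrite splitAt-↑ˡ (size e) a (size f) | splitAt-↑ˡ (size e) b (size f) = refl
    sem₂ : ∀ a b → semAdj (e ⊕ f) (size e ↑ʳ a) (size e ↑ʳ b) ≡ semAdj f a b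
    sem₂ a b rewrite splitAt-↑ʳ (size e) (size f) a | splitAt-↑ʳ (size e) (size f) b = refl
    sem₁₂ : ∀ a b → semAdj (e ⊕ f) (a ↑ˡ size f) (size e ↑ʳ b) ≡ false
    sem₁₂ a b rewrite splitAt-↑ˡ (size e) a (size f) | splitAt-↑ʳ (size e) (size f) b = refl
    sem₂₁ : ∀ a b → semAdj (e ⊕ f) (size e ↑ʳ b) (a ↑ˡ size f) ≡ false
    sem₂₁ a b rewrite splitAt-↑ˡ (size e) a (size f) | splitAt-↑ʳ (size e) (size f) b = refl
    cover : ∀ {v} → In v → Part.In h₁ v ⊎ Part.In h₂ v
    cover (x , eq) with splitAt (size e) x in ex
    ... | inj₁ a = inj₁ (a , trans (cong h (Finₚ.splitAt⁻¹-↑ˡ ex)) eq)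
    ... | inj₂ b = inj₂ (b , trans (cong h (Finₚ.splitAt⁻¹-↑ʳ {m = size e} ex)) eq)
    I₁ : Inv e h₁
    I₁ = record
      { h-inj = λ eq → ↑ˡ-injective (size f) _ _ (h-inj I eq)
      ; outside = λ {a} {b} eq {v} v∉ → cross eq v∉ (Part.in? h₂ v)
      ; later = later I
      ; inside = λ a b → trans (inside I _ _) (cong₂ _∨_ (sem₁ a b) (cong₂ (later I) (label₁ a) (label₁ b))) }
      where
      cross : ∀ {a b v} → label e a ≡ label e b → ¬ Part.In h₁ v → Dec (Part.In h₂ v) → adj host (h₁ a) v ≡ adj host (h₁ b) v
      cross {a} {b} eq v∉ (yes (c , refl)) = trans (inside I _ _) (trans (cong₂ _∨_ (trans (sem₁₂ a c) (sym (sem₁₂ b c)))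
        (cong (λ l → later I l _) (trans (label₁ a) (trans eq (sym (label₁ b)))))) (sym (inside I _ _)))
      cross {a} {b} eq v∉ (no v∉₂) = outside I (trans (label₁ a) (trans eq (sym (label₁ b)))) λ v∈ → [ v∉ , v∉₂ ]′ (cover v∈)
    I₂ : Inv f h₂
    I₂ = record
      { h-inj = λ eq → ↑ʳ-injective (size e) _ _ (h-inj I eq)
      ; outside = λ {a} {b} eq {v} v∉ → cross eq v∉ (Part.in? h₁ v)
      ; later = later I
      ; inside = λ a b → trans (inside I _ _) (cong₂ _∨_ (sem₂ a b) (cong₂ (later I) (label₂ a) (label₂ b))) }
      where
      cross : ∀ {a b v} → label f a ≡ label f b → ¬ Part.In h₂ v → Dec (Part.In h₁ v) → adj host (h₂ a) v ≡ adj host (h₂ b) v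
      cross {a} {b} eq v∉ (yes (c , refl)) = trans (inside I _ _) (trans (cong₂ _∨_ (trans (sem₂₁ c a) (sym (sem₂₁ c b)))
        (cong (λ l → later I l _) (trans (label₂ a) (trans eq (sym (label₂ b)))))) (sym (inside I _ _)))
      cross {a} {b} eq v∉ (no v∉₁) = outside I (trans (label₂ a) (trans eq (sym (label₂ b)))) λ v∈ → [ v∉₁ , v∉ ]′ (cover v∈)
    unmet : List (Fin N)
    unmet = filter (¬? ∘ met?) (allFin N)
    unmet-unique : Unique unmet
    unmet-unique = Uniqueₚ.filter⁺ (¬? ∘ met?) (Uniqueₚ.allFin⁺ N)
    met-bound : length met ≤ K + K
    met-bound = ≤-trans (unique-⊆-length met-unique (All.tabulate λ i∈ → from (∈-met i∈)))
        (≤-trans (≤-reflexive (length-++ (Part.met h₁))) (+-mono-≤ (few-rows e h₁ I₁) (few-rows f h₂ I₂)))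
      where
      from : ∀ {i} → Met i → i ∈ Part.met h₁ ++ Part.met h₂
      from {i} (p , v∈) with cover v∈
      ... | inj₁ q = ∈-++⁺ˡ (∈-filter⁺ (Part.met? h₁) (∈-allFin i) (p , q))
      ... | inj₂ q = ∈-++⁺ʳ (Part.met h₁) (∈-filter⁺ (Part.met? h₂) (∈-allFin i) (p , q))
    many : K < length unmet
    many = +-cancelˡ-≤ (K + K) (suc K) _ (≤-trans wide (≤-trans (≤-reflexive
      (trans (sym (length-tabulate id)) (trans (↭-length (filter-split met? (allFin N))) (length-++ met)))) (+-monoˡ-≤ (length unmet) met-bound)))
  few-rows (η i j i≢j e) h I = few-rows e h (record
    { h-inj = h-inj I ; outside = outside I
    ; later = λ l l′ → ((⌊ l ≟ i ⌋ ∧ ⌊ l′ ≟ j ⌋) ∨ (⌊ l ≟ j ⌋ ∧ ⌊ l′ ≟ i ⌋)) ∨ later I l l′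
    ; inside = λ a b → trans (inside I a b) (Boolₚ.∨-assoc (semAdj e a b) _ _) })
  few-rows (ρ i j e) h I = few-rows e h (record
    { h-inj = h-inj I ; outside = λ eq → outside I (relabelled eq) ; later = λ l l′ → later I (φ l) (φ l′)
    ; inside = λ a b → trans (inside I a b) (cong₂ (λ l l′ → semAdj e a b ∨ later I l l′) (label-φ a) (label-φ b)) })
    where
    φ : Fin k → Fin k
    φ l = if ⌊ l ≟ i ⌋ then j else l
    label-φ : ∀ a → label (ρ i j e) a ≡ φ (label e a)
    label-φ a with label e a ≟ i
    ... | yes _ = refl
    ... | no _ = refl
    relabelled : ∀ {a b} → label e a ≡ label e b → label (ρ i j e) a ≡ label (ρ i j e) b
    relabelled {a} {b} eq = trans (label-φ a) (trans (cong φ eq) (sym (label-φ b)))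

  unbounded : ¬ CWAtMost host k
  unbounded (e , f , (f-inj , f-surj) , f-adj) = <⇒≱ (≤-trans (m≤n+m (suc K) (K + K)) wide)
      (≤-trans (≤-trans (≤-reflexive (sym (length-tabulate id))) (unique-⊆-length (Uniqueₚ.allFin⁺ N) (All.tabulate λ {i} _ → ∈-filter⁺ (Part.met? h) (∈-allFin i) (zero , everywhere _))))
        (few-rows e h I))
    where
    h : Fin (size e) → V
    h a = proj₁ (f-surj a)
    f-h : ∀ a → f (h a) ≡ a
    f-h a = proj₂ (f-surj a) refl
    everywhere : ∀ v → Part.In h v
    everywhere v = f v , f-inj (f-h (f v))
    I : Inv e h
    I = record
      { h-inj = λ {a} {b} eq → trans (sym (f-h a)) (trans (cong f eq) (f-h b))
      ; outside = λ _ v∉ → ⊥-elim (v∉ (everywhere _))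
      ; later = λ _ _ → false
      ; inside = λ a b → trans (f-adj (h a) (h b)) (trans (cong₂ (semAdj e) (f-h a) (f-h b)) (sym (Boolₚ.∨-identityʳ _))) }

-- Both directions for a finite list of excluded graphs

private
  OrderBelow : ℕ → Σ ℕ Graph → Set
  OrderBelow b H = suc (proj₁ H) < b

  bounded-orders : (M : List (Σ ℕ Graph)) → ∃ λ b → All (OrderBelow b) M
  bounded-orders [] = 0 , []
  bounded-orders ((m , _) ∷ M) with bounded-orders M
  ... | b , al = (2 + m) + b , m≤m+n (2 + m) b ∷ All.map (λ p → ≤-trans p (m≤n+m b (2 + m))) al

theorem17 : (M : List (Σ ℕ Graph)) → All (λ H → Bipartite (proj₂ H)) M →
    BoundedCliqueWidth (λ G → Bipartite G × ¬ Any (λ H → SI G (proj₂ H)) M)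
      ⇔ Any (λ H → InS (proj₂ H)) M
theorem17 M _ = mk⇔ forward backward
  where
  forward : BoundedCliqueWidth (λ G → Bipartite G × ¬ Any (λ H → SI G (proj₂ H)) M) → Any (λ H → InS (proj₂ H)) M
  forward (k , bounded) with bounded-orders M
  ... | b , below = decide (Any.any? (λ H → emb? {H = proj₂ H} {G = host}) M)
    where
    -- The number of rows, 9k + 1, is what `Wide` requires. The spacing, twice `suc b`, exceeds the
    -- order of every member of `M` by more than one, so a member that embeds in the host satisfies
    -- the bound of `Subgraph`.
    open Host (k * 3 + k * 3 + suc (k * 3)) (suc b) (s≤s z≤n)
    decide : Dec (Any (λ H → Emb (proj₂ H) host) M) → Any (λ H → InS (proj₂ H)) M
    decide (yes found) =
      let ((m , H) , H∈ , e) = find found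
      in lose H∈ (Subgraph.in-S H (≤-trans (All.lookup below H∈) (≤-trans (n≤1+n b) (m≤m+n (suc b) (suc b)))) e)
    decide (no none) = ⊥-elim (Wide.unbounded _ (suc b) (s≤s z≤n) k ≤-refl
      (bounded order host (host-bipartite , λ si → none (Any.map SI⇒Emb si))))

  backward : Any (λ H → InS (proj₂ H)) M → BoundedCliqueWidth (λ G → Bipartite G × ¬ Any (λ H → SI G (proj₂ H)) M)
  backward found with find found
  ... | (m , H) , H∈ , s = _ , λ n G (bip , ¬si) → Upper.clique-width-bound m {H = H} {G = G} bip (coordinates H s) (λ si → ¬si (lose H∈ si))
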